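{- The problem \textsc{Poset $\exists$-FO-Model Checking} is fixed-parameter tractable when parameterized by the size of the formula and the width of the input poset. Precisely, there is a computable function $h$ and an algorithm that, given an existential first-order sentence $\phi$ and a finite poset $\mathcal{P}=(P,\leq^P)$ with $n=|P|$ elements and width $w$, decides whether $\mathcal{P}\models\phi$ in time $h(|\phi|,w)\cdot O(n^2)$.
   Context: A poset $\mathcal{P}=(P,\leq^P)$ is a set with a reflexive, antisymmetric, transitive relation. An antichain is a set of pairwise incomparable elements; the width of $\mathcal{P}$ is the maximum size of an antichain. Formulas are relational first-order formulas over the vocabulary consisting of a single binary relation symbol $\leq$ (interpreted by $\leq^P$) together with equality; atoms are $x=y$ and $x\leq y$. An existential first-order sentence is a sentence in prefix normal form (all quantifiers in front, negations only in front of atoms) in which all quantifiers are existential. \textsc{Poset $\exists$-FO-Model Checking}: given an existential FO sentence $\phi$ and a poset $\mathcal{P}$, decide whether $\mathcal{P}\models\phi$; parameters are $|\phi|$ and the width of $\mathcal{P}$. A parameterized problem is fixed-parameter tractable if instances $(x,k)$ can be solved in time $f(k)\cdot|x|^c$ for a computable $f$ and constant $c$. -}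

module Defs where

open import Data.Bool.Base using (if_then_else_)
open import Data.Fin.Base using (Fin; toℕ)
open import Data.Fin.Subset using (Subset; _∈_; ∣_∣)
open import Data.List.Base using (List; []; _∷_; _++_; allFin; concatMap; drop; head; length; map)
open import Data.Maybe.Base using (Maybe; just; nothing)
open import Data.Nat.Base using (ℕ; suc; _+_; _∸_; _*_; _≤_; _≡ᵇ_; ⌊_/2⌋)
open import Data.Product.Base using (∃-syntax; Σ-syntax; _×_)
open import Data.Sum.Base using (_⊎_)
open import Data.Vec.Base as Vec using (Vec; lookup)
open import Level using (0ℓ)
open import Relation.Binary.Core using (Rel)
open import Relation.Binary.PropositionalEquality.Core using (_≡_; _≢_)
open import Relation.Binary.Structures using (IsDecPartialOrder)
open import Relation.Nullary.Decidable.Core using (does)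
open import Relation.Nullary.Negation.Core using (¬_)

-- The elements are numbered because a poset is an input of an algorithm; the
-- numbering is unrelated to the order.
record FinPoset (n : ℕ) : Set₁ where
  field
    _⊑_               : Rel (Fin n) 0ℓ
    isDecPartialOrder : IsDecPartialOrder _≡_ _⊑_

  open IsDecPartialOrder isDecPartialOrder public
    using () renaming (_≤?_ to _⊑?_)

module _ {n : ℕ} (P : FinPoset n) where
  open FinPoset P

  Antichain : Subset n → Set
  Antichain S = ∀ {x y} → x ∈ S → y ∈ S → x ≢ y → ¬ (x ⊑ y) × ¬ (y ⊑ x)

  HasWidth : ℕ → Set
  HasWidth w = (∃[ S ] Antichain S × ∣ S ∣ ≡ w)
             × (∀ S → Antichain S → ∣ S ∣ ≤ w)

-- Variables are de Bruijn indices; k is the number of free variables.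
data Atom (k : ℕ) : Set where
  _≐_ _≼_ : Fin k → Fin k → Atom k

data Matrix (k : ℕ) : Set where
  pos neg   : Atom k → Matrix k
  _∧′_ _∨′_ : Matrix k → Matrix k → Matrix k

data ∃Formula (k : ℕ) : Set where
  matrix : Matrix k → ∃Formula k
  ex     : ∃Formula (suc k) → ∃Formula k

∃Sentence : Set
∃Sentence = ∃Formula 0

module _ {n : ℕ} (P : FinPoset n) where
  open FinPoset P

  ⟦_⟧ᴬ : ∀ {k} → Atom k → Vec (Fin n) k → Set
  ⟦ x ≐ y ⟧ᴬ ρ = lookup ρ x ≡ lookup ρ y
  ⟦ x ≼ y ⟧ᴬ ρ = lookup ρ x ⊑ lookup ρ y

  ⟦_⟧ᴹ : ∀ {k} → Matrix k → Vec (Fin n) k → Set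
  ⟦ pos α ⟧ᴹ    ρ = ⟦ α ⟧ᴬ ρ
  ⟦ neg α ⟧ᴹ    ρ = ¬ ⟦ α ⟧ᴬ ρ
  ⟦ ψ₁ ∧′ ψ₂ ⟧ᴹ ρ = ⟦ ψ₁ ⟧ᴹ ρ × ⟦ ψ₂ ⟧ᴹ ρ
  ⟦ ψ₁ ∨′ ψ₂ ⟧ᴹ ρ = ⟦ ψ₁ ⟧ᴹ ρ ⊎ ⟦ ψ₂ ⟧ᴹ ρ

  ⟦_⟧ : ∀ {k} → ∃Formula k → Vec (Fin n) k → Set
  ⟦ matrix ψ ⟧ ρ = ⟦ ψ ⟧ᴹ ρ
  ⟦ ex φ ⟧     ρ = ∃[ a ] ⟦ φ ⟧ (a Vec.∷ ρ)

infix 4 _⊨_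

_⊨_ : ∀ {n} → FinPoset n → ∃Sentence → Set
P ⊨ φ = ⟦_⟧ P φ Vec.[]

-- Polish notation, one number per symbol: 0 is ∃, 1 is ∧, 2 is ∨, 3 is ¬,
-- 4 is =, 5 is ≤.  The code is self-delimiting.
codeᴬ : ∀ {k} → Atom k → List ℕ
codeᴬ (x ≐ y) = 4 ∷ toℕ x ∷ toℕ y ∷ []
codeᴬ (x ≼ y) = 5 ∷ toℕ x ∷ toℕ y ∷ []

codeᴹ : ∀ {k} → Matrix k → List ℕ
codeᴹ (pos α)    = codeᴬ α
codeᴹ (neg α)    = 3 ∷ codeᴬ α
codeᴹ (ψ₁ ∧′ ψ₂) = 1 ∷ codeᴹ ψ₁ ++ codeᴹ ψ₂
codeᴹ (ψ₁ ∨′ ψ₂) = 2 ∷ codeᴹ ψ₁ ++ codeᴹ ψ₂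

code : ∀ {k} → ∃Formula k → List ℕ
code (matrix ψ) = codeᴹ ψ
code (ex φ)     = 0 ∷ code φ

∥_∥ : ∃Sentence → ℕ
∥ φ ∥ = length (code φ)

-- The number of elements followed by the n × n matrix of the order, row by row.
codePoset : ∀ {n} → FinPoset n → List ℕ
codePoset {n} P = n ∷ concatMap row (allFin n)
  where
  open FinPoset P
  row : Fin n → List ℕ
  row i = map (λ j → if does (i ⊑? j) then 1 else 0) (allFin n)

encode : ∀ {n} → ∃Sentence → FinPoset n → List ℕ
encode φ P = code φ ++ codePoset P

-- Random access machines with an input tape and uniform cost: every instruction
-- takes one step, and registers hold arbitrary natural numbers.  There is no
-- multiplication: at unit cost it would make the machine unreasonably powerful.
--
-- r, a, b are register addresses, l is an instruction number.
data Instr : Set where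
  const       : (r k : ℕ) → Instr
  copy half   : (r a : ℕ) → Instr
  add sub     : (r a b : ℕ) → Instr
  load store  : (r a : ℕ) → Instr     -- mem[r] := mem[mem[a]], mem[mem[r]] := mem[a]
  read        : (r : ℕ) → Instr
  jump        : (l : ℕ) → Instr
  jumpIfZero  : (r l : ℕ) → Instr

Program : Set
Program = List Instr

record State : Set where
  constructor state
  field
    pc    : ℕ
    input : List ℕ          -- the part of the input not yet read
    mem   : ℕ → ℕ

_[_≔_] : (ℕ → ℕ) → ℕ → ℕ → (ℕ → ℕ)
(m [ r ≔ v ]) a = if a ≡ᵇ r then v else m a

exec : Instr → State → State
exec (const r k)            (state pc xs m) = state (suc pc) xs (m [ r ≔ k ])
exec (copy r a)             (state pc xs m) = state (suc pc) xs (m [ r ≔ m a ])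
exec (half r a)             (state pc xs m) = state (suc pc) xs (m [ r ≔ ⌊ m a /2⌋ ])
exec (add r a b)            (state pc xs m) = state (suc pc) xs (m [ r ≔ m a + m b ])
exec (sub r a b)            (state pc xs m) = state (suc pc) xs (m [ r ≔ m a ∸ m b ])
exec (load r a)             (state pc xs m) = state (suc pc) xs (m [ r ≔ m (m a) ])
exec (store r a)            (state pc xs m) = state (suc pc) xs (m [ m r ≔ m a ])
exec (read r)               (state pc [] m) = state (suc pc) [] (m [ r ≔ 0 ])
exec (read r)         (state pc (x ∷ xs) m) = state (suc pc) xs (m [ r ≔ x ])
exec (jump l)               (state pc xs m) = state l xs m
exec (jumpIfZero r l)       (state pc xs m) = state (if m r ≡ᵇ 0 then l else suc pc) xs m

fetch : Program → ℕ → Maybe Instr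
fetch p l = head (drop l p)

-- The program halts when the program counter leaves it; the index t counts the
-- executed instructions.
data _⊢_⇓[_]_ (p : Program) : State → ℕ → State → Set where
  halt : ∀ {s} → fetch p (State.pc s) ≡ nothing → p ⊢ s ⇓[ 0 ] s
  step : ∀ {s i t s′} → fetch p (State.pc s) ≡ just i →
         p ⊢ exec i s ⇓[ t ] s′ → p ⊢ s ⇓[ suc t ] s′

-- On input xs the program halts after t steps with y in register 0.
Outputs : Program → List ℕ → ℕ → ℕ → Set
Outputs p xs t y =
  ∃[ s ] (p ⊢ state 0 xs (λ _ → 0) ⇓[ t ] s) × State.mem s 0 ≡ y

Computable₂ : (ℕ → ℕ → ℕ) → Set
Computable₂ h = Σ[ p ∈ Program ] (∀ a b → ∃[ t ] Outputs p (a ∷ b ∷ []) t (h a b))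

infix 4 _∈O_

_∈O_ : (ℕ → ℕ) → (ℕ → ℕ) → Set
g ∈O f = ∃[ c ] ∃[ n₀ ] (∀ n → n₀ ≤ n → g n ≤ c * f n)

-- The answers are 1 for yes and 0 for no.
DecidesWithin : Program → List ℕ → Set → ℕ → Set
DecidesWithin p xs A bound =
  ∃[ t ] t ≤ bound × ((A × Outputs p xs t 1) ⊎ (¬ A × Outputs p xs t 0))

{-# OPTIONS --safe #-}

-- A sentence with k quantifiers asks for k elements of P. Fix for each of them a
-- chain of a partition of P, and for each pair whether x ≤ y is to hold. Starting
-- from the bottom of its chain, every element is moved up as long as some pair is
-- violated: if x ≤ y should hold but fails then y must move, and if it holds but
-- should not then x must move, since everything below the current places has been
-- excluded. After at most k n moves the least solution is reached or there is none.
-- A machine can therefore try all guesses of chains and of the order type and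
-- evaluate the matrix at the place where each ascent ends; the number of guesses
-- depends only on k and the number of chains. The chains are found on line: the
-- elements arrive in the order of a linear extension and Felsner's algorithm uses
-- at most w (w + 1) chains, the chains with label i being at most i in number and
-- having pairwise incomparable top elements.
--
-- The machine program is compiled from a small structured language, for which a
-- Hoare-style calculus bounds the number of steps.

module Submission where

open import Data.Bool.Base using (Bool; true; false; if_then_else_; T; not; _∧_; _∨_)
open import Data.Empty using (⊥; ⊥-elim)
open import Data.Fin using (#_)
open import Data.Fin.Base using (Fin; toℕ; fromℕ<)
open import Data.Fin.Properties using (toℕ-fromℕ<; fromℕ<-toℕ; toℕ-injective; toℕ<n) renaming (_≟_ to _≟ᶠ_)
open import Data.Fin.Subset using (Subset; ⁅_⁆; _∪_; ∣_∣) renaming (⊥ to ∅; _∈_ to _∈ˢ_)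
open import Data.Fin.Subset.Properties using (p⊂q⇒∣p∣<∣q∣; x∈p∪q⁻; x∈p∪q⁺; x∈⁅y⁆⇒x≡y; x∈⁅x⁆; ∉⊥; q⊆p∪q)
open import Data.List.Base using (List; []; _∷_; _++_; length; map; concatMap; tabulate)
open import Data.List.Properties using (length-++; ++-assoc)
open import Data.List.Relation.Unary.All using (All; []; _∷_)
open import Data.List.Relation.Unary.AllPairs using (AllPairs; []; _∷_)
open import Data.Maybe.Base using (just; nothing)
open import Data.Nat
open import Data.Nat.DivMod using (_%_; [m+kn]%n≡m%n; m<n⇒m%n≡m)
open import Data.Nat.Properties
open import Data.Nat.Tactic.RingSolver using (solve-∀)
open import Data.Product using (Σ-syntax; ∃-syntax; _×_; _,_; proj₁; proj₂)
open import Data.Sum.Base using (_⊎_; inj₁; inj₂; [_,_]′)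
open import Data.Unit.Base using (⊤; tt)
open import Data.Vec.Base as Vec using (Vec; lookup)
open import Data.Vec.Properties using (lookup∘tabulate)
open import Relation.Binary.PropositionalEquality hiding (poset)
open import Relation.Binary.Structures using (IsDecPartialOrder)
open import Relation.Nullary.Decidable.Core using (Dec; yes; no; does; _×-dec_; _⊎-dec_; ¬?)
open import Relation.Nullary.Negation.Core using (¬_; contradiction)
open import Defs

-- A structured language over named arrays

-- Why the ascent cannot overshoot: if x ≤ y is wanted and fails, it fails for every later x of the
-- chain too, so only y can help; if it is unwanted and holds, it holds for every later y, so only x
-- can help. Outside a chain there would be several next candidates and no forced move. Guessing the
-- complete order type turns an arbitrary matrix into such conditions on pairs, and as the truth of
-- the matrix depends only on the type, the elements reached may replace those of the solution. A
-- wrong guess does no harm, because the answer 1 rests on evaluating the matrix at actual elements.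
-- Hence the claims about a guess are conditional on a solution coded by it, while termination and
-- time hold for every guess; this is why the number of sweeps is fixed beforehand. The number of
-- chains enters only h, so a quadratic number of chains, found within the time for reading the
-- matrix, does as well as w of them. The missing multiplication shapes the program: cells are
-- addressed by doubling, rows through stored pointers, guesses are strings of bits, and h is
-- computed by iterated doubling.

data Var : Set where
  %ans %need %tok %vars %len %op %sgn %lhs %rhs %size %row %mat %deg %ptr %ι %κ %ord %cnt %level %fam : Var
  %found %chains %lab %top %colour %chosen %members %ξ %η %guesses %sweeps %guess %bits %want %place : Var
  %queue %stk %val %loop₁ %loop₂ %loop₃ %loop₄ : Var

slot : Var → Fin 63
slot %ans      = # 0
slot %need     = # 1
slot %tok      = # 2
slot %vars     = # 3
slot %len      = # 4
slot %op       = # 5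
slot %sgn      = # 6
slot %lhs      = # 7
slot %rhs      = # 8
slot %size     = # 9
slot %row      = # 10
slot %mat      = # 11
slot %deg      = # 12
slot %ptr      = # 13
slot %ι        = # 14
slot %κ        = # 15
slot %ord      = # 16
slot %cnt      = # 17
slot %level    = # 18
slot %fam      = # 19
slot %found    = # 20
slot %chains   = # 21
slot %lab      = # 22
slot %top      = # 23
slot %colour   = # 24
slot %chosen   = # 25
slot %members  = # 26
slot %ξ        = # 27
slot %η        = # 28
slot %guesses  = # 29
slot %sweeps   = # 30
slot %guess    = # 31
slot %bits     = # 32
slot %want     = # 33
slot %place    = # 34
slot %queue    = # 35
slot %stk      = # 36
slot %val      = # 37
slot %loop₁       = # 38
slot %loop₂       = # 39
slot %loop₃       = # 40
slot %loop₄       = # 41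

data Expr : Set where
  lit     : ℕ → Expr
  _!_     : Var → Expr → Expr
  _⊕_ _⊖_ : Expr → Expr → Expr
  halve   : Expr → Expr

data Cmd : Set where
  skip        : Cmd
  _!_≔_       : Var → Expr → Expr → Cmd
  input       : Var → Cmd
  _⨾_         : Cmd → Cmd → Cmd
  when_⟨_∣_⟩  : Expr → Cmd → Cmd → Cmd
  while_⟨_⟩   : Expr → Cmd → Cmd

infixr 4 _⨾_
infix  5 _!_≔_
infixl 6 _⊕_ _⊖_
infix  7 _!_

Store : Set
Store = Var → ℕ → ℕ

-- Variables are compared through their slots: the test computes for concrete variables, and the
-- update agrees with the memory because equal slots mean equal addresses.
_⟨_!_≔_⟩ : Store → Var → ℕ → ℕ → Store
(σ ⟨ v ! n ≔ z ⟩) u = if toℕ (slot u) ≡ᵇ toℕ (slot v) then σ u [ n ≔ z ] else σ u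

⟦_⟧ᴱ : Expr → Store → ℕ
⟦ lit n ⟧ᴱ   σ = n
⟦ v ! e ⟧ᴱ   σ = σ v (⟦ e ⟧ᴱ σ)
⟦ e ⊕ f ⟧ᴱ   σ = ⟦ e ⟧ᴱ σ + ⟦ f ⟧ᴱ σ
⟦ e ⊖ f ⟧ᴱ   σ = ⟦ e ⟧ᴱ σ ∸ ⟦ f ⟧ᴱ σ
⟦ halve e ⟧ᴱ σ = ⌊ ⟦ e ⟧ᴱ σ /2⌋

record Config : Set where
  constructor _▹_
  field
    tape  : List ℕ
    cells : Store
open Config public

infix 4 _▹_

pop : List ℕ → ℕ × List ℕ
pop []       = 0 , []
pop (n ∷ ns) = n , ns

-- Expressions compile to straight-line code, so this is both the length of the code and the number
-- of steps. The 9 of an array access are the eight instructions of `index` and one `load`.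
costᴱ : Expr → ℕ
costᴱ (lit n)   = 1
costᴱ (v ! e)   = costᴱ e + 9
costᴱ (e ⊕ f)   = costᴱ e + (costᴱ f + 1)
costᴱ (e ⊖ f)   = costᴱ e + (costᴱ f + 1)
costᴱ (halve e) = costᴱ e + 1

infix 3 _,_⇓[_]_

-- The step counts are exactly those of the compiled code; the additional ones are the conditional
-- jump, the jump over the second branch and the jump back to the test.
data _,_⇓[_]_ : Cmd → Config → ℕ → Config → Set where
  skip  : ∀ {s} → skip , s ⇓[ 0 ] s
  set   : ∀ {v e f ns σ} →
          v ! e ≔ f , (ns ▹ σ) ⇓[ costᴱ e + (8 + (costᴱ f + 1)) ] (ns ▹ σ ⟨ v ! ⟦ e ⟧ᴱ σ ≔ ⟦ f ⟧ᴱ σ ⟩)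
  input : ∀ {v ns σ} →
          input v , (ns ▹ σ) ⇓[ 1 ] (proj₂ (pop ns) ▹ σ ⟨ v ! 0 ≔ proj₁ (pop ns) ⟩)
  seq   : ∀ {c d s s′ s″ t t′} → c , s ⇓[ t ] s′ → d , s′ ⇓[ t′ ] s″ → c ⨾ d , s ⇓[ t + t′ ] s″
  whenT : ∀ {e c d s s′ t n} → ⟦ e ⟧ᴱ (cells s) ≡ suc n → c , s ⇓[ t ] s′ →
          when e ⟨ c ∣ d ⟩ , s ⇓[ costᴱ e + (1 + (t + 1)) ] s′
  whenF : ∀ {e c d s s′ t} → ⟦ e ⟧ᴱ (cells s) ≡ 0 → d , s ⇓[ t ] s′ →
          when e ⟨ c ∣ d ⟩ , s ⇓[ costᴱ e + (1 + t) ] s′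
  loop  : ∀ {e c s s′ s″ t t′ n} → ⟦ e ⟧ᴱ (cells s) ≡ suc n → c , s ⇓[ t ] s′ →
          while e ⟨ c ⟩ , s′ ⇓[ t′ ] s″ → while e ⟨ c ⟩ , s ⇓[ costᴱ e + (1 + (t + (1 + t′))) ] s″
  exit  : ∀ {e c s} → ⟦ e ⟧ᴱ (cells s) ≡ 0 → while e ⟨ c ⟩ , s ⇓[ costᴱ e + 1 ] s

-- Compilation to the machine.  Cell n of the array v lives at address
-- slot v + 64 n; the addresses 63 + 64 n are the stack for evaluating expressions.

opaque
  address : Var → ℕ → ℕ
  address v n = toℕ (slot v) + n * 64

  temp : ℕ → ℕ
  temp d = 63 + d * 64

-- Multiplication by 64 is six doublings, which is why the arrays are interleaved with a power of
-- two as period. The cell `temp (suc d)` serves as scratch for the slot.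
index : ℕ → Var → List Instr
index d v = add (temp d) (temp d) (temp d) ∷ add (temp d) (temp d) (temp d) ∷
            add (temp d) (temp d) (temp d) ∷ add (temp d) (temp d) (temp d) ∷
            add (temp d) (temp d) (temp d) ∷ add (temp d) (temp d) (temp d) ∷
            const (temp (suc d)) (toℕ (slot v)) ∷
            add (temp d) (temp (suc d)) (temp d) ∷ []

compileᴱ : ℕ → Expr → List Instr
compileᴱ d (lit n)   = const (temp d) n ∷ []
compileᴱ d (v ! e)   = compileᴱ d e ++ (index d v ++ load (temp d) (temp d) ∷ [])
compileᴱ d (e ⊕ f)   = compileᴱ d e ++ (compileᴱ (suc d) f ++ add (temp d) (temp d) (temp (suc d)) ∷ [])
compileᴱ d (e ⊖ f)   = compileᴱ d e ++ (compileᴱ (suc d) f ++ sub (temp d) (temp d) (temp (suc d)) ∷ [])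
compileᴱ d (halve e) = compileᴱ d e ++ half (temp d) (temp d) ∷ []

width : Cmd → ℕ
width skip                 = 0
width (v ! e ≔ f)          = costᴱ e + (8 + (costᴱ f + 1))
width (input v)            = 1
width (c ⨾ d)              = width c + width d
width (when e ⟨ c ∣ d ⟩)   = costᴱ e + (1 + (width c + (1 + width d)))
width (while e ⟨ c ⟩)      = costᴱ e + (1 + (width c + 1))

-- Jumps are absolute, so the code depends on the position `o` of its first instruction. Its length
-- does not, so every target is known in advance from `width`.
compile : ℕ → Cmd → List Instr
compile o skip               = []
compile o (v ! e ≔ f)        =
  compileᴱ 0 e ++ (index 0 v ++ (compileᴱ 1 f ++ store (temp 0) (temp 1) ∷ []))
compile o (input v)          = read (address v 0) ∷ []
compile o (c ⨾ d)            = compile o c ++ compile (o + width c) d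
compile o when e ⟨ c ∣ d ⟩   =
  compileᴱ 0 e ++ jumpIfZero (temp 0) (o + costᴱ e + 1 + width c + 1) ∷
  (compile (o + costᴱ e + 1) c ++ jump (o + costᴱ e + 1 + width c + 1 + width d) ∷
  compile (o + costᴱ e + 1 + width c + 1) d)
compile o while e ⟨ c ⟩      =
  compileᴱ 0 e ++ jumpIfZero (temp 0) (o + costᴱ e + 1 + width c + 1) ∷
  (compile (o + costᴱ e + 1) c ++ jump o ∷ [])

length-compileᴱ : ∀ d e → length (compileᴱ d e) ≡ costᴱ e
length-compileᴱ d (lit n) = refl
length-compileᴱ d (v ! e) =
  trans (length-++ (compileᴱ d e)) (cong (_+ 9) (length-compileᴱ d e))
length-compileᴱ d (e ⊕ f) =
  trans (length-++ (compileᴱ d e)) (cong₂ _+_ (length-compileᴱ d e)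
    (trans (length-++ (compileᴱ (suc d) f)) (cong (_+ 1) (length-compileᴱ (suc d) f))))
length-compileᴱ d (e ⊖ f) =
  trans (length-++ (compileᴱ d e)) (cong₂ _+_ (length-compileᴱ d e)
    (trans (length-++ (compileᴱ (suc d) f)) (cong (_+ 1) (length-compileᴱ (suc d) f))))
length-compileᴱ d (halve e) =
  trans (length-++ (compileᴱ d e)) (cong (_+ 1) (length-compileᴱ d e))

length-compile : ∀ o c → length (compile o c) ≡ width c
length-compile o skip = refl
length-compile o (v ! e ≔ f) =
  trans (length-++ (compileᴱ 0 e)) (cong₂ _+_ (length-compileᴱ 0 e)
    (cong (8 +_) (trans (length-++ (compileᴱ 1 f)) (cong (_+ 1) (length-compileᴱ 1 f)))))
length-compile o (input v) = refl
length-compile o (c ⨾ d) =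
  trans (length-++ (compile o c)) (cong₂ _+_ (length-compile o c) (length-compile _ d))
length-compile o when e ⟨ c ∣ d ⟩ =
  trans (length-++ (compileᴱ 0 e)) (cong₂ _+_ (length-compileᴱ 0 e)
    (cong suc (trans (length-++ (compile _ c))
      (cong₂ _+_ (length-compile _ c) (cong suc (length-compile _ d))))))
length-compile o while e ⟨ c ⟩ =
  trans (length-++ (compileᴱ 0 e)) (cong₂ _+_ (length-compileᴱ 0 e)
    (cong suc (trans (length-++ (compile _ c)) (cong (_+ 1) (length-compile _ c)))))

-- Correctness of the compiler

≡ᵇ-refl : ∀ n → (n ≡ᵇ n) ≡ true
≡ᵇ-refl zero    = refl
≡ᵇ-refl (suc n) = ≡ᵇ-refl n

≢⇒≡ᵇ-false : ∀ {m n} → m ≢ n → (m ≡ᵇ n) ≡ false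
≢⇒≡ᵇ-false {m} {n} m≢n with m ≡ᵇ n in eq
... | false = refl
... | true  = contradiction (≡ᵇ⇒≡ m n (subst T (sym eq) tt)) m≢n

≔-same : ∀ f n z → (f [ n ≔ z ]) n ≡ z
≔-same f n z rewrite ≡ᵇ-refl n = refl

≔-other : ∀ f {n m} z → m ≢ n → (f [ n ≔ z ]) m ≡ f m
≔-other f z m≢n rewrite ≢⇒≡ᵇ-false m≢n = refl

opaque
  unfolding address temp

  address-% : ∀ v n → address v n % 64 ≡ toℕ (slot v)
  address-% v n = trans ([m+kn]%n≡m%n (toℕ (slot v)) n 64)
                        (m<n⇒m%n≡m (≤-trans (toℕ<n (slot v)) (n≤1+n 63)))

  -- Slots are smaller than 63, so cells and stack differ modulo 64.
  address≢temp : ∀ v n d → address v n ≢ temp d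
  address≢temp v n d eq = <⇒≢ (toℕ<n (slot v))
    (trans (sym (address-% v n)) (trans (cong (_% 64) eq) ([m+kn]%n≡m%n 63 d 64)))

  address-cell : ∀ v {n m} → address v n ≡ address v m → n ≡ m
  address-cell v {n} {m} eq = *-cancelʳ-≡ n m 64 (+-cancelˡ-≡ (toℕ (slot v)) (n * 64) (m * 64) eq)

  temp-injective : ∀ {d d′} → temp d ≡ temp d′ → d ≡ d′
  temp-injective {d} {d′} eq = *-cancelʳ-≡ d d′ 64 (+-cancelˡ-≡ 63 (d * 64) (d′ * 64) eq)

  address≡ : ∀ v n → toℕ (slot v) + n * 64 ≡ address v n
  address≡ v n = refl

  address-var : ∀ u v n → toℕ (slot u) ≡ toℕ (slot v) → address u n ≡ address v n
  address-var u v n = cong (_+ n * 64)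

  address-ans : address %ans 0 ≡ 0
  address-ans = refl

infix 4 _≈_
record _≈_ (m : ℕ → ℕ) (σ : Store) : Set where
  constructor agree
  field at : ∀ v n → m (address v n) ≡ σ v n

≈-temp : ∀ {m σ} d z → m ≈ σ → m [ temp d ≔ z ] ≈ σ
≈-temp {m} d z (agree m≈σ) = agree λ v n → trans (≔-other m z (address≢temp v n d)) (m≈σ v n)

≈-cell : ∀ {m σ} v n z → m ≈ σ → m [ address v n ≔ z ] ≈ σ ⟨ v ! n ≔ z ⟩
≈-cell {m} {σ} v n z (agree m≈σ) = agree cell
  where
  cell : ∀ u k → (m [ address v n ≔ z ]) (address u k) ≡ (σ ⟨ v ! n ≔ z ⟩) u k
  cell u k with toℕ (slot u) ≡ᵇ toℕ (slot v) in eq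
  ... | false = trans (≔-other m z λ e → subst T eq
                  (≡⇒≡ᵇ _ _ (trans (sym (address-% u k)) (trans (cong (_% 64) e) (address-% v n))))) (m≈σ u k)
  ... | true with k ≡ᵇ n in eq′
  ...   | true  = trans (cong (m [ address v n ≔ z ]) (trans (address-var u v k same)
                    (cong (address v) (≡ᵇ⇒≡ k n (subst T (sym eq′) tt))))) (≔-same m (address v n) z)
    where same = ≡ᵇ⇒≡ (toℕ (slot u)) (toℕ (slot v)) (subst T (sym eq) tt)
  ...   | false = trans (≔-other m z λ e → subst T eq′
                    (≡⇒≡ᵇ k n (address-cell v (trans (sym (address-var u v k same)) e)))) (m≈σ u k)
    where same = ≡ᵇ⇒≡ (toℕ (slot u)) (toℕ (slot v)) (subst T (sym eq) tt)

record Fetches (p : Program) (o : ℕ) (i : Instr) : Set where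
  constructor fetches
  field fetched : fetch p o ≡ just i

infix 3 _⊢_⟶[_]_
-- These runs need not end in a halt, so those of consecutive pieces of code compose.
data _⊢_⟶[_]_ (p : Program) : State → ℕ → State → Set where
  []  : ∀ {s} → p ⊢ s ⟶[ 0 ] s
  _∷_ : ∀ {s i t s′} → Fetches p (State.pc s) i → p ⊢ exec i s ⟶[ t ] s′ → p ⊢ s ⟶[ suc t ] s′

_⟫_ : ∀ {p s s′ s″ t t′} → p ⊢ s ⟶[ t ] s′ → p ⊢ s′ ⟶[ t′ ] s″ → p ⊢ s ⟶[ t + t′ ] s″
[]       ⟫ ys = ys
(x ∷ xs) ⟫ ys = x ∷ (xs ⟫ ys)

infixr 5 _⟫_

run-to-halt : ∀ {p s s′ t} → p ⊢ s ⟶[ t ] s′ → fetch p (State.pc s′) ≡ nothing → p ⊢ s ⇓[ t ] s′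
run-to-halt []       stop = halt stop
run-to-halt (fetches x ∷ xs) stop = step x (run-to-halt xs stop)

At : Program → ℕ → List Instr → Set
At p o []       = ⊤
At p o (i ∷ is) = Fetches p o i × At p (suc o) is

At-++ : ∀ {p} o is {js} → At p o (is ++ js) → At p o is × At p (o + length is) js
At-++ {p} o []       {js} at       = tt , subst (λ q → At p q js) (sym (+-identityʳ o)) at
At-++ {p} o (i ∷ is) {js} (f , at) with at₁ , at₂ ← At-++ (suc o) is at =
  (f , at₁) , subst (λ q → At p q js) (sym (+-suc o (length is))) at₂

At-whole : ∀ is {pre} → At (pre ++ is) (length pre) is
At-whole []             = tt
At-whole (i ∷ is) {pre} = fetches (fetch-++ pre) ,
  subst₂ (λ p q → At p q is) (++-assoc pre (i ∷ []) is)
    (trans (length-++ pre) (+-comm (length pre) 1)) (At-whole is {pre ++ i ∷ []})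
  where
  fetch-++ : ∀ pre → fetch (pre ++ i ∷ is) (length pre) ≡ just i
  fetch-++ []        = refl
  fetch-++ (_ ∷ pre) = fetch-++ pre

fetch-end : ∀ (p : Program) → fetch p (length p) ≡ nothing
fetch-end []      = refl
fetch-end (_ ∷ p) = fetch-end p

At-split : ∀ p o {l} is {js} → length is ≡ l → At p o (is ++ js) → At p o is × At p (o + l) js
At-split p o is refl = At-++ o is

goto : ∀ {p s t q q′ xs m} → q ≡ q′ → p ⊢ s ⟶[ t ] state q xs m → p ⊢ s ⟶[ t ] state q′ xs m
goto refl steps = steps

-- The stack below depth `d` has to survive: the left operand of a binary operation waits there
-- while the right one is evaluated one level higher.
record Computes (d n : ℕ) (σ : Store) (m m′ : ℕ → ℕ) : Set where
  constructor computes
  field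
    agrees : m′ ≈ σ
    result : m′ (temp d) ≡ n
    below  : ∀ d′ → d′ < d → m′ (temp d′) ≡ m (temp d′)

put : ∀ {d n σ m m′} z {n′} → z ≡ n′ → Computes d n σ m m′ → Computes d n′ σ m (m′ [ temp d ≔ z ])
put {d} {m′ = m′} z z≡n′ (computes ag _ be) = computes (≈-temp d z ag)
  (trans (≔-same m′ (temp d) z) z≡n′)
  λ d′ d′<d → trans (≔-other m′ z λ eq → <⇒≢ d′<d (temp-injective eq)) (be d′ d′<d)

put-above : ∀ {d n σ m m′} z → Computes d n σ m m′ → Computes d n σ m (m′ [ temp (suc d) ≔ z ])
put-above {d} {m′ = m′} z (computes ag re be) = computes (≈-temp (suc d) z ag)
  (trans (≔-other m′ z λ eq → <⇒≢ (n<1+n d) (temp-injective eq)) re)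
  λ d′ d′<d → trans (≔-other m′ z λ eq → <⇒≢ (m<n⇒m<1+n d′<d) (temp-injective eq)) (be d′ d′<d)

opaque
  double : ∀ {p o d n σ m₀ m} xs → Fetches p o (add (temp d) (temp d) (temp d)) → Computes d n σ m₀ m →
           ∃[ m′ ] p ⊢ state o xs m ⟶[ 1 ] state (suc o) xs m′ × Computes d (n + n) σ m₀ m′
  double xs f c = _ , f ∷ [] , put _ (cong₂ _+_ (Computes.result c) (Computes.result c)) c

times64 : ∀ n → (((((n + n) + (n + n)) + ((n + n) + (n + n))) + (((n + n) + (n + n)) + ((n + n) + (n + n)))) +
    ((((n + n) + (n + n)) + ((n + n) + (n + n))) + (((n + n) + (n + n)) + ((n + n) + (n + n))))) +
    (((((n + n) + (n + n)) + ((n + n) + (n + n))) + (((n + n) + (n + n)) + ((n + n) + (n + n)))) +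
    ((((n + n) + (n + n)) + ((n + n) + (n + n))) + (((n + n) + (n + n)) + ((n + n) + (n + n))))) ≡ n * 64
times64 = solve-∀

opaque
  sim-index : ∀ {p o m m₀ σ n} xs d v → At p o (index d v) → Computes d n σ m₀ m →
              ∃[ m′ ] p ⊢ state o xs m ⟶[ 8 ] state (8 + o) xs m′ × Computes d (address v n) σ m₀ m′
  sim-index {n = n} xs d v (f₁ , f₂ , f₃ , f₄ , f₅ , f₆ , f₇ , f₈ , _) c
    with _ , s , c ← double xs f₁ c
    with _ , s₂ , c ← double xs f₂ c
    with _ , s₃ , c ← double xs f₃ c
    with _ , s₄ , c ← double xs f₄ c
    with _ , s₅ , c ← double xs f₅ c
    with m₆ , s₆ , c ← double xs f₆ c
    = let c′ = put-above (toℕ (slot v)) c in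
      _ , s ⟫ s₂ ⟫ s₃ ⟫ s₄ ⟫ s₅ ⟫ s₆ ⟫ f₇ ∷ f₈ ∷ [] ,
    put _ (trans (cong₂ _+_ (≔-same m₆ (temp (suc d)) (toℕ (slot v)))
                            (trans (Computes.result c′) (times64 n)))
                 (address≡ v n)) c′

  sim-load : ∀ {p o m m₀ σ n} xs d v → At p o (index d v ++ load (temp d) (temp d) ∷ []) → Computes d n σ m₀ m →
             ∃[ m′ ] p ⊢ state o xs m ⟶[ 9 ] state (9 + o) xs m′ × Computes d (σ v n) σ m₀ m′
  sim-load {n = n} xs d v (f₁ , f₂ , f₃ , f₄ , f₅ , f₆ , f₇ , f₈ , f₉ , _) c =
    let m₁ , s₁ , c₁ = sim-index xs d v (f₁ , f₂ , f₃ , f₄ , f₅ , f₆ , f₇ , f₈ , tt) c in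
    m₁ [ temp d ≔ m₁ (m₁ (temp d)) ] , s₁ ⟫ f₉ ∷ [] ,
    put (m₁ (m₁ (temp d))) (trans (cong m₁ (Computes.result c₁)) (_≈_.at (Computes.agrees c₁) v n)) c₁

Simulatesᴱ : Program → ℕ → ℕ → Expr → Store → (ℕ → ℕ) → Set
Simulatesᴱ p o d e σ m = ∀ xs → ∃[ m′ ]
  p ⊢ state o xs m ⟶[ costᴱ e ] state (o + costᴱ e) xs m′ × Computes d (⟦ e ⟧ᴱ σ) σ m m′

simᴱ : ∀ {p o m σ} d e → At p o (compileᴱ d e) → m ≈ σ → Simulatesᴱ p o d e σ m

simᴱ₂ : ∀ {p o m σ i z} d e f → At p o (compileᴱ d e ++ (compileᴱ (suc d) f ++ i ∷ [])) → m ≈ σ →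
        (∀ q xs m′ → m′ (temp d) ≡ ⟦ e ⟧ᴱ σ → m′ (temp (suc d)) ≡ ⟦ f ⟧ᴱ σ →
          exec i (state q xs m′) ≡ state (suc q) xs (m′ [ temp d ≔ z ])) → ∀ xs →
        ∃[ m′ ] p ⊢ state o xs m ⟶[ costᴱ e + (costᴱ f + 1) ] state (o + (costᴱ e + (costᴱ f + 1))) xs m′
          × Computes d z σ m m′
simᴱ₂ {p} {o} {σ = σ} {z = z} d e f at m≈σ run xs
  with at₁ , at₂ ← At-split p o (compileᴱ d e) (length-compileᴱ d e) at
  with at₂ , (at₃ , _) ← At-split p (o + costᴱ e) (compileᴱ (suc d) f) (length-compileᴱ (suc d) f) at₂
  with m₁ , s₁ , c₁ ← simᴱ d e at₁ m≈σ xs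
  with m₂ , s₂ , c₂ ← simᴱ (suc d) f at₂ (Computes.agrees c₁) xs
  = _ , goto (pc o (costᴱ e) (costᴱ f)) (s₁ ⟫ s₂ ⟫
      (at₃ ∷ subst (λ s → p ⊢ s ⟶[ 0 ] state (suc (o + costᴱ e + costᴱ f)) xs (m₂ [ temp d ≔ z ]))
                   (sym (run _ xs m₂ re (Computes.result c₂))) []))
  , put {n = ⟦ e ⟧ᴱ σ} z refl (computes (Computes.agrees c₂) re
      (λ d′ d′<d → trans (Computes.below c₂ d′ (m<n⇒m<1+n d′<d)) (Computes.below c₁ d′ d′<d)))
  where
  re = trans (Computes.below c₂ d ≤-refl) (Computes.result c₁)
  pc : ∀ o a b → suc (o + a + b) ≡ o + (a + (b + 1))
  pc = solve-∀

simᴱ d (lit n) (f , _) m≈σ xs = _ , goto (+-comm 1 _) (f ∷ []) ,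
  put {n = _} n refl (computes m≈σ refl λ _ _ → refl)
simᴱ {p} {o} d (v ! e) at m≈σ xs
  with at₁ , at₂ ← At-split p o (compileᴱ d e) (length-compileᴱ d e) at
  with m₁ , s₁ , c₁ ← simᴱ d e at₁ m≈σ xs
  with m₂ , s₂ , c₂ ← sim-load xs d v at₂ c₁
  = m₂ , goto (pc o (costᴱ e)) (s₁ ⟫ s₂) , c₂
  where
  pc : ∀ o a → 9 + (o + a) ≡ o + (a + 9)
  pc = solve-∀
simᴱ d (e ⊕ f) at m≈σ = simᴱ₂ d e f at m≈σ
  λ q ns m′ re₁ re₂ → cong (λ z → state (suc q) ns (m′ [ temp d ≔ z ])) (cong₂ _+_ re₁ re₂)
simᴱ d (e ⊖ f) at m≈σ = simᴱ₂ d e f at m≈σ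
  λ q ns m′ re₁ re₂ → cong (λ z → state (suc q) ns (m′ [ temp d ≔ z ])) (cong₂ _∸_ re₁ re₂)
simᴱ {p} {o} d (halve e) at m≈σ xs
  with at₁ , (at₂ , _) ← At-split p o (compileᴱ d e) (length-compileᴱ d e) at
  with m₁ , s₁ , c₁ ← simᴱ d e at₁ m≈σ xs
  = _ , goto (trans (+-comm 1 _) (+-assoc o (costᴱ e) 1)) (s₁ ⟫ (at₂ ∷ [])) ,
    put ⌊ m₁ (temp d) /2⌋ (cong ⌊_/2⌋ (Computes.result c₁)) c₁

else-offset : ∀ o a b → suc (suc (o + a) + b) ≡ o + a + 1 + b + 1
else-offset = solve-∀

-- By induction on the run, not on the command, since a loop executes the same code again; the
-- placement of that code serves both the first round and the remaining ones.
sim : ∀ {p o c t s s′ m} → c , s ⇓[ t ] s′ → At p o (compile o c) → m ≈ cells s →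
      ∃[ m′ ] p ⊢ state o (tape s) m ⟶[ t ] state (o + width c) (tape s′) m′ × m′ ≈ cells s′
sim {o = o} skip at m≈σ = _ , goto (sym (+-identityʳ o)) [] , m≈σ
sim {p} {o} {s′ = s′} (set {v} {e} {f} {ns} {σ}) at m≈σ
  with at₁ , at ← At-split p o (compileᴱ 0 e) (length-compileᴱ 0 e) at
  with at₂ , at ← At-split p (o + costᴱ e) (index 0 v) refl at
  with at₃ , (at₄ , _) ← At-split p (o + costᴱ e + 8) (compileᴱ 1 f) (length-compileᴱ 1 f) at
  with m₁ , s₁ , c₁ ← simᴱ 0 e at₁ m≈σ ns
  with m₂ , s₂ , c₂ ← sim-index ns 0 v at₂ c₁
  with m₃ , s₃ , c₃ ← simᴱ 1 f (subst (λ q → At p q (compileᴱ 1 f)) (+-comm (o + costᴱ e) 8) at₃) (Computes.agrees c₂) ns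
  = _ , s₁ ⟫ s₂ ⟫ s₃ ⟫
        (subst (λ q → Fetches p q (store (temp 0) (temp 1))) (sym (pc₀ o (costᴱ e) (costᴱ f))) at₄ ∷
            goto (pc o (costᴱ e) (costᴱ f)) [])
      , subst₂ (λ a z → m₃ [ a ≔ z ] ≈ cells s′)
          (sym (trans (Computes.below c₃ 0 (s≤s z≤n)) (Computes.result c₂))) (sym (Computes.result c₃))
          (≈-cell v (⟦ e ⟧ᴱ σ) (⟦ f ⟧ᴱ σ) (Computes.agrees c₃))
  where
  pc₀ : ∀ o a b → 8 + (o + a) + b ≡ o + a + 8 + b
  pc₀ = solve-∀
  pc : ∀ o a b → suc (8 + (o + a) + b) ≡ o + (a + (8 + (b + 1)))
  pc = solve-∀
sim {o = o} (input {v} {[]} {σ}) (f , _) m≈σ = _ , goto (+-comm 1 o) (f ∷ []) , ≈-cell v 0 0 m≈σ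
sim {o = o} (input {v} {z ∷ ns} {σ}) (f , _) m≈σ = _ , goto (+-comm 1 o) (f ∷ []) , ≈-cell v 0 z m≈σ
sim {p} {o} (seq {c} {d} r₁ r₂) at m≈σ
  with at₁ , at₂ ← At-split p o (compile o c) (length-compile o c) at
  with m₁ , s₁ , e₁ ← sim r₁ at₁ m≈σ
  with m₂ , s₂ , e₂ ← sim r₂ at₂ e₁
  = m₂ , goto (+-assoc o (width c) (width d)) (s₁ ⟫ s₂) , e₂
sim {p} {o} {s = s} (whenT {e} {c} {d} eq r) at m≈σ
  with at₁ , (at₂ , at) ← At-split p o (compileᴱ 0 e) (length-compileᴱ 0 e) at
  with at₃ , (at₄ , _) ← At-split p (suc (o + costᴱ e)) (compile (o + costᴱ e + 1) c) (length-compile _ c) at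
  with m₁ , s₁ , c₁ ← simᴱ 0 e at₁ m≈σ (tape s)
  with m₂ , s₂ , e₂ ← sim r (subst (λ q → At p q (compile (o + costᴱ e + 1) c)) (+-comm 1 (o + costᴱ e)) at₃)
      (Computes.agrees c₁)
  = m₂ , s₁ ⟫ at₂ ∷ subst (λ q → p ⊢ state q (tape s) m₁ ⟶[ _ ] _)
                      (trans (+-comm (o + costᴱ e) 1)
                        (cong (λ z → if z ≡ᵇ 0 then o + costᴱ e + 1 + width c + 1 else suc (o + costᴱ e))
                          (sym (trans (Computes.result c₁) eq))))
                      (s₂ ⟫ subst (λ q → Fetches p (q + width c) (jump (o + costᴱ e + 1 + width c + 1 + width d)))
                          (+-comm 1 (o + costᴱ e)) at₄ ∷
                        goto (pc o (costᴱ e) (width c) (width d)) []) , e₂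
  where
  pc : ∀ o a b c → o + a + 1 + b + 1 + c ≡ o + (a + (1 + (b + (1 + c))))
  pc = solve-∀
sim {p} {o} {s = s} (whenF {e} {c} {d} eq r) at m≈σ
  with at₁ , (at₂ , at) ← At-split p o (compileᴱ 0 e) (length-compileᴱ 0 e) at
  with at₃ , (at₄ , at₅) ← At-split p (suc (o + costᴱ e)) (compile (o + costᴱ e + 1) c) (length-compile _ c) at
  with m₁ , s₁ , c₁ ← simᴱ 0 e at₁ m≈σ (tape s)
  with m₂ , s₂ , e₂ ← sim r (subst (λ q → At p q (compile (o + costᴱ e + 1 + width c + 1) d))
      (else-offset o (costᴱ e) (width c)) at₅) (Computes.agrees c₁)
  = m₂ , s₁ ⟫ at₂ ∷ subst (λ q → p ⊢ state q (tape s) m₁ ⟶[ _ ] _)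
                        (cong (λ z → if z ≡ᵇ 0 then o + costᴱ e + 1 + width c + 1 else suc (o + costᴱ e))
                          (sym (trans (Computes.result c₁) eq)))
                      (goto (pc o (costᴱ e) (width c) (width d)) s₂) , e₂
  where
  pc : ∀ o a b c → o + a + 1 + b + 1 + c ≡ o + (a + (1 + (b + (1 + c))))
  pc = solve-∀
sim {p} {o} {s = s} (loop {e} {c} {s′ = s₁} {t′ = t′} eq r r′) at₀ m≈σ
  with at₁ , (at₂ , at) ← At-split p o (compileᴱ 0 e) (length-compileᴱ 0 e) at₀
  with at₃ , (at₄ , _) ← At-split p (suc (o + costᴱ e)) (compile (o + costᴱ e + 1) c) (length-compile _ c) at
  with m₁ , s₁ , c₁ ← simᴱ 0 e at₁ m≈σ (tape s)
  with m₂ , s₂ , e₂ ← sim r (subst (λ q → At p q (compile (o + costᴱ e + 1) c)) (+-comm 1 (o + costᴱ e)) at₃)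
      (Computes.agrees c₁)
  with m₃ , s₃ , e₃ ← sim r′ at₀ e₂
  = m₃ , s₁ ⟫ at₂ ∷ subst (λ q → p ⊢ state q (tape s) m₁ ⟶[ _ ] _)
                      (trans (+-comm (o + costᴱ e) 1)
                        (cong (λ z → if z ≡ᵇ 0 then o + costᴱ e + 1 + width c + 1 else suc (o + costᴱ e))
                          (sym (trans (Computes.result c₁) eq))))
                      (s₂ ⟫ subst (λ q → Fetches p (q + width c) (jump o)) (+-comm 1 (o + costᴱ e)) at₄ ∷ s₃) , e₃
sim {p} {o} {s = s} (exit {e} {c} eq) at m≈σ
  with at₁ , (at₂ , _) ← At-split p o (compileᴱ 0 e) (length-compileᴱ 0 e) at
  with m₁ , s₁ , c₁ ← simᴱ 0 e at₁ m≈σ (tape s)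
  = m₁ , s₁ ⟫ at₂ ∷ subst (λ q → p ⊢ state q (tape s) m₁ ⟶[ 0 ] state (o + (costᴱ e + (1 + (width c + 1)))) (tape s) m₁)
                        (trans (sym (pc o (costᴱ e) (width c)))
                          (cong (λ z → if z ≡ᵇ 0 then o + costᴱ e + 1 + width c + 1 else suc (o + costᴱ e))
                            (sym (trans (Computes.result c₁) eq)))) [] , Computes.agrees c₁
  where
  pc : ∀ o a b → o + a + 1 + b + 1 ≡ o + (a + (1 + (b + 1)))
  pc = solve-∀

blank : List ℕ → Config
blank ns = ns ▹ λ _ _ → 0

-- The zeroed memory represents the blank store, and cell 0 of `%ans` is the output register because
-- `%ans` has slot 0.
compile-outputs : ∀ {c ns t s} → c , blank ns ⇓[ t ] s → Outputs (compile 0 c) ns t (cells s %ans 0)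
compile-outputs {c} r with m , steps , m≈σ ← sim r (At-whole (compile 0 c) {[]}) (agree λ _ _ → refl) =
  _ , run-to-halt steps (trans (cong (fetch (compile 0 c)) (sym (length-compile 0 c))) (fetch-end (compile 0 c))) ,
  trans (cong m (sym address-ans)) (_≈_.at m≈σ %ans 0)

-- Program logic: total correctness with a time bound

writes : Cmd → Var → Bool
writes skip u               = false
writes (v ! e ≔ f) u        = toℕ (slot u) ≡ᵇ toℕ (slot v)
writes (input v) u          = toℕ (slot u) ≡ᵇ toℕ (slot v)
writes (c ⨾ d) u            = writes c u ∨ writes d u
writes when e ⟨ c ∣ d ⟩ u   = writes c u ∨ writes d u
writes while e ⟨ c ⟩ u      = writes c u

-- The side condition is a Boolean that evaluates to true for a concrete command and an array it
-- leaves alone, so it is inferred at each use. All later reasoning about unchanged data goes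
-- through this.
Frame : Cmd → Config → Config → Set
Frame c s s′ = ∀ u → {T (not (writes c u))} → cells s′ u ≡ cells s u

not-∨ˡ : ∀ {a b} → T (not (a ∨ b)) → T (not a)
not-∨ˡ {false} _ = tt

not-∨ʳ : ∀ {a b} → T (not (a ∨ b)) → T (not b)
not-∨ʳ {false} t = t

opaque
  unwritten : ∀ σ v n z u → T (not (toℕ (slot u) ≡ᵇ toℕ (slot v))) → (σ ⟨ v ! n ≔ z ⟩) u ≡ σ u
  unwritten σ v n z u t with toℕ (slot u) ≡ᵇ toℕ (slot v)
  ... | false = refl

  frame : ∀ {c s s′ t} → c , s ⇓[ t ] s′ → Frame c s s′
  frame skip u = refl
  frame (set {v} {e} {f} {ns} {σ}) u {t} = unwritten σ v _ _ u t
  frame (input {v} {ns} {σ}) u {t} = unwritten σ v _ _ u t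
  frame (seq {c} {d} r₁ r₂) u {t} =
    trans (frame r₂ u {not-∨ʳ {writes c u} t}) (frame r₁ u {not-∨ˡ {writes c u} t})
  frame (whenT {e} {c} {d} _ r) u {t} = frame r u {not-∨ˡ {writes c u} t}
  frame (whenF {e} {c} {d} _ r) u {t} = frame r u {not-∨ʳ {writes c u} t}
  frame (loop _ r r′) u {t} = trans (frame r′ u {t}) (frame r u {t})
  frame (exit _) u = refl

record Run (c : Cmd) (s : Config) (B : ℕ) (Q : Config → Set) : Set where
  constructor ran
  field
    {end}   : Config
    {steps} : ℕ
    eval    : c , s ⇓[ steps ] end
    bound   : steps ≤ B
    post    : Q end

choose : ∀ {A : Set} → ℕ → A → A → A
choose zero    t f = f
choose (suc _) t f = t

-- The effect of a loop-free command as a function, so that many assertions about the final state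
-- hold by computation. The clause for `while` is a dummy, excluded by `straight`.
perform : Cmd → Config → Config
perform skip s               = s
perform (v ! e ≔ f) s        = tape s ▹ cells s ⟨ v ! ⟦ e ⟧ᴱ (cells s) ≔ ⟦ f ⟧ᴱ (cells s) ⟩
perform (input v) s          = proj₂ (pop (tape s)) ▹ cells s ⟨ v ! 0 ≔ proj₁ (pop (tape s)) ⟩
perform (c ⨾ d) s            = perform d (perform c s)
perform when e ⟨ c ∣ d ⟩ s   = choose (⟦ e ⟧ᴱ (cells s)) (perform c s) (perform d s)
perform while e ⟨ c ⟩ s      = s

straight : Cmd → Bool
straight (c ⨾ d)          = straight c ∧ straight d
straight when e ⟨ c ∣ d ⟩ = straight c ∧ straight d
straight while e ⟨ c ⟩    = false
straight _                = true

ticks : Cmd → ℕ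
ticks skip             = 0
ticks (v ! e ≔ f)      = costᴱ e + (8 + (costᴱ f + 1))
ticks (input v)        = 1
ticks (c ⨾ d)          = ticks c + ticks d
ticks when e ⟨ c ∣ d ⟩ = costᴱ e + (2 + (ticks c + ticks d))
ticks while e ⟨ c ⟩    = 0

∧-T : ∀ {a b} → T (a ∧ b) → T a × T b
∧-T {true} t = tt , t

opaque
  performs : ∀ c s → T (straight c) → ∃[ t ] (c , s ⇓[ t ] perform c s) × t ≤ ticks c
  performs skip s _          = _ , skip , z≤n
  performs (v ! e ≔ f) s _   = _ , set , ≤-refl
  performs (input v) s _     = _ , input , ≤-refl
  performs (c ⨾ d) s st =
    let st₁ , st₂ = ∧-T {straight c} st
        _ , r₁ , b₁ = performs c s st₁
        _ , r₂ , b₂ = performs d (perform c s) st₂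
    in _ , seq r₁ r₂ , +-mono-≤ b₁ b₂
  performs when e ⟨ c ∣ d ⟩ s st with ⟦ e ⟧ᴱ (cells s) in eq
  ... | zero =
    let _ , r , b = performs d s (proj₂ (∧-T {straight c} st))
    in _ , whenF eq r , +-monoʳ-≤ (costᴱ e) (s≤s (≤-trans b (≤-trans (m≤n+m (ticks d) (ticks c)) (n≤1+n _))))
  ... | suc _ =
    let _ , r , b = performs c s (proj₁ (∧-T {straight c} st))
    in _ , whenT eq r , +-monoʳ-≤ (costᴱ e)
        (s≤s (≤-trans (≤-reflexive (+-comm _ 1)) (s≤s (≤-trans b (m≤m+n (ticks c) (ticks d))))))

  run-block : ∀ {c s Q} → {T (straight c)} → Q (perform c s) → Run c s (ticks c) Q
  run-block {c} {s} {Q} {st} q = let _ , r , b = performs c s st in ran r b q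

  run-weaken : ∀ {c s B B′} {Q Q′ : Config → Set} → B ≤ B′ → (∀ s′ → Frame c s s′ → Q s′ → Q′ s′) →
               Run c s B Q → Run c s B′ Q′
  run-weaken B≤B′ Q⇒Q′ (ran r b q) = ran r (≤-trans b B≤B′) (Q⇒Q′ _ (frame r) q)

  run-seq : ∀ {c d s B B′} {Q R : Config → Set} → Run c s B R →
            (∀ s′ → Frame c s s′ → R s′ → Run d s′ B′ Q) → Run (c ⨾ d) s (B + B′) Q
  run-seq (ran r b p) next with ran r′ b′ q ← next _ (frame r) p = ran (seq r r′) (+-mono-≤ b b′) q

  run-after : ∀ {c d s B} {Q : Config → Set} {t : T (straight c)} → Run d (perform c s) B Q → Run (c ⨾ d) s (ticks c + B) Q
  run-after {c} {s = s} {t = st} (ran r′ b′ q) = let _ , r , b = performs c s st in ran (seq r r′) (+-mono-≤ b b′) q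

  -- Adding the bounds of the two branches instead of taking their maximum keeps the running times
  -- polynomial expressions.
  run-when : ∀ {e c d s B B′} {Q : Config → Set} →
             (∀ n → ⟦ e ⟧ᴱ (cells s) ≡ suc n → Run c s B Q) → (⟦ e ⟧ᴱ (cells s) ≡ 0 → Run d s B′ Q) →
             Run when e ⟨ c ∣ d ⟩ s (costᴱ e + (2 + (B + B′))) Q
  run-when {e} {s = s} {B} {B′} then otherwise with ⟦ e ⟧ᴱ (cells s) in eq
  ... | zero  with ran r b q ← otherwise refl =
    ran (whenF eq r) (+-monoʳ-≤ (costᴱ e) (s≤s (≤-trans b (≤-trans (m≤n+m B′ B) (n≤1+n _))))) q
  ... | suc n with ran r b q ← then n refl =
    ran (whenT eq r) (+-monoʳ-≤ (costᴱ e) (s≤s (≤-trans (≤-reflexive (+-comm _ 1)) (s≤s (≤-trans b (m≤m+n B B′)))))) q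

  -- The index bounds the rounds that are still possible, and the loop may stop earlier; at index 0
  -- the invariant must force the test to fail.
  run-while : ∀ {e c s B} (I : ℕ → Config → Set) →
              (∀ i s′ → Frame while e ⟨ c ⟩ s s′ → I (suc i) s′ → ∀ n → ⟦ e ⟧ᴱ (cells s′) ≡ suc n → Run c s′ B (I i)) →
              (∀ s′ → Frame while e ⟨ c ⟩ s s′ → I 0 s′ → ⟦ e ⟧ᴱ (cells s′) ≡ 0) →
              ∀ i → I i s →
              Run while e ⟨ c ⟩ s (i * (costᴱ e + (2 + B)) + (costᴱ e + 1))
                  (λ s′ → (∃[ i′ ] I i′ s′) × ⟦ e ⟧ᴱ (cells s′) ≡ 0)
  run-while {e} {c} {s₀} {B} I body stop i₀ inv₀ = go i₀ s₀ (λ _ → refl) inv₀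
    where
    arith : ∀ a b d → a + (1 + (b + (1 + d))) ≡ a + (2 + b) + d
    arith = solve-∀
    go : ∀ i s → Frame while e ⟨ c ⟩ s₀ s → I i s →
         Run while e ⟨ c ⟩ s (i * (costᴱ e + (2 + B)) + (costᴱ e + 1)) (λ s′ → (∃[ i′ ] I i′ s′) × ⟦ e ⟧ᴱ (cells s′) ≡ 0)
    go zero s fr inv = ran (exit (stop s fr inv)) ≤-refl ((_ , inv) , stop s fr inv)
    go (suc i) s fr inv with ⟦ e ⟧ᴱ (cells s) in eq
    ... | zero  = ran (exit eq) (m≤n+m _ (suc i * (costᴱ e + (2 + B)))) ((_ , inv) , eq)
    ... | suc n with ran {t} r b inv′ ← body i s fr inv n eq
                with ran r′ b′ q ← go i t (λ u {w} → trans (frame r u {w}) (fr u {w})) inv′ =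
      ran (loop eq r r′) (≤-trans (≤-reflexive (arith (costᴱ e) _ _))
            (≤-trans (+-mono-≤ (+-monoʳ-≤ (costᴱ e) (+-monoʳ-≤ 2 b)) b′)
                     (≤-reflexive (sym (+-assoc (costᴱ e + (2 + B)) (i * (costᴱ e + (2 + B))) (costᴱ e + 1)))))) q

infix 8 _at_≔_
_at_≔_ : Config → Var → ℕ → Config
s at v ≔ n = tape s ▹ cells s ⟨ v ! 0 ≔ n ⟩

for_from_⟨_⟩ : Var → Expr → Cmd → Cmd
for v from e ⟨ c ⟩ = v ! lit 0 ≔ e ⨾ while v ! lit 0 ⟨ v ! lit 0 ≔ v ! lit 0 ⊖ lit 1 ⨾ c ⟩

-- Setting the counter takes 10 + `costᴱ e` steps. A round takes 11 for the test, 22 for the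
-- decrement and 1 for the jump back; the final test takes 11.
for-time : Expr → ℕ → ℕ → ℕ
for-time e n B = 10 + costᴱ e + (n * (34 + B) + 11)

opaque
  -- The counter runs from n ∸ 1 down to 0.  The invariant I i describes the state
  -- when i rounds remain; it must not mention the counter, so that it survives
  -- the decrement.
  run-for : ∀ {v e c s B} n (I : ℕ → Config → Set) → {T (not (writes c v))} →
            ⟦ e ⟧ᴱ (cells s) ≡ n → I n (s at v ≔ n) →
            (∀ i s′ → i < n → Frame for v from e ⟨ c ⟩ s s′ → I (suc i) s′ → Run c (s′ at v ≔ i) B (I i)) →
            Run for v from e ⟨ c ⟩ s (for-time e n B) (I 0)
  run-for {v} {e} {c} {s₀} {B} n I {v∉c} refl inv₀ body
    = let ran r b q = go n (s₀ at v ≔ n) ≤-refl start (same s₀ n) inv₀ in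
    ran (seq set r) (≤-trans (+-monoʳ-≤ (1 + (8 + (costᴱ e + 1))) b)
        (≤-reflexive (cong (_+ (n * (34 + B) + 11)) (cong (9 +_) (+-comm (costᴱ e) 1))))) q
    where
    same : ∀ s k → cells (s at v ≔ k) v 0 ≡ k
    same s k rewrite ≡ᵇ-refl (toℕ (slot v)) = refl
    start : Frame for v from e ⟨ c ⟩ s₀ (s₀ at v ≔ n)
    start u {t} = unwritten (cells s₀) v 0 n u (not-∨ˡ t)
    round : Cmd
    round = v ! lit 0 ≔ v ! lit 0 ⊖ lit 1 ⨾ c
    go : ∀ i s → i ≤ n → Frame for v from e ⟨ c ⟩ s₀ s → cells s v 0 ≡ i → I i s →
         Run while v ! lit 0 ⟨ round ⟩ s (i * (34 + B) + 11) (I 0)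
    go zero s i≤n fr eq inv = ran (exit eq) ≤-refl inv
    go (suc i) s i<n fr eq inv
      with ran {s′} r b inv′ ← body i s i<n fr inv
      with ran r′ b′ q ← go i s′ (<⇒≤ i<n)
             (λ u {t} → trans (frame r u {not-∨ʳ {writes (v ! lit 0 ≔ e) u} (not-∨ʳ {writes (v ! lit 0 ≔ e) u} t)})
                       (trans (unwritten (cells s) v 0 i u (not-∨ˡ t)) (fr u {t})))
             (trans (cong (λ f → f 0) (frame r v {v∉c})) (same s i)) inv′ =
      ran (loop eq (seq set (subst (λ z → c , tape s ▹ cells s ⟨ v ! 0 ≔ z ⟩ ⇓[ _ ] s′) (sym (cong (_∸ 1) eq)) r)) r′)
          (≤-trans (+-monoʳ-≤ 33 (≤-trans (+-mono-≤ b (s≤s b′)) (≤-reflexive (+-suc B _))))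
                   (≤-reflexive (sym (+-assoc (34 + B) (i * (34 + B)) 11)))) q

infix 8 &_
&_ : Var → Expr
& v = v ! lit 0

infix 5 _:=_
_:=_ : Var → Expr → Cmd
v := e = v ! lit 0 ≔ e

increment : Var → Cmd
increment v = v := & v ⊕ lit 1

-- Parsing the formula

-- lit 4 ⊖ & %tok is 1 at a negation and 0 at an atom.
literal connective symbol parse : Cmd
literal =
  %sgn ! & %len ≔ lit 4 ⊖ & %tok ⨾
  when lit 4 ⊖ & %tok ⟨ input %tok ∣ skip ⟩ ⨾
  %op ! & %len ≔ & %tok ⨾
  input %tok ⨾ %lhs ! & %len ≔ & %tok ⨾
  input %tok ⨾ %rhs ! & %len ≔ & %tok ⨾
  increment %len ⨾
  %need := & %need ⊖ lit 1
connective = %op ! & %len ≔ & %tok ⨾ increment %len ⨾ increment %need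
symbol =
  input %tok ⨾
  when & %tok
    ⟨ when & %tok ⊖ lit 2 ⟨ literal ∣ connective ⟩
    ∣ increment %vars ⟩
-- `%need` counts the formulas still to be read: a connective replaces one by two, a literal
-- completes one, a quantifier changes nothing. At 0 the self-delimiting code has ended.
parse = %need := lit 1 ⨾ while & %need ⟨ symbol ⟩

-- The nodes of the syntax tree in prefix order; %sgn is 1 at a negated atom.
node : Store → ℕ → ℕ × ℕ × ℕ × ℕ
node σ n = σ %op n , σ %sgn n , σ %lhs n , σ %rhs n

nodes : ∀ {k} → Matrix k → ℕ
nodes (pos α)  = 1
nodes (neg α)  = 1
nodes (ψ ∧′ χ) = suc (nodes ψ + nodes χ)
nodes (ψ ∨′ χ) = suc (nodes ψ + nodes χ)

atomNode : ∀ {k} → ℕ → Atom k → ℕ × ℕ × ℕ × ℕ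
atomNode s (x ≐ y) = 4 , s , toℕ x , toℕ y
atomNode s (x ≼ y) = 5 , s , toℕ x , toℕ y

Stored : ∀ {k} → Store → ℕ → Matrix k → Set
Stored σ l (pos α)  = node σ l ≡ atomNode 0 α
Stored σ l (neg α)  = node σ l ≡ atomNode 1 α
Stored σ l (ψ ∧′ χ) = σ %op l ≡ 1 × Stored σ (suc l) ψ × Stored σ (suc l + nodes ψ) χ
Stored σ l (ψ ∨′ χ) = σ %op l ≡ 2 × Stored σ (suc l) ψ × Stored σ (suc l + nodes ψ) χ

Stored-cong : ∀ {k} (ψ : Matrix k) {σ τ l} → (∀ n → n < l + nodes ψ → node τ n ≡ node σ n) → Stored σ l ψ → Stored τ l ψ
Stored-cong₂ : ∀ {k} (ψ χ : Matrix k) {σ τ l d} → (∀ n → n < l + suc (nodes ψ + nodes χ) → node τ n ≡ node σ n) →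
               σ %op l ≡ d × Stored σ (suc l) ψ × Stored σ (suc l + nodes ψ) χ →
               τ %op l ≡ d × Stored τ (suc l) ψ × Stored τ (suc l + nodes ψ) χ
Stored-cong₂ ψ χ {l = l} same (o , s , t) =
  trans (cong proj₁ (same l (m<m+n l (s≤s z≤n)))) o ,
  Stored-cong ψ (λ n n< → same n (≤-trans n< (≤-trans (m≤m+n _ (nodes χ)) end))) s ,
  Stored-cong χ (λ n n< → same n (≤-trans n< end)) t
  where
  end = ≤-reflexive (trans (cong suc (+-assoc l (nodes ψ) (nodes χ))) (sym (+-suc l _)))

Stored-cong (pos α) {l = l} same st = trans (same l (m<m+n l (s≤s z≤n))) st
Stored-cong (neg α) {l = l} same st = trans (same l (m<m+n l (s≤s z≤n))) st
Stored-cong (ψ ∧′ χ) same st = Stored-cong₂ ψ χ same st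
Stored-cong (ψ ∨′ χ) same st = Stored-cong₂ ψ χ same st

quad : ∀ {a b c d a′ b′ c′ d′ : ℕ} → a ≡ a′ → b ≡ b′ → c ≡ c′ → d ≡ d′ → (a , b , c , d) ≡ (a′ , b′ , c′ , d′)
quad refl refl refl refl = refl

record Parsed (σ : Store) (rest : List ℕ) (q l : ℕ) (s : Config) : Set where
  field
    tape≡ : tape s ≡ rest
    need≡ : cells s %need 0 ≡ q
    len≡  : cells s %len 0 ≡ l
    vars≡ : cells s %vars 0 ≡ σ %vars 0
    below : ∀ n → n < σ %len 0 → node (cells s) n ≡ node σ n

opaque
  symbol-time : ℕ
  symbol-time = 12 + ticks symbol

  parse-step : ∀ {s q B Q} → cells s %need 0 ≡ suc q → Run while & %need ⟨ symbol ⟩ (perform symbol s) B Q →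
               Run while & %need ⟨ symbol ⟩ s (symbol-time + B) Q
  parse-step {s} {B = B} eq (ran r b q) =
    let _ , r₀ , b₀ = performs symbol s tt
    in ran (loop eq r₀ r) (+-monoʳ-≤ 11 (≤-trans (+-mono-≤ b₀ (s≤s b)) (≤-reflexive (+-suc (ticks symbol) B)))) q

opaque
  parse-literal : ∀ {k} (ψ : Matrix k) rest q σ s →
    cells s ≡ σ → σ %need 0 ≡ suc q → ∀ {B Q} → 
    (let s′ = perform symbol s in
     tape s′ ≡ rest × cells s′ %need 0 ≡ σ %need 0 ∸ 1 × cells s′ %len 0 ≡ σ %len 0 + 1 × cells s′ %vars 0 ≡ σ %vars 0 ×
     (∀ n → n < σ %len 0 → node (cells s′) n ≡ node σ n) × Stored (cells s′) (σ %len 0) ψ) →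
    (∀ t → Parsed σ rest q (σ %len 0 + 1) t → Stored (cells t) (σ %len 0) ψ → Run while & %need ⟨ symbol ⟩ t B Q) →
    Run while & %need ⟨ symbol ⟩ s (symbol-time + B) Q
  parse-literal ψ rest q σ s refl eq (t≡ , n≡ , l≡ , v≡ , be , st) next =
    parse-step {s} eq (next (perform symbol s)
      (record { tape≡ = t≡ ; need≡ = trans n≡ (cong (_∸ 1) eq) ; len≡ = l≡ ; vars≡ = v≡ ; below = be }) st)

  literal-below : ∀ (f g h j : ℕ → ℕ) l a b c d n → n < l →
    ((f [ l ≔ a ]) n , (g [ l ≔ b ]) n , (h [ l ≔ c ]) n , (j [ l ≔ d ]) n) ≡ (f n , g n , h n , j n)
  literal-below f g h j l a b c d n n<l =
    let n≢l = <⇒≢ n<l in quad (≔-other f a n≢l) (≔-other g b n≢l) (≔-other h c n≢l) (≔-other j d n≢l)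

  literal-at : ∀ (f g h j : ℕ → ℕ) l a b c d →
    ((f [ l ≔ a ]) l , (g [ l ≔ b ]) l , (h [ l ≔ c ]) l , (j [ l ≔ d ]) l) ≡ (a , b , c , d)
  literal-at f g h j l a b c d = quad (≔-same f l a) (≔-same g l b) (≔-same h l c) (≔-same j l d)

  -- One loop reads the whole formula, so a subformula corresponds to a stretch of its rounds and
  -- not to a command. Therefore the induction is in continuation-passing style: a run of the loop
  -- after ψ is extended to one that starts before ψ.
  parse-matrix : ∀ {k} (ψ : Matrix k) rest q s → tape s ≡ codeᴹ ψ ++ rest → cells s %need 0 ≡ suc q → ∀ {B Q} →
    (∀ t → Parsed (cells s) rest q (cells s %len 0 + nodes ψ) t → Stored (cells t) (cells s %len 0) ψ →
      Run while & %need ⟨ symbol ⟩ t B Q) →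
    Run while & %need ⟨ symbol ⟩ s (length (codeᴹ ψ) * symbol-time + B) Q

  parse-connective : ∀ {k} (ψ χ : Matrix k) rest q σ s d →
    tape s ≡ codeᴹ ψ ++ codeᴹ χ ++ rest → cells s %need 0 ≡ suc (suc q) → cells s %len 0 ≡ σ %len 0 + 1 →
    cells s %vars 0 ≡ σ %vars 0 → (∀ n → n < σ %len 0 → node (cells s) n ≡ node σ n) → cells s %op (σ %len 0) ≡ d → ∀ {B Q} →
    (∀ t → Parsed σ rest q (σ %len 0 + suc (nodes ψ + nodes χ)) t →
      cells t %op (σ %len 0) ≡ d × Stored (cells t) (suc (σ %len 0)) ψ × Stored (cells t) (suc (σ %len 0) + nodes ψ) χ →
      Run while & %need ⟨ symbol ⟩ t B Q) →
    Run while & %need ⟨ symbol ⟩ s (length (codeᴹ ψ ++ codeᴹ χ) * symbol-time + B) Q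
  parse-connective ψ χ rest q σ s d t≡ n≡ l≡ v≡ be o≡ {B} next =
    run-weaken (≤-reflexive (trans (sym (+-assoc (length (codeᴹ ψ) * symbol-time) _ B)) (cong (_+ B)
      (trans (sym (*-distribʳ-+ symbol-time (length (codeᴹ ψ)) _)) (cong (_* symbol-time) (sym (length-++ (codeᴹ ψ))))))))
      (λ _ _ p → p)
    (parse-matrix ψ (codeᴹ χ ++ rest) (suc q) s t≡ n≡ λ s₁ p₁ st₁ →
     parse-matrix χ rest q s₁ (Parsed.tape≡ p₁) (Parsed.need≡ p₁) λ s₂ p₂ st₂ →
     let l = σ %len 0
         l₁ : cells s %len 0 ≡ suc l
         l₁ = trans l≡ (+-comm l 1)
         l₂ : cells s₁ %len 0 ≡ suc l + nodes ψ
         l₂ = trans (Parsed.len≡ p₁) (cong (_+ nodes ψ) l₁)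
         same : ∀ n → n < suc l + nodes ψ → node (cells s₂) n ≡ node (cells s₁) n
         same n n< = Parsed.below p₂ n (≤-trans n< (≤-reflexive (sym l₂)))
         same′ : ∀ n → n < suc l → node (cells s₂) n ≡ node (cells s) n
         same′ n n< = trans (same n (≤-trans n< (m≤m+n (suc l) (nodes ψ))))
             (Parsed.below p₁ n (≤-trans n< (≤-reflexive (sym l₁))))
     in next s₂
       (record { tape≡ = Parsed.tape≡ p₂ ; need≡ = Parsed.need≡ p₂
               ; len≡ = trans (Parsed.len≡ p₂) (trans (cong (_+ nodes χ) l₂)
                   (trans (cong suc (+-assoc l (nodes ψ) (nodes χ))) (sym (+-suc l _))))
               ; vars≡ = trans (Parsed.vars≡ p₂) (trans (Parsed.vars≡ p₁) v≡)
               ; below = λ n n< → trans (same′ n (m<n⇒m<1+n n<)) (be n n<) })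
       ( trans (cong proj₁ (same′ l (n<1+n l))) o≡
       , Stored-cong ψ same (subst (λ z → Stored (cells s₁) z ψ) l₁ st₁)
       , subst (λ z → Stored (cells s₂) z χ) l₂ st₂))

  parse-matrix (pos (x ≐ y)) rest q (_ ▹ σ) refl eq next =
    -- An atom has three code symbols, four with a negation, but is read in a single round; the
    -- bound charges a round to every symbol.
    run-weaken (+-monoˡ-≤ _ (m≤m+n symbol-time (2 * symbol-time))) (λ _ _ p → p)
    (parse-literal (pos (x ≐ y)) rest q σ _ refl eq
      (refl , refl , refl , refl , literal-below _ _ _ _ _ _ _ _ _ , literal-at (σ %op) (σ %sgn) (σ %lhs) (σ %rhs)
          (σ %len 0) _ _ _ _) next)
  parse-matrix (pos (x ≼ y)) rest q (_ ▹ σ) refl eq next =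
    run-weaken (+-monoˡ-≤ _ (m≤m+n symbol-time (2 * symbol-time))) (λ _ _ p → p)
    (parse-literal (pos (x ≼ y)) rest q σ _ refl eq
      (refl , refl , refl , refl , literal-below _ _ _ _ _ _ _ _ _ , literal-at (σ %op) (σ %sgn) (σ %lhs) (σ %rhs)
          (σ %len 0) _ _ _ _) next)
  parse-matrix (neg (x ≐ y)) rest q (_ ▹ σ) refl eq next =
    run-weaken (+-monoˡ-≤ _ (m≤m+n symbol-time (3 * symbol-time))) (λ _ _ p → p)
    (parse-literal (neg (x ≐ y)) rest q σ _ refl eq
      (refl , refl , refl , refl , literal-below _ _ _ _ _ _ _ _ _ , literal-at (σ %op) (σ %sgn) (σ %lhs) (σ %rhs)
          (σ %len 0) _ _ _ _) next)
  parse-matrix (neg (x ≼ y)) rest q (_ ▹ σ) refl eq next =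
    run-weaken (+-monoˡ-≤ _ (m≤m+n symbol-time (3 * symbol-time))) (λ _ _ p → p)
    (parse-literal (neg (x ≼ y)) rest q σ _ refl eq
      (refl , refl , refl , refl , literal-below _ _ _ _ _ _ _ _ _ , literal-at (σ %op) (σ %sgn) (σ %lhs) (σ %rhs)
          (σ %len 0) _ _ _ _) next)
  parse-matrix (ψ ∧′ χ) rest q (_ ▹ σ) refl eq next =
    run-weaken (≤-reflexive (sym (+-assoc symbol-time (length (codeᴹ ψ ++ codeᴹ χ) * symbol-time) _))) (λ _ _ p → p)
    (parse-step eq (parse-connective ψ χ rest q σ _ 1 (++-assoc (codeᴹ ψ) (codeᴹ χ) rest)
      (trans (+-comm _ 1) (cong suc eq)) refl refl
      (λ n n< → cong (_, (σ %sgn n , σ %lhs n , σ %rhs n)) (≔-other (σ %op) 1 (<⇒≢ n<))) (≔-same (σ %op) (σ %len 0) 1) next))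
  parse-matrix (ψ ∨′ χ) rest q (_ ▹ σ) refl eq next =
    run-weaken (≤-reflexive (sym (+-assoc symbol-time (length (codeᴹ ψ ++ codeᴹ χ) * symbol-time) _))) (λ _ _ p → p)
    (parse-step eq (parse-connective ψ χ rest q σ _ 2 (++-assoc (codeᴹ ψ) (codeᴹ χ) rest)
      (trans (+-comm _ 1) (cong suc eq)) refl refl
      (λ n n< → cong (_, (σ %sgn n , σ %lhs n , σ %rhs n)) (≔-other (σ %op) 2 (<⇒≢ n<))) (≔-same (σ %op) (σ %len 0) 2) next))

variables : ∀ {k} → ∃Formula k → ℕ
variables {k} (matrix ψ) = k
variables (ex φ)         = variables φ

matrixOf : ∀ {k} (φ : ∃Formula k) → Matrix (variables φ)
matrixOf (matrix ψ) = ψ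
matrixOf (ex φ)     = matrixOf φ

module _ {n} (P : FinPoset n) where

  sat⇒matrix : ∀ {k} (φ : ∃Formula k) → (∃[ ρ ] ⟦_⟧ P φ ρ) → ∃[ ρ ] ⟦_⟧ᴹ P (matrixOf φ) ρ
  sat⇒matrix (matrix ψ) sat              = sat
  sat⇒matrix (ex φ)     (ρ , a , holds) = sat⇒matrix φ (a Vec.∷ ρ , holds)

  matrix⇒sat : ∀ {k} (φ : ∃Formula k) → (∃[ ρ ] ⟦_⟧ᴹ P (matrixOf φ) ρ) → ∃[ ρ ] ⟦_⟧ P φ ρ
  matrix⇒sat (matrix ψ) sat = sat
  matrix⇒sat (ex φ)     sat with a Vec.∷ ρ , holds ← matrix⇒sat φ sat = ρ , a , holds

record ParsedSentence {k} (φ : ∃Formula k) (rest : List ℕ) (s : Config) : Set where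
  field
    tape≡  : tape s ≡ rest
    vars≡  : cells s %vars 0 ≡ variables φ
    len≡   : cells s %len 0 ≡ nodes (matrixOf φ)
    stored : Stored (cells s) 0 (matrixOf φ)

parse-time : ℕ → ℕ
parse-time c = 11 + (c * symbol-time + 11)

opaque
  parse-prefix : ∀ {k} (φ : ∃Formula k) rest s → tape s ≡ code φ ++ rest → cells s %need 0 ≡ 1 →
    cells s %len 0 ≡ 0 → cells s %vars 0 ≡ k →
    Run while & %need ⟨ symbol ⟩ s (length (code φ) * symbol-time + 11) (ParsedSentence φ rest)
  parse-prefix (matrix ψ) rest s t≡ n≡ l≡ v≡ =
    parse-matrix ψ rest 0 s t≡ n≡ λ t p st → ran (exit (Parsed.need≡ p)) ≤-refl record
      { tape≡ = Parsed.tape≡ p ; vars≡ = trans (Parsed.vars≡ p) v≡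
      ; len≡ = trans (Parsed.len≡ p) (cong (_+ nodes ψ) l≡) ; stored = subst (λ l → Stored (cells t) l ψ) l≡ st }
  parse-prefix (ex φ) rest (_ ▹ σ) refl n≡ l≡ v≡ =
    run-weaken (≤-reflexive (sym (+-assoc symbol-time (length (code φ) * symbol-time) 11)))
      (λ _ _ p → record { ParsedSentence p })
      (parse-step n≡ (parse-prefix φ rest _ refl n≡ l≡ (trans (+-comm _ 1) (cong suc v≡))))

  parse-correct : ∀ (φ : ∃Sentence) rest →
    Run parse (blank (code φ ++ rest)) (parse-time (length (code φ))) (ParsedSentence φ rest)
  parse-correct φ rest =
    run-after (parse-prefix φ rest _ refl refl refl refl)

-- Reading the order

-- `%row` stores where each row starts, which replaces the product in the address of an entry.
-- `%deg` sums the columns: it counts the elements below or equal to a given one, and so increases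
-- strictly along the order.
readCell readRow readPoset : Cmd
readCell =
  input %tok ⨾ %mat ! & %ptr ≔ & %tok ⨾ %deg ! & %κ ≔ %deg ! & %κ ⊕ & %tok ⨾ increment %ptr ⨾ increment %κ
readRow = for %loop₂ from & %size ⟨ readCell ⟩
startRow : Cmd
startRow = %row ! & %ι ≔ & %ptr ⨾ %κ := lit 0
readPoset = input %size ⨾ for %loop₁ from & %size ⟨ startRow ⨾ readRow ⨾ increment %ι ⟩

sumTo : ℕ → (ℕ → ℕ) → ℕ
sumTo zero    f = 0
sumTo (suc n) f = sumTo n f + f n

segment : (ℕ → ℕ) → ℕ → ℕ → List ℕ
segment f j zero    = []
segment f j (suc c) = f j ∷ segment f (suc j) c

rows : (ℕ → ℕ → ℕ) → ℕ → ℕ → ℕ → List ℕ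
rows b n i zero    = []
rows b n i (suc c) = segment (b i) 0 n ++ rows b n (suc i) c

record RowRead (b : ℕ → ℕ) (rest : List ℕ) (p n : ℕ) (mat₀ deg₀ : ℕ → ℕ) (r : ℕ) (s : Config) : Set where
  field
    j     : ℕ
    j+r≡n : j + r ≡ n
    κ≡    : cells s %κ 0 ≡ j
    ptr≡  : cells s %ptr 0 ≡ p + j
    tape≡ : tape s ≡ segment b j r ++ rest
    mat≡  : ∀ j′ → j′ < j → cells s %mat (p + j′) ≡ b j′
    old   : ∀ a → a < p → cells s %mat a ≡ mat₀ a
    deg≡  : ∀ j′ → j′ < j → cells s %deg j′ ≡ deg₀ j′ + b j′
    deg₀≡ : ∀ j′ → j ≤ j′ → cells s %deg j′ ≡ deg₀ j′

row-time : ℕ → ℕ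
row-time n = for-time (& %size) n (ticks readCell)

poset-time : ℕ → ℕ
poset-time n = 1 + for-time (& %size) n (ticks startRow + (row-time n + ticks (increment %ι)))

+1≡ : ∀ {m n} → m ≡ n → m + 1 ≡ suc n
+1≡ {m} eq = trans (+-comm m 1) (cong suc eq)

next-round : ∀ {r} m {n} → m + suc r ≡ n → suc m + r ≡ n
next-round {r} m eq = trans (sym (+-suc m r)) eq

≤-suc-split : ∀ {m n} → m < suc n → m < n ⊎ m ≡ n
≤-suc-split m<1+n = m≤n⇒m<n∨m≡n (≤-pred m<1+n)

opaque
  read-cell : ∀ {b rest p n mat₀ deg₀} i s′ → RowRead b rest p n mat₀ deg₀ (suc i) s′ → RowRead b rest p n mat₀ deg₀ i
      (perform readCell (s′ at %loop₂ ≔ i))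
  read-cell {b} {rest} {p} {n} {mat₀} {deg₀} i (ts ▹ σ) record { j = j ; j+r≡n = j+r≡n ; κ≡ = κ≡ ; ptr≡ = ptr≡ ; tape≡ =
      refl ; mat≡ = mat≡ ; old = old ; deg≡ = deg≡ ; deg₀≡ = deg₀≡ } = record
    { j     = suc j
    ; j+r≡n = next-round j j+r≡n
    ; κ≡    = +1≡ κ≡
    ; ptr≡  = trans (+-comm _ 1) (trans (cong suc ptr≡) (sym (+-suc p j)))
    ; tape≡ = refl
    ; mat≡  = mat′
    ; old   = λ a a<p → trans (≔-other (σ %mat) (b j) (λ eq → <⇒≢ (≤-trans a<p (m≤m+n p j)) (trans eq ptr≡))) (old a a<p)
    ; deg≡  = deg′
    ; deg₀≡ = λ j′ j<j′ → trans (≔-other (σ %deg) _ (λ eq → <⇒≢ j<j′ (sym (trans eq κ≡)))) (deg₀≡ j′ (<⇒≤ j<j′))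
    }
    where
    mat′ : ∀ j′ → j′ < suc j → (σ %mat [ σ %ptr 0 ≔ b j ]) (p + j′) ≡ b j′
    mat′ j′ j′<1+j with ≤-suc-split j′<1+j
    ... | inj₁ j′<j = trans (≔-other (σ %mat) (b j) (λ eq → <⇒≢ j′<j (+-cancelˡ-≡ p _ _ (trans eq ptr≡)))) (mat≡ j′ j′<j)
    ... | inj₂ refl = trans (cong (σ %mat [ σ %ptr 0 ≔ b j ]) (sym ptr≡)) (≔-same (σ %mat) (σ %ptr 0) (b j))
    deg′ : ∀ j′ → j′ < suc j → (σ %deg [ σ %κ 0 ≔ σ %deg (σ %κ 0) + b j ]) j′ ≡ deg₀ j′ + b j′
    deg′ j′ j′<1+j with ≤-suc-split j′<1+j
    ... | inj₁ j′<j = trans (≔-other (σ %deg) _ (λ eq → <⇒≢ j′<j (trans eq κ≡))) (deg≡ j′ j′<j)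
    ... | inj₂ refl rewrite κ≡ = trans (≔-same (σ %deg) j _) (cong (_+ b j) (deg₀≡ j ≤-refl))

  read-row : ∀ b rest n s → cells s %size 0 ≡ n → cells s %κ 0 ≡ 0 → tape s ≡ segment b 0 n ++ rest →
    Run readRow s (row-time n) (RowRead b rest (cells s %ptr 0) n (cells s %mat) (cells s %deg) 0)
  read-row b rest n s n≡ κ≡ t≡ = run-for n (RowRead b rest (cells s %ptr 0) n (cells s %mat) (cells s %deg)) n≡
    (record { j = 0 ; j+r≡n = refl ; κ≡ = κ≡ ; ptr≡ = sym (+-identityʳ _) ; tape≡ = t≡
            ; mat≡ = λ _ () ; old = λ _ _ → refl ; deg≡ = λ _ () ; deg₀≡ = λ _ _ → refl })
    λ i s′ _ _ inv → run-block (read-cell i s′ inv)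

-- That the addresses of the rows read so far lie below `%ptr` protects them from the rows written
-- later.
record PosetRead (b : ℕ → ℕ → ℕ) (n r : ℕ) (s : Config) : Set where
  field
    i     : ℕ
    i+r≡n : i + r ≡ n
    ι≡    : cells s %ι 0 ≡ i
    tape≡ : tape s ≡ rows b n i r
    mat≡  : ∀ i′ j → i′ < i → j < n → cells s %row i′ + j < cells s %ptr 0 × cells s %mat (cells s %row i′ + j) ≡ b i′ j
    deg≡  : ∀ j → j < n → cells s %deg j ≡ sumTo i (λ i′ → b i′ j)

record HasPoset (b : ℕ → ℕ → ℕ) (n : ℕ) (σ : Store) : Set where
  field
    size≡ : σ %size 0 ≡ n
    mat≡  : ∀ i j → i < n → j < n → σ %mat (σ %row i + j) ≡ b i j
    deg≡  : ∀ j → j < n → σ %deg j ≡ sumTo n (λ i → b i j)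

opaque
  read-poset : ∀ b n s → tape s ≡ n ∷ rows b n 0 n → cells s %ι 0 ≡ 0 → (∀ j → cells s %deg j ≡ 0) →
    Run readPoset s (poset-time n) (λ s′ → HasPoset b n (cells s′))
  read-poset b n (_ ▹ σ) refl ι≡ deg≡ =
    run-after (
    run-weaken ≤-refl (λ s′ fr inv → record
        { size≡ = cong-app (fr %size) 0
        ; mat≡  = λ i j i<n j<n → proj₂ (PosetRead.mat≡ inv i j (subst (i <_) (total inv) i<n) j<n)
        ; deg≡  = λ j j<n → trans (PosetRead.deg≡ inv j j<n) (cong (λ m → sumTo m (λ i → b i j)) (sym (total inv))) })
      (run-for n (PosetRead b n) refl
        (record { i = 0 ; i+r≡n = refl ; ι≡ = ι≡ ; tape≡ = refl ; mat≡ = λ _ _ () ; deg≡ = λ j _ → deg≡ j })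
        λ r s′ _ fr inv → body r s′ (cong-app (fr %size) 0) inv))
    where
    total : ∀ {s} (inv : PosetRead b n 0 s) → n ≡ PosetRead.i inv
    total inv = trans (sym (PosetRead.i+r≡n inv)) (+-identityʳ _)
    body : ∀ r s′ → cells s′ %size 0 ≡ n → PosetRead b n (suc r) s′ →
           Run (startRow ⨾ readRow ⨾ increment %ι) (s′ at %loop₁ ≔ r) (ticks startRow + (row-time n + ticks (increment %ι)))
               (PosetRead b n r)
    body r (_ ▹ τ) n≡ record { i = i ; i+r≡n = i+r≡n ; ι≡ = ι≡ ; tape≡ = refl ; mat≡ = mat≡ ; deg≡ = deg≡ } =
      run-after (
      run-seq (read-row (b i) (rows b n (suc i) r) n _ n≡ refl refl) λ s₂ fr inv → run-block
      (let module R = RowRead inv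
           j≡n : R.j ≡ n
           j≡n = trans (sym (+-identityʳ _)) R.j+r≡n
           row≡ : ∀ k → cells s₂ %row k ≡ (τ %row [ τ %ι 0 ≔ τ %ptr 0 ]) k
           row≡ k = cong-app (fr %row) k
           ptr≡ : cells s₂ %ptr 0 ≡ τ %ptr 0 + n
           ptr≡ = trans R.ptr≡ (cong (τ %ptr 0 +_) j≡n)
           mat′ : ∀ i′ j → i′ < suc i → j < n →
                  cells s₂ %row i′ + j < cells s₂ %ptr 0 × cells s₂ %mat (cells s₂ %row i′ + j) ≡ b i′ j
           mat′ = λ i′ j i′<1+i j<n → case-row i′ j i′<1+i j<n (row≡ i′) ptr≡
                    (λ j′ j′<n → R.mat≡ j′ (subst (j′ <_) (sym j≡n) j′<n)) R.old
       in record
       { i     = suc i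
       ; i+r≡n = next-round i i+r≡n
       ; ι≡    = +1≡ (trans (cong-app (fr %ι) 0) ι≡)
       ; tape≡ = R.tape≡
       ; mat≡  = mat′
       ; deg≡  = λ j j<n → trans (R.deg≡ j (subst (j <_) (sym j≡n) j<n)) (cong (_+ b i j) (deg≡ j j<n)) }))
      where
      case-row : ∀ i′ j → i′ < suc i → j < n → ∀ {ρ q} {μ : ℕ → ℕ} → ρ ≡ (τ %row [ τ %ι 0 ≔ τ %ptr 0 ]) i′ →
          q ≡ τ %ptr 0 + n →
                 (∀ j′ → j′ < n → μ (τ %ptr 0 + j′) ≡ b i j′) → (∀ a → a < τ %ptr 0 → μ a ≡ τ %mat a) →
                 ρ + j < q × μ (ρ + j) ≡ b i′ j
      case-row i′ j i′<1+i j<n {μ = μ} refl refl new old with ≤-suc-split i′<1+i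
      ... | inj₂ refl rewrite ι≡ | ≔-same (τ %row) i′ (τ %ptr 0) = +-monoʳ-< (τ %ptr 0) j<n , new j j<n
      ... | inj₁ i′<i rewrite ≔-other (τ %row) (τ %ptr 0) (λ eq → <⇒≢ i′<i (trans eq ι≡)) =
        let lt , eq = mat≡ i′ j i′<i j<n in ≤-trans lt (m≤m+n _ n) , trans (old _ lt) eq

-- Colouring the poset by chains

eqBit : ℕ → ℕ → ℕ
eqBit a b = if a ≡ᵇ b then 1 else 0

eqBit-refl : ∀ a → eqBit a a ≡ 1
eqBit-refl a rewrite ≡ᵇ-refl a = refl

eqBit-≢ : ∀ {a b} → a ≢ b → eqBit a b ≡ 0
eqBit-≢ a≢b rewrite ≢⇒≡ᵇ-false a≢b = refl

count : (ℕ → ℕ) → ℕ → ℕ → ℕ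
count f zero    i = 0
count f (suc m) i = count f m i + eqBit (f m) i

count-cong : ∀ {f g} m i → (∀ c → c < m → f c ≡ g c) → count f m i ≡ count g m i
count-cong zero    i f≡g = refl
count-cong (suc m) i f≡g = cong₂ _+_ (count-cong m i λ c c<m → f≡g c (m<n⇒m<1+n c<m)) (cong (λ z → eqBit z i) (f≡g m ≤-refl))

exchange : ∀ a b c → a + b + c ≡ a + c + b
exchange = solve-∀

-- Both sides count the common values away from c and the two values at c; adding on both sides
-- avoids truncated subtraction.
count-point : ∀ {f g} m c i → c < m → (∀ k → k < m → k ≢ c → f k ≡ g k) →
              count f m i + eqBit (g c) i ≡ count g m i + eqBit (f c) i
count-point {f} {g} (suc m) c i c<1+m f≡g with ≤-suc-split c<1+m
... | inj₂ refl = trans (cong (λ z → z + eqBit (f m) i + eqBit (g m) i)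
                    (count-cong m i λ k k<m → f≡g k (m<n⇒m<1+n k<m) (<⇒≢ k<m))) (exchange (count g m i) _ _)
... | inj₁ c<m  = trans (exchange (count f m i) _ _) (trans
                    (cong₂ _+_ (count-point m c i c<m λ k k<m → f≡g k (m<n⇒m<1+n k<m))
                               (cong (λ z → eqBit z i) (f≡g m ≤-refl (≢-sym (<⇒≢ c<m)))))
                    (exchange (count g m i) _ _))

swap : ℕ → ℕ → ℕ
swap i l = if l ≡ᵇ suc i then i else (if l ≡ᵇ i then suc i else l)

swap-suc : ∀ i → swap i (suc i) ≡ i
swap-suc i rewrite ≡ᵇ-refl i = refl

swap-same : ∀ i → swap i i ≡ suc i
swap-same i rewrite ≢⇒≡ᵇ-false {i} {suc i} (<⇒≢ ≤-refl) | ≡ᵇ-refl i = refl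

swap-other : ∀ {i l} → l ≢ suc i → l ≢ i → swap i l ≡ l
swap-other p q rewrite ≢⇒≡ᵇ-false p | ≢⇒≡ᵇ-false q = refl

swap-involutive : ∀ i l → swap i (swap i l) ≡ l
swap-involutive i l with l ≟ suc i | l ≟ i
... | yes refl | _        = trans (cong (swap i) (swap-suc i)) (swap-same i)
... | no _     | yes refl = trans (cong (swap i) (swap-same i)) (swap-suc i)
... | no p     | no q     = trans (cong (swap i) (swap-other p q)) (swap-other p q)

eqBit-swap : ∀ i l j → eqBit (swap i l) j ≡ eqBit l (swap i j)
eqBit-swap i l j with l ≟ swap i j
... | yes refl = trans (cong (λ z → eqBit z j) (swap-involutive i j)) (trans (eqBit-refl j) (sym (eqBit-refl (swap i j))))
... | no p     = trans (eqBit-≢ {swap i l} {j} λ eq → p (trans (sym (swap-involutive i l)) (cong (swap i) eq)))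
    (sym (eqBit-≢ {l} {swap i j} p))

count-swap : ∀ f i m j → count (λ c → swap i (f c)) m j ≡ count f m (swap i j)
count-swap f i zero    j = refl
count-swap f i (suc m) j = cong₂ _+_ (count-swap f i m j) (eqBit-swap i (f m) j)

module _ (top lab : ℕ → ℕ) (i : ℕ) where

  tops : ℕ → List ℕ
  tops zero    = []
  tops (suc m) = if lab m ≡ᵇ i then top m ∷ tops m else tops m

  length-tops : ∀ m → length (tops m) ≡ count lab m i
  length-tops zero    = refl
  length-tops (suc m) with lab m ≡ᵇ i
  ... | true  = trans (cong suc (length-tops m)) (+-comm 1 _)
  ... | false = trans (length-tops m) (sym (+-identityʳ _))

  All-tops : ∀ {Q : ℕ → Set} m → (∀ c → c < m → lab c ≡ i → Q (top c)) → All Q (tops m)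
  All-tops zero    q = []
  All-tops (suc m) q with lab m ≡ᵇ i in eq
  ... | true  = q m ≤-refl (≡ᵇ⇒≡ (lab m) i (subst T (sym eq) tt)) ∷ All-tops m λ c c<m → q c (m<n⇒m<1+n c<m)
  ... | false = All-tops m λ c c<m → q c (m<n⇒m<1+n c<m)

  AllPairs-tops : ∀ {R : ℕ → ℕ → Set} m →
    (∀ c d → c < m → d < m → c ≢ d → lab c ≡ i → lab d ≡ i → R (top c) (top d)) → AllPairs R (tops m)
  AllPairs-tops zero    r = []
  AllPairs-tops {R} (suc m) r with lab m ≡ᵇ i in eq
  ... | true  = All-tops m (λ c c<m lc → r m c ≤-refl (m<n⇒m<1+n c<m) (≢-sym (<⇒≢ c<m))
      (≡ᵇ⇒≡ (lab m) i (subst T (sym eq) tt)) lc)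
              ∷ AllPairs-tops m λ c d c<m d<m → r c d (m<n⇒m<1+n c<m) (m<n⇒m<1+n d<m)
  ... | false = AllPairs-tops m λ c d c<m d<m → r c d (m<n⇒m<1+n c<m) (m<n⇒m<1+n d<m)

-- What the colouring and the ascent use of the poset: `le` is its 0/1 matrix, `dg` a function
-- increasing strictly along the order, and the width is a bound on lists of pairwise incomparable
-- elements.
record Order (n w : ℕ) (le : ℕ → ℕ → ℕ) (dg : ℕ → ℕ) : Set where
  field
    bit       : ∀ {x y} → x < n → y < n → le x y ≡ 0 ⊎ le x y ≡ 1
    le-refl   : ∀ {x} → x < n → le x x ≡ 1
    le-trans  : ∀ {x y z} → x < n → y < n → z < n → le x y ≡ 1 → le y z ≡ 1 → le x z ≡ 1
    strict    : ∀ {x y} → x < n → y < n → le x y ≡ 1 → x ≢ y → dg x < dg y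
    dg≤n      : ∀ {x} → x < n → dg x ≤ n
    antichain : ∀ xs → All (_< n) xs → AllPairs (λ x y → le x y ≡ 0 × le y x ≡ 0) xs → length xs ≤ w

module Colourings {n w le dg} (order : Order n w le dg) where
  open Order order

  -- Felsner's invariant: the chains with label i are at most i in number and
  -- their top elements are pairwise incomparable.
  record Colouring (In : ℕ → Set) (cnt m : ℕ) (ord colour top lab : ℕ → ℕ) : Set where
    field
      In<n       : ∀ y → In y → y < n
      ord<n      : 0 < n → ∀ p → ord p < n
      ord-In     : ∀ p → p < cnt → In (ord p)
      position   : ∀ y → In y → ∃[ p ] p < cnt × ord p ≡ y
      mono       : ∀ p q → p ≤ q → q < cnt → colour (ord p) ≡ colour (ord q) → le (ord p) (ord q) ≡ 1
      colour<m   : ∀ p → p < cnt → colour (ord p) < m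
      below-top  : ∀ p → p < cnt → le (ord p) (top (colour (ord p))) ≡ 1
      top-In     : ∀ c → c < m → In (top c)
      lab≤w      : ∀ c → c < m → lab c ≤ w
      unrelated  : ∀ c d → c < m → d < m → c ≢ d → lab c ≡ lab d → le (top c) (top d) ≡ 0
      few        : ∀ i → count lab m i ≤ i

  -- The chain c is about to receive x; it has label i + 1.
  record Selected (In : ℕ → Set) (x cnt m c i : ℕ) (ord colour top lab : ℕ → ℕ) : Set where
    field
      In<n       : ∀ y → In y → y < n
      ord<n      : 0 < n → ∀ p → ord p < n
      ord-In     : ∀ p → p < cnt → In (ord p)
      position   : ∀ y → In y → ∃[ p ] p < cnt × ord p ≡ y
      mono       : ∀ p q → p ≤ q → q < cnt → colour (ord p) ≡ colour (ord q) → le (ord p) (ord q) ≡ 1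
      colour<m   : ∀ p → p < cnt → colour (ord p) < m
      below-top  : ∀ p → p < cnt → colour (ord p) ≢ c → le (ord p) (top (colour (ord p))) ≡ 1
      below-x    : ∀ p → p < cnt → colour (ord p) ≡ c → le (ord p) x ≡ 1
      top-In     : ∀ k → k < m → k ≢ c → In (top k)
      lab≤w      : ∀ k → k < m → lab k ≤ w
      unrelated  : ∀ k l → k < m → l < m → k ≢ c → l ≢ c → k ≢ l → lab k ≡ lab l → le (top k) (top l) ≡ 0
      few        : ∀ j → count lab m j ≤ j
      c<m        : c < m
      lab-c      : lab c ≡ suc i
      x-above    : ∀ k → k < m → k ≢ c → lab k ≡ i → le (top k) x ≡ 0

  module _ {In : ℕ → Set} {x cnt m i : ℕ} {ord colour top lab : ℕ → ℕ} (x<n : x < n)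
           (C : Colouring In cnt m ord colour top lab)
           (x≰i : ∀ k → k < m → lab k ≡ i → le (top k) x ≡ 0) where
    open Colouring C

    select-old : ∀ c → c < m → lab c ≡ suc i → le (top c) x ≡ 1 → Selected In x cnt m c i ord colour top lab
    select-old c c<m lc tx = record
      { In<n = In<n ; ord<n = ord<n ; ord-In = ord-In ; position = position ; mono = mono ; colour<m = colour<m
      ; below-top = λ p p<cnt _ → below-top p p<cnt
      ; below-x   = λ p p<cnt eq → le-trans (In<n _ (ord-In p p<cnt)) (In<n _ (top-In c c<m)) x<n
                      (subst (λ z → le (ord p) (top z) ≡ 1) eq (below-top p p<cnt)) tx
      ; top-In    = λ k k<m _ → top-In k k<m
      ; lab≤w     = lab≤w
      ; unrelated = λ k l k<m l<m _ _ → unrelated k l k<m l<m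
      ; few = few ; c<m = c<m ; lab-c = lc
      ; x-above   = λ k k<m _ → x≰i k k<m }

    -- The fresh chain is empty and its top is arbitrary, which `Selected` permits by asking nothing
    -- of the top of the chosen chain. Thus old and fresh chains are extended by the same argument.
    select-new : count lab m (suc i) < suc i → suc i ≤ w → Selected In x cnt (suc m) m i ord colour top (lab [ m ≔ suc i ])
    select-new small 1+i≤w = record
      { In<n = In<n ; ord<n = ord<n ; ord-In = ord-In ; position = position ; mono = mono
      ; colour<m = λ p p<cnt → m<n⇒m<1+n (colour<m p p<cnt)
      ; below-top = λ p p<cnt _ → below-top p p<cnt
      ; below-x   = λ p p<cnt eq → contradiction eq (<⇒≢ (colour<m p p<cnt))
      ; top-In    = λ k k<1+m k≢m → top-In k (old k<1+m k≢m)
      ; lab≤w     = lab≤w′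
      ; unrelated = λ k l k<m l<m k≢m l≢m k≢l eq → unrelated k l (old k<m k≢m) (old l<m l≢m) k≢l
                      (trans (sym (≔-other lab _ k≢m)) (trans eq (≔-other lab _ l≢m)))
      ; few       = few′
      ; c<m = ≤-refl ; lab-c = ≔-same lab m (suc i)
      ; x-above   = λ k k<1+m k≢m eq → x≰i k (old k<1+m k≢m) (trans (sym (≔-other lab _ k≢m)) eq) }
      where
      old : ∀ {k} → k < suc m → k ≢ m → k < m
      old k<1+m k≢m = ≤∧≢⇒< (≤-pred k<1+m) k≢m
      lab≤w′ : ∀ k → k < suc m → (lab [ m ≔ suc i ]) k ≤ w
      lab≤w′ k k<1+m with k ≟ m
      ... | yes refl = ≤-trans (≤-reflexive (≔-same lab m (suc i))) 1+i≤w
      ... | no k≢m   = ≤-trans (≤-reflexive (≔-other lab _ k≢m)) (lab≤w k (old k<1+m k≢m))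
      same : ∀ j → count (lab [ m ≔ suc i ]) m j ≡ count lab m j
      same j = count-cong m j λ c c<m → ≔-other lab _ (<⇒≢ c<m)
      few′ : ∀ j → count (lab [ m ≔ suc i ]) (suc m) j ≤ j
      few′ j rewrite ≔-same lab m (suc i) | same j with suc i ≟ j
      ... | yes refl rewrite ≡ᵇ-refl i = ≤-trans (≤-reflexive (+-comm _ 1)) small
      ... | no i≢j   rewrite eqBit-≢ i≢j | +-identityʳ (count lab m j) = few j

    -- The tops of family i are not below x, and x is below no earlier element, so x and these tops
    -- form an antichain; a full family i gives it at least i + 1 elements.
    full⇒i<w : (∀ y → In y → le x y ≡ 0) → i ≤ count lab m i → suc i ≤ w
    full⇒i<w x≰ full = ≤-trans (s≤s (≤-trans full (≤-reflexive (sym (length-tops top lab i m)))))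
      (antichain (x ∷ tops top lab i m)
        (x<n ∷ All-tops top lab i m λ c c<m _ → In<n _ (top-In c c<m))
        (All-tops top lab i m (λ c c<m lc → x≰ _ (top-In c c<m) , x≰i c c<m lc)
         ∷ AllPairs-tops top lab i m λ c d c<m d<m c≢d lc ld →
             unrelated c d c<m d<m c≢d (trans lc (sym ld)) , unrelated d c d<m c<m (≢-sym c≢d) (trans ld (sym lc))))

  -- Felsner's exchange. The tops of family i are incomparable to x, so family i together with c,
  -- whose top is now x, can serve as family i + 1. The old family i + 1 without c has at most i
  -- chains and becomes family i. Hence all chains except c exchange the labels i and i + 1, and
  -- both parts of the invariant survive.
  extend : ∀ {In In′ : ℕ → Set} {x cnt m c i ord colour top lab lab′} →
           Selected In x cnt m c i ord colour top lab → x < n → ¬ In x → (∀ y → In y → le x y ≡ 0) →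
           (∀ y → In y → In′ y) → In′ x → (∀ y → In′ y → In y ⊎ y ≡ x) →
           (lab′ c ≡ lab c) → (∀ k → k < m → k ≢ c → lab′ k ≡ swap i (lab k)) → suc i ≤ w →
           Colouring In′ (suc cnt) m (ord [ cnt ≔ x ]) (colour [ x ≔ c ]) (top [ c ≔ x ]) lab′
  extend {In} {In′} {x} {cnt} {m} {c} {i} {ord} {colour} {top} {lab} {lab′} S x<n x∉ x≰ In⇒ x∈ ⇒In lab′-c lab′-k 1+i≤w =
      record
    { In<n = λ y y∈ → [ In<n y , (λ { refl → x<n }) ]′ (⇒In y y∈)
    ; ord<n = ord<n′
    ; ord-In = λ p p< → by-position (λ q → In′ (ord′ q)) (λ q q< → subst In′ (sym (ord-old q<)) (In⇒ _ (ord-In q q<)))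
        (subst In′ (sym ord-new) x∈) p p<
    ; position = position′
    ; mono = mono′
    ; colour<m = λ p p< → by-position (λ q → colour′ (ord′ q) < m)
        (λ q q< → subst (_< m) (sym (colour-old q<)) (colour<m q q<)) (subst (_< m) (sym colour-new) c<m) p p<
    ; below-top = λ p p< → by-position (λ q → le (ord′ q) (top′ (colour′ (ord′ q))) ≡ 1) below-old
        (trans (cong₂ le ord-new (trans (cong top′ colour-new) (≔-same top c x))) (le-refl x<n)) p p<
    ; top-In = top-In′
    ; lab≤w = lab≤w′
    ; unrelated = unrelated′
    ; few = few′ }
    where
    open Selected S
    ord′ colour′ top′ : ℕ → ℕ
    ord′    = ord [ cnt ≔ x ]
    colour′ = colour [ x ≔ c ]
    top′    = top [ c ≔ x ]
    ord-new : ord′ cnt ≡ x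
    ord-new = ≔-same ord cnt x
    ord-old : ∀ {p} → p < cnt → ord′ p ≡ ord p
    ord-old p< = ≔-other ord x (<⇒≢ p<)
    colour-new : colour′ (ord′ cnt) ≡ c
    colour-new = trans (cong colour′ ord-new) (≔-same colour x c)
    colour-old : ∀ {p} → p < cnt → colour′ (ord′ p) ≡ colour (ord p)
    colour-old {p} p< = trans (cong colour′ (ord-old p<)) (≔-other colour c λ eq → x∉ (subst In eq (ord-In p p<)))
    by-position : ∀ (Q : ℕ → Set) → (∀ q → q < cnt → Q q) → Q cnt → ∀ p → p < suc cnt → Q p
    by-position Q old new p p< with ≤-suc-split p<
    ... | inj₁ p<cnt = old p p<cnt
    ... | inj₂ refl  = new
    ord<n′ : 0 < n → ∀ p → ord′ p < n
    ord<n′ 0<n p with p ≟ cnt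
    ... | yes refl = ≤-trans (s≤s (≤-reflexive ord-new)) x<n
    ... | no p≢    = ≤-trans (s≤s (≤-reflexive (≔-other ord x p≢))) (ord<n 0<n p)
    position′ : ∀ y → In′ y → ∃[ p ] p < suc cnt × ord′ p ≡ y
    position′ y y∈ with ⇒In y y∈
    ... | inj₁ y∈In with p , p< , eq ← position y y∈In = p , m<n⇒m<1+n p< , trans (ord-old p<) eq
    ... | inj₂ refl = cnt , ≤-refl , ord-new
    mono′ : ∀ p q → p ≤ q → q < suc cnt → colour′ (ord′ p) ≡ colour′ (ord′ q) → le (ord′ p) (ord′ q) ≡ 1
    mono′ p q p≤q q< eq with ≤-suc-split q<
    ... | inj₁ q<cnt = trans (cong₂ le (ord-old (≤-<-trans p≤q q<cnt)) (ord-old q<cnt))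
          (mono p q p≤q q<cnt (trans (sym (colour-old (≤-<-trans p≤q q<cnt))) (trans eq (colour-old q<cnt))))
    ... | inj₂ refl with m≤n⇒m<n∨m≡n p≤q
    ...   | inj₁ p<cnt = trans (cong₂ le (ord-old p<cnt) ord-new)
        (below-x p p<cnt (trans (sym (colour-old p<cnt)) (trans eq colour-new)))
    ...   | inj₂ refl  = trans (cong₂ le ord-new ord-new) (le-refl x<n)
    below-old : ∀ p → p < cnt → le (ord′ p) (top′ (colour′ (ord′ p))) ≡ 1
    below-old p p< with colour (ord p) ≟ c
    ... | yes eq = trans (cong₂ le (ord-old p<) (trans (cong top′ (trans (colour-old p<) eq)) (≔-same top c x)))
        (below-x p p< eq)
    ... | no neq = trans (cong₂ le (ord-old p<) (trans (cong top′ (colour-old p<)) (≔-other top x neq))) (below-top p p< neq)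
    top-In′ : ∀ k → k < m → In′ (top′ k)
    top-In′ k k<m with k ≟ c
    ... | yes refl = subst In′ (sym (≔-same top c x)) x∈
    ... | no k≢c   = subst In′ (sym (≔-other top x k≢c)) (In⇒ _ (top-In k k<m k≢c))
    swap≤w : ∀ l → l ≤ w → swap i l ≤ w
    swap≤w l l≤w with l ≟ suc i | l ≟ i
    ... | yes refl | _        = ≤-trans (≤-reflexive (swap-suc i)) (<⇒≤ l≤w)
    ... | no _     | yes refl = ≤-trans (≤-reflexive (swap-same i)) 1+i≤w
    ... | no p     | no q     = ≤-trans (≤-reflexive (swap-other p q)) l≤w
    lab≤w′ : ∀ k → k < m → lab′ k ≤ w
    lab≤w′ k k<m with k ≟ c
    ... | yes refl = ≤-trans (≤-reflexive lab′-c) (lab≤w k k<m)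
    ... | no k≢c   = ≤-trans (≤-reflexive (lab′-k k k<m k≢c)) (swap≤w (lab k) (lab≤w k k<m))
    from-new : ∀ k → k < m → k ≢ c → lab′ k ≡ lab′ c → lab k ≡ i
    from-new k k<m k≢c eq = trans (sym (swap-involutive i (lab k)))
      (trans (cong (swap i) (trans (sym (lab′-k k k<m k≢c)) (trans eq (trans lab′-c lab-c)))) (swap-suc i))
    unrelated′ : ∀ k l → k < m → l < m → k ≢ l → lab′ k ≡ lab′ l → le (top′ k) (top′ l) ≡ 0
    unrelated′ k l k<m l<m k≢l eq with k ≟ c | l ≟ c
    ... | yes refl | yes refl = contradiction refl k≢l
    ... | yes refl | no l≢c   = trans (cong₂ le (≔-same top c x) (≔-other top x l≢c)) (x≰ _ (top-In l l<m l≢c))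
    ... | no k≢c   | yes refl = trans (cong₂ le (≔-other top x k≢c) (≔-same top c x))
        (x-above k k<m k≢c (from-new k k<m k≢c eq))
    ... | no k≢c   | no l≢c   = trans (cong₂ le (≔-other top x k≢c) (≔-other top x l≢c))
          (unrelated k l k<m l<m k≢c l≢c k≢l (trans (sym (swap-involutive i (lab k))) (trans (cong (swap i)
            (trans (sym (lab′-k k k<m k≢c)) (trans eq (lab′-k l l<m l≢c)))) (swap-involutive i (lab l)))))
    -- Applying `swap i` to every label would give c the label i; the two bits correct for c keeping
    -- the label i + 1.
    moved : ∀ j → count lab′ m j + eqBit i j ≡ count lab m (swap i j) + eqBit (suc i) j
    moved j = trans (cong (λ z → count lab′ m j + eqBit z j) (sym (trans (cong (swap i) lab-c) (swap-suc i))))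
      (trans (count-point m c j c<m (λ k k<m k≢c → lab′-k k k<m k≢c))
             (cong₂ _+_ (count-swap lab i m j) (cong (λ z → eqBit z j) (trans lab′-c lab-c))))
    few′ : ∀ j → count lab′ m j ≤ j
    few′ j with j ≟ suc i | j ≟ i
    ... | yes refl | _ = ≤-trans (m≤m+n _ _) (≤-trans (≤-reflexive (trans (moved j)
            (cong₂ _+_ (cong (count lab m) (swap-suc i)) (eqBit-refl j))))
                (≤-trans (+-monoˡ-≤ 1 (few i)) (≤-reflexive (+-comm i 1))))
    ... | no _     | yes refl = ≤-pred (≤-trans
        (≤-reflexive (trans (+-comm 1 _) (trans (cong (count lab′ m j +_) (sym (eqBit-refl j)))
            (trans (moved j) (trans (cong₂ _+_ (cong (count lab m) (swap-same i)) (eqBit-≢ {suc i} {i} (≢-sym (<⇒≢ ≤-refl))))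
                (+-identityʳ _))))))
            (few (suc i)))
    ... | no p     | no q     = ≤-trans (≤-reflexive
        (trans (sym (+-identityʳ _)) (trans (cong (count lab′ m j +_) (sym (eqBit-≢ (≢-sym q))))
            (trans (moved j) (trans (cong₂ _+_ (cong (count lab m) (swap-other p q)) (eqBit-≢ (≢-sym p)))
                (+-identityʳ _))))))
            (few j)

-- Felsner's algorithm as a program

differs : Expr → Expr → Expr
differs e f = (e ⊖ f) ⊕ (f ⊖ e)

below : Expr → Expr → Expr
below e f = %mat ! (%row ! e ⊕ f)

-- `%found` is the number of the chosen chain plus one, with 0 for none yet. Taking elements by
-- increasing degree gives a linear extension. Degrees are at most n, so n + 1 passes over the
-- elements sort them, and these (n + 1) n visits stay within the quadratic bound.
scanChain decide search relabelChain insert visit insertAll : Cmd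
scanChain =
  when differs (%lab ! & %loop₃) (& %fam)
    ⟨ skip
    ∣ increment %members ⨾
      when below (%top ! & %loop₃) (& %ξ) ⟨ %found := & %loop₃ ⊕ lit 1 ∣ skip ⟩ ⟩
decide =
  when & %found
    ⟨ skip
    ∣ when & %fam ⊖ & %members
        ⟨ %lab ! & %chains ≔ & %fam ⨾ increment %chains ⨾ %found := & %chains
        ∣ increment %fam ⟩ ⟩
search =
  while lit 1 ⊖ & %found
    ⟨ %members := lit 0 ⨾ for %loop₃ from & %chains ⟨ scanChain ⟩ ⨾ decide ⟩
relabelChain =
  when differs (& %loop₃) (& %chosen)
    ⟨ when differs (%lab ! & %loop₃) (& %fam)
        ⟨ when differs (%lab ! & %loop₃) (& %fam ⊖ lit 1) ⟨ skip ∣ %lab ! & %loop₃ ≔ & %fam ⟩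
        ∣ %lab ! & %loop₃ ≔ & %fam ⊖ lit 1 ⟩
    ∣ skip ⟩

startInsert finishInsert : Cmd
startInsert  = %ord ! & %cnt ≔ & %ξ ⨾ increment %cnt ⨾ %fam := lit 1 ⨾ %found := lit 0
finishInsert = %top ! & %chosen ≔ & %ξ ⨾ %colour ! & %ξ ≔ & %chosen

insert =
  startInsert ⨾
  search ⨾
  %chosen := & %found ⊖ lit 1 ⨾
  for %loop₃ from & %chains ⟨ relabelChain ⟩ ⨾
  finishInsert
visit = when differs (%deg ! & %ξ) (& %level) ⟨ skip ∣ insert ⟩ ⨾ increment %ξ
insertAll =
  for %loop₁ from & %size ⊕ lit 1
    ⟨ %ξ := lit 0 ⨾ for %loop₂ from & %size ⟨ visit ⟩ ⨾ increment %level ⟩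

distance : ℕ → ℕ → ℕ
distance a b = (a ∸ b) + (b ∸ a)

opaque
  distance-≡ : ∀ {a b} → a ≡ b → distance a b ≡ 0
  distance-≡ {a} refl = cong₂ _+_ (n∸n≡0 a) (n∸n≡0 a)

  distance-≢ : ∀ {a b} → a ≢ b → ∃[ n ] distance a b ≡ suc n
  distance-≢ {a} {b} a≢b with distance a b in eq
  ... | suc n = n , refl
  ... | zero  = contradiction (≤-antisym (m∸n≡0⇒m≤n (m+n≡0⇒m≡0 (a ∸ b) eq)) (m∸n≡0⇒m≤n (m+n≡0⇒n≡0 (a ∸ b) eq))) a≢b

  choose-≡ : ∀ {A : Set} (Q : A → Set) {a b} {t f : A} → a ≡ b → Q f → Q (choose (distance a b) t f)
  choose-≡ Q eq q rewrite distance-≡ eq = q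

  choose-≢ : ∀ {A : Set} (Q : A → Set) {a b} {t f : A} → a ≢ b → Q t → Q (choose (distance a b) t f)
  choose-≢ Q neq q rewrite proj₂ (distance-≢ neq) = q

  choose-0 : ∀ {A : Set} (Q : A → Set) {z} {t f : A} → z ≡ 0 → Q f → Q (choose z t f)
  choose-0 Q refl q = q

  choose-suc : ∀ {A : Set} (Q : A → Set) {z n} {t f : A} → z ≡ suc n → Q t → Q (choose z t f)
  choose-suc Q refl q = q

  sumTo-+ : ∀ n f g → sumTo n (λ i → f i + g i) ≡ sumTo n f + sumTo n g
  sumTo-+ zero    f g = refl
  sumTo-+ (suc n) f g = trans (cong (_+ (f n + g n)) (sumTo-+ n f g)) (interchange (sumTo n f) (sumTo n g) (f n) (g n))
    where
    interchange : ∀ a b c d → a + b + (c + d) ≡ a + c + (b + d)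
    interchange = solve-∀

  sumTo-eqBit : ∀ n a → a < n → sumTo n (eqBit a) ≡ 1
  sumTo-zero : ∀ n a → n ≤ a → sumTo n (eqBit a) ≡ 0
  sumTo-zero zero    a n≤a = refl
  sumTo-zero (suc n) a n<a = cong₂ _+_ (sumTo-zero n a (<⇒≤ n<a)) (eqBit-≢ (≢-sym (<⇒≢ n<a)))
  sumTo-eqBit (suc n) a a<1+n with ≤-suc-split a<1+n
  ... | inj₁ a<n  = cong₂ _+_ (sumTo-eqBit n a a<n) (eqBit-≢ (<⇒≢ a<n))
  ... | inj₂ refl = cong₂ _+_ (sumTo-zero a a ≤-refl) (eqBit-refl a)

  sumTo-≤ : ∀ n f b → (∀ i → i < n → f i ≤ b) → sumTo n f ≤ n * b
  sumTo-≤ zero    f b f≤b = z≤n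
  sumTo-≤ (suc n) f b f≤b = ≤-trans (+-mono-≤ (sumTo-≤ n f b λ i i<n → f≤b i (m<n⇒m<1+n i<n)) (f≤b n ≤-refl))
                                    (≤-reflexive (+-comm (n * b) b))

  sumTo-0 : ∀ n → sumTo n (λ _ → 0) ≡ 0
  sumTo-0 zero    = refl
  sumTo-0 (suc n) = trans (+-identityʳ _) (sumTo-0 n)

  sumTo-count : ∀ L f m → (∀ c → c < m → f c < L) → sumTo L (count f m) ≡ m
  sumTo-count L f zero    f<L = sumTo-0 L
  sumTo-count L f (suc m) f<L = trans (sumTo-+ L (count f m) (eqBit (f m)))
    (trans (cong₂ _+_ (sumTo-count L f m λ c c<m → f<L c (m<n⇒m<1+n c<m)) (sumTo-eqBit L (f m) (f<L m ≤-refl))) (+-comm m 1))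

-- Labels range from 0 to w, and a label i is on at most i ≤ w chains.
maxChains : ℕ → ℕ
maxChains w = suc w * w

for-time-mono : ∀ e B {n n′} → n ≤ n′ → for-time e n B ≤ for-time e n′ B
for-time-mono e B n≤n′ = +-monoʳ-≤ (10 + costᴱ e) (+-monoˡ-≤ 11 (*-monoˡ-≤ (34 + B) n≤n′))

opaque
  chains≤ : ∀ {w} lab m → (∀ c → c < m → lab c ≤ w) → (∀ i → count lab m i ≤ i) → m ≤ maxChains w
  chains≤ {w} lab m lab≤w few = ≤-trans (≤-reflexive (sym (sumTo-count (suc w) lab m λ c c<m → s≤s (lab≤w c c<m))))
    (sumTo-≤ (suc w) (count lab m) w λ i i<1+w → ≤-trans (few i) (≤-pred i<1+w))

scan-time search-time relabel-time insert-time visit-time : ℕ → ℕ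
scan-time w    = for-time (& %chains) (maxChains w) (ticks scanChain)
search-time w  = w * (12 + (2 + (ticks (%members := lit 0) + (scan-time w + ticks decide)))) + 13
relabel-time w = for-time (& %chains) (maxChains w) (ticks relabelChain)
insert-time w  = ticks startInsert +
    (search-time w + (ticks (%chosen := & %found ⊖ lit 1) + (relabel-time w + ticks finishInsert)))
visit-time w   = costᴱ (differs (%deg ! & %ξ) (& %level)) + (2 + (0 + insert-time w)) + ticks (increment %ξ)

level-time insertAll-time : ℕ → ℕ → ℕ
level-time n w     = 1 + (8 + (1 + 1)) + (for-time (& %size) n (visit-time w) + ticks (increment %level))
insertAll-time n w = for-time (& %size ⊕ lit 1) (suc n) (level-time n w)

record Scanned (x i m : ℕ) (le : ℕ → ℕ → ℕ) (top lab : ℕ → ℕ) (r : ℕ) (s : Config) : Set where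
  field
    members≡ : cells s %members 0 + count lab r i ≡ count lab m i
    found≡   : (cells s %found 0 ≡ 0 × (∀ c → r ≤ c → c < m → lab c ≡ i → le (top c) x ≡ 0))
             ⊎ (∃[ c ] cells s %found 0 ≡ suc c × c < m × lab c ≡ i × le (top c) x ≡ 1)

opaque
  scan-correct : ∀ {x i m w le} s → m ≤ maxChains w →
    cells s %members 0 ≡ 0 → cells s %found 0 ≡ 0 → cells s %chains 0 ≡ m → cells s %fam 0 ≡ i → cells s %ξ 0 ≡ x →
    (∀ c → c < m → cells s %mat (cells s %row (cells s %top c) + x) ≡ le (cells s %top c) x) →
    (∀ c → c < m → le (cells s %top c) x ≡ 0 ⊎ le (cells s %top c) x ≡ 1) →
    Run for %loop₃ from & %chains ⟨ scanChain ⟩ s (scan-time w) (Scanned x i m le (cells s %top) (cells s %lab) 0)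
  scan-correct {x} {i} {m} {w} {le} s m≤ mem≡ fou≡ cha≡ fam≡ ξ≡ test bit =
    run-weaken (for-time-mono (& %chains) (ticks scanChain) m≤) (λ _ _ q → q)
    (run-for m (Scanned x i m le (cells s %top) (cells s %lab)) cha≡
      (record { members≡ = cong (_+ count (cells s %lab) m i) mem≡ ; found≡ =
          inj₁ (fou≡ , λ c m≤c c<m → contradiction c<m (≤⇒≯ m≤c)) })
      λ r s′ r<m fr inv → run-block (body r s′ r<m fr inv))
    where
    Inv : ℕ → Config → Set
    Inv = Scanned x i m le (cells s %top) (cells s %lab)
    body : ∀ r s′ → r < m → Frame for %loop₃ from & %chains ⟨ scanChain ⟩ s s′ → Inv (suc r) s′ →
           Inv r (perform scanChain (s′ at %loop₃ ≔ r))
    body r s′ r<m fr inv with cells s %lab r ≟ i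
    ... | no lab≢ = choose-≢ (Inv r)
          (λ eq → lab≢ (trans (cong (λ f → f r) (sym (fr %lab))) (trans eq (trans (cong-app (fr %fam) 0) fam≡))))
          (record { members≡ = trans (cong (λ z → cells s′ %members 0 + z)
              (sym (trans (cong (count (cells s %lab) r i +_) (eqBit-≢ lab≢)) (+-identityʳ _))))
                                     (Scanned.members≡ inv)
                  ; found≡ = [ (λ { (f , no-c) → inj₁ (f , λ c r≤c c<m lc →
                      [ (λ r<c → no-c c r<c c<m lc) , (λ { refl → contradiction lc lab≢ }) ]′ (m≤n⇒m<n∨m≡n r≤c)) })
                             , inj₂ ]′ (Scanned.found≡ inv) })
    ... | yes lab≡ = choose-≡ (Inv r)
          (trans (cong-app (fr %lab) r) (trans lab≡ (sym (trans (cong-app (fr %fam) 0) fam≡))))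
          (by-test (bit r r<m))
      where
      members′ : cells s′ %members 0 + 1 + count (cells s %lab) r i ≡ count (cells s %lab) m i
      members′ = trans (trans (+-assoc (cells s′ %members 0) 1 _) (cong (cells s′ %members 0 +_) (trans (+-comm 1 _)
                   (cong (count (cells s %lab) r i +_) (sym (trans (cong (λ z → eqBit z i) lab≡) (eqBit-refl i)))))))
                       (Scanned.members≡ inv)
      test′ : cells s′ %mat (cells s′ %row (cells s′ %top r) + cells s′ %ξ 0) ≡ le (cells s %top r) x
      test′ = trans (cong₂ (λ f a → f a) (fr %mat) (cong₂ _+_ (cong₂ (λ f g → f (g r)) (fr %row) (fr %top))
          (trans (cong-app (fr %ξ) 0) ξ≡))) (test r r<m)
      by-test : le (cells s %top r) x ≡ 0 ⊎ le (cells s %top r) x ≡ 1 →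
                Inv r (perform (increment %members ⨾ when below (%top ! & %loop₃)
                    (& %ξ) ⟨ %found := & %loop₃ ⊕ lit 1 ∣ skip ⟩) (s′ at %loop₃ ≔ r))
      by-test (inj₁ z) = choose-0 (Inv r) (trans test′ z) record
        { members≡ = members′
        ; found≡ = [ (λ { (f , no-c) → inj₁ (f , λ c r≤c c<m lc → [ (λ r<c → no-c c r<c c<m lc) , (λ { refl → z }) ]′
            (m≤n⇒m<n∨m≡n r≤c)) })
                   , inj₂ ]′ (Scanned.found≡ inv) }
      by-test (inj₂ o) = choose-suc (Inv r) (trans test′ o) record
        { members≡ = members′ ; found≡ = inj₂ (r , +-comm r 1 , r<m , lab≡ , o) }

module Insertion {n w le dg} (order : Order n w le dg) where
  open Order order
  open Colourings order

  record Found (In : ℕ → Set) (x cnt : ℕ) (ord colour top : ℕ → ℕ) (s : Config) : Set where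
    field
      {m c i}  : ℕ
      found≡   : cells s %found 0 ≡ suc c
      fam≡     : cells s %fam 0 ≡ suc i
      chains≡  : cells s %chains 0 ≡ m
      i<w      : suc i ≤ w
      selected : Selected In x cnt m c i ord colour top (cells s %lab)

  -- Only the family rejected last is remembered: it is full and has no top below x. This is what
  -- the exchange of labels needs, and through the antichain argument it also bounds the number of
  -- rounds by w.
  record Searching (x m : ℕ) (top lab : ℕ → ℕ) (f : ℕ) (s : Config) : Set where
    field
      i       : ℕ
      fuel    : i + f ≡ w
      found≡  : cells s %found 0 ≡ 0
      fam≡    : cells s %fam 0 ≡ suc i
      chains≡ : cells s %chains 0 ≡ m
      lab≡    : cells s %lab ≡ lab
      x≰i     : ∀ k → k < m → lab k ≡ i → le (top k) x ≡ 0
      full    : i ≤ count lab m i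

  module _ {In : ℕ → Set} {x cnt m : ℕ} {ord : ℕ → ℕ} (s : Config)
           (C : Colouring In cnt m ord (cells s %colour) (cells s %top) (cells s %lab))
           (x<n : x < n) (x≰ : ∀ y → In y → le x y ≡ 0)
           (found≡ : cells s %found 0 ≡ 0) (fam≡ : cells s %fam 0 ≡ 1) (chains≡ : cells s %chains 0 ≡ m)
               (ξ≡ : cells s %ξ 0 ≡ x)
           (test : ∀ y → y < n → cells s %mat (cells s %row y + x) ≡ le y x) where
    open Colouring C

    Progress : ℕ → Config → Set
    Progress f t = Searching x m (cells s %top) (cells s %lab) f t ⊎ Found In x cnt ord (cells s %colour) (cells s %top) t

    opaque
      decide-correct : ∀ f t (S : Searching x m (cells s %top) (cells s %lab) (suc f) t) t₂ →
        Frame for %loop₃ from & %chains ⟨ scanChain ⟩ (perform (%members := lit 0) t) t₂ →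
        Scanned x (suc (Searching.i S)) m le (cells s %top) (cells s %lab) 0 t₂ → Progress f (perform decide t₂)
      decide-correct f t S t₂ fr sc with Scanned.found≡ sc
      ... | inj₂ (c , eq , c<m , lc , tx) = choose-suc (Progress f) eq (inj₂ record
              { found≡ = eq
              ; fam≡ = trans (cong-app (fr %fam) 0) (Searching.fam≡ S)
              ; chains≡ = trans (cong-app (fr %chains) 0) (Searching.chains≡ S)
              ; i<w = ≤-trans (m≤m+n _ f) (≤-reflexive (trans (sym (+-suc _ f)) (Searching.fuel S)))
              ; selected = subst (Selected In x cnt m c (Searching.i S) ord (cells s %colour) (cells s %top))
                             (sym (trans (fr %lab) (Searching.lab≡ S)))
                             (select-old x<n C (Searching.x≰i S) c c<m lc tx) })
      ... | inj₁ (eq , none) = choose-0 (Progress f) eq (by-size (suc i ≤? cells t₂ %members 0))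
        where
        open Searching S using (i)
        members≡ : cells t₂ %members 0 ≡ count (cells s %lab) m (suc i)
        members≡ = trans (sym (+-identityʳ _)) (Scanned.members≡ sc)
        fam≡′ : cells t₂ %fam 0 ≡ suc i
        fam≡′ = trans (cong-app (fr %fam) 0) (Searching.fam≡ S)
        chains≡′ : cells t₂ %chains 0 ≡ m
        chains≡′ = trans (cong-app (fr %chains) 0) (Searching.chains≡ S)
        lab≡′ : cells t₂ %lab ≡ cells s %lab
        lab≡′ = trans (fr %lab) (Searching.lab≡ S)
        fuel′ : suc i + f ≡ w
        fuel′ = trans (sym (+-suc i f)) (Searching.fuel S)
        i<w′ : suc i ≤ w
        i<w′ = ≤-trans (m≤m+n _ f) (≤-reflexive fuel′)
        grow : Cmd
        grow = when & %fam ⊖ & %members ⟨ %lab ! & %chains ≔ & %fam ⨾ increment %chains ⨾ %found := & %chains ∣ increment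
            %fam ⟩
        by-size : Dec (suc i ≤ cells t₂ %members 0) → Progress f (perform grow t₂)
        by-size (yes big) = choose-0 (Progress f) (m≤n⇒m∸n≡0 (≤-trans (≤-reflexive fam≡′) big)) (inj₁ record
          { i = suc i ; fuel = fuel′ ; found≡ = eq ; fam≡ = +1≡ fam≡′
          ; chains≡ = chains≡′ ; lab≡ = lab≡′ ; x≰i = λ k → none k z≤n ; full = ≤-trans big (≤-reflexive members≡) })
        by-size (no ¬big) = choose-suc (Progress f) {n = pred (cells t₂ %fam 0 ∸ cells t₂ %members 0)}
          (sym (suc-pred _ {{>-nonZero (m<n⇒0<n∸m (≤-trans (≰⇒> ¬big) (≤-reflexive (sym fam≡′))))}})) (inj₂ record
          { found≡ = +1≡ chains≡′ ; fam≡ = fam≡′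
          ; chains≡ = +1≡ chains≡′ ; i<w = i<w′
          ; selected = subst (Selected In x cnt (suc m) m i ord (cells s %colour) (cells s %top))
                         (sym (trans (cong₂ (λ a z → cells t₂ %lab [ a ≔ z ]) chains≡′ fam≡′) (cong (_[ m ≔ suc i ]) lab≡′)))
                         (select-new x<n C (Searching.x≰i S) (≤-trans (s≤s (≤-reflexive (sym members≡))) (≰⇒> ¬big)) i<w′) })

      search-correct : Run search s (search-time w) (Found In x cnt ord (cells s %colour) (cells s %top))
      search-correct = run-weaken ≤-refl finish (run-while Progress body stop w (inj₁ start))
        where
        start : Searching x m (cells s %top) (cells s %lab) w s
        start = record { i = 0 ; fuel = refl ; found≡ = found≡ ; fam≡ = fam≡ ; chains≡ = chains≡ ; lab≡ = refl
          -- No chain has label 0, since `few` allows none; so the empty family 0 counts as rejected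
          -- at the start.
          ; x≰i = λ k k<m lk → contradiction (≤-trans
              (≤-trans (≤-reflexive (sym (eqBit-refl 0))) (≤-trans (≤-reflexive (cong (λ z → eqBit z 0) (sym lk)))
              (occurs m k k<m))) (few 0)) λ ()
          ; full = z≤n }
          where
          occurs : ∀ m k → k < m → eqBit (cells s %lab k) 0 ≤ count (cells s %lab) m 0
          occurs (suc m) k k<1+m with ≤-suc-split k<1+m
          ... | inj₁ k<m  = ≤-trans (occurs m k k<m) (m≤m+n _ _)
          ... | inj₂ refl = m≤n+m _ (count (cells s %lab) m 0)
        -- With no fuel left, i = w, and the full family w together with x would be an antichain of
        -- w + 1 elements.
        contradictory : ∀ {t} → Searching x m (cells s %top) (cells s %lab) 0 t → ⊥
        contradictory S = <⇒≱ (full⇒i<w x<n C (Searching.x≰i S) x≰ (Searching.full S))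
          (≤-reflexive (trans (sym (Searching.fuel S)) (+-identityʳ _)))
        stop : ∀ t → Frame search s t → Progress 0 t → 1 ∸ cells t %found 0 ≡ 0
        stop t _ (inj₁ S) = ⊥-elim (contradictory S)
        stop t _ (inj₂ F) = m≤n⇒m∸n≡0 (≤-trans (s≤s z≤n) (≤-reflexive (sym (Found.found≡ F))))
        finish : ∀ t → Frame search s t → (∃[ f ] Progress f t) × 1 ∸ cells t %found 0 ≡ 0 →
                 Found In x cnt ord (cells s %colour) (cells s %top) t
        finish t _ ((_ , inj₂ F) , _)  = F
        finish t _ ((_ , inj₁ S) , eq) = contradiction (trans (sym (cong (1 ∸_) (Searching.found≡ S))) eq) λ ()
        body : ∀ f t → Frame search s t → Progress (suc f) t → ∀ k → 1 ∸ cells t %found 0 ≡ suc k →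
               Run (%members := lit 0 ⨾ for %loop₃ from & %chains ⟨ scanChain ⟩ ⨾ decide) t
                   (ticks (%members := lit 0) + (scan-time w + ticks decide)) (Progress f)
        body f t fr (inj₂ F) k eq = contradiction
            (trans (sym eq) (m≤n⇒m∸n≡0 (≤-trans (s≤s z≤n) (≤-reflexive (sym (Found.found≡ F)))))) λ ()
        body f t fr (inj₁ S) k eq = run-after (run-seq
          (run-weaken ≤-refl (λ _ _ q → subst₂ (λ g h → Scanned x (suc (Searching.i S)) m le g h 0 _) (fr %top)
              (Searching.lab≡ S) q)
          (scan-correct {x} {suc (Searching.i S)} {m} {w} {le} (perform (%members := lit 0) t)
              (chains≤ (cells s %lab) m lab≤w few) refl
            (Searching.found≡ S) (Searching.chains≡ S) (Searching.fam≡ S) (trans (cong-app (fr %ξ) 0) ξ≡)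
            (λ c c<m → trans (cong₂ (λ g h → g (h + x)) (fr %mat) (cong (λ g → g (cells t %top c)) (fr %row)))
                             (test (cells t %top c) (top<n c c<m)))
            (λ c c<m → bit (top<n c c<m) x<n)))
          λ t₂ fr₂ sc → run-block (decide-correct f t S t₂ fr₂ sc))
          where
          top<n : ∀ c → c < m → cells t %top c < n
          top<n c c<m = subst (_< n) (cong (λ g → g c) (sym (fr %top))) (In<n _ (top-In c c<m))

record Relabelled (m c i : ℕ) (lab : ℕ → ℕ) (r : ℕ) (s : Config) : Set where
  field
    early  : ∀ k → k < r → cells s %lab k ≡ lab k
    chosen : r ≤ c → cells s %lab c ≡ lab c
    late   : ∀ k → r ≤ k → k < m → k ≢ c → cells s %lab k ≡ swap i (lab k)

opaque
  relabel-correct : ∀ {m c i} w s → m ≤ maxChains w → cells s %chains 0 ≡ m → cells s %chosen 0 ≡ c →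
      cells s %fam 0 ≡ suc i →
    Run for %loop₃ from & %chains ⟨ relabelChain ⟩ s (relabel-time w) (Relabelled m c i (cells s %lab) 0)
  relabel-correct {m} {c} {i} w s m≤ chains≡ chosen≡ fam≡ =
    run-weaken (for-time-mono (& %chains) (ticks relabelChain) m≤) (λ _ _ q → q)
    (run-for m Inv chains≡ (record { early = λ _ _ → refl ; chosen = λ _ → refl ; late = λ k m≤k k<m →
        contradiction k<m (≤⇒≯ m≤k) })
      λ r s′ _ fr inv → run-block (body r s′ (trans (cong-app (fr %chosen) 0) chosen≡) (trans (cong-app (fr %fam) 0) fam≡)
          inv))
    where
    lab : ℕ → ℕ
    lab = cells s %lab
    Inv : ℕ → Config → Set
    Inv = Relabelled m c i (cells s %lab)
    put-label : ∀ r {z} s′ t → Inv (suc r) s′ → r ≢ c → cells t %lab ≡ cells s′ %lab [ r ≔ z ] →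
        z ≡ swap i (cells s %lab r) → Inv r t
    put-label r {z} s′ t inv r≢c lab≡ z≡ = record
      { early  = λ k k<r → trans (at k) (trans (≔-other (cells s′ %lab) z (<⇒≢ k<r))
          (Relabelled.early inv k (m<n⇒m<1+n k<r)))
      ; chosen = λ r≤c → trans (at c) (trans (≔-other (cells s′ %lab) z (≢-sym r≢c)) (Relabelled.chosen inv (≤∧≢⇒< r≤c r≢c)))
      ; late   = late }
      where
      at : ∀ k → cells t %lab k ≡ (cells s′ %lab [ r ≔ z ]) k
      at k = cong (λ f → f k) lab≡
      late : ∀ k → r ≤ k → k < m → k ≢ c → cells t %lab k ≡ swap i (cells s %lab k)
      late k r≤k k<m k≢c with m≤n⇒m<n∨m≡n r≤k
      ... | inj₁ r<k  = trans (at k) (trans (≔-other (cells s′ %lab) z (≢-sym (<⇒≢ r<k)))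
          (Relabelled.late inv k r<k k<m k≢c))
      ... | inj₂ refl = trans (at k) (trans (≔-same (cells s′ %lab) k z) z≡)
    keep : ∀ r s′ → Inv (suc r) s′ → (r ≢ c → cells s %lab r ≡ swap i (cells s %lab r)) → Inv r (s′ at %loop₃ ≔ r)
    keep r s′ inv r≡ = record
      { early  = λ k k<r → Relabelled.early inv k (m<n⇒m<1+n k<r)
      ; chosen = λ r≤c → [ Relabelled.chosen inv , (λ { refl → Relabelled.early inv r ≤-refl }) ]′ (m≤n⇒m<n∨m≡n r≤c)
      ; late   = λ k r≤k k<m k≢c → [ (λ r<k → Relabelled.late inv k r<k k<m k≢c)
                                   , (λ { refl → trans (Relabelled.early inv k ≤-refl) (r≡ k≢c) }) ]′ (m≤n⇒m<n∨m≡n r≤k) }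
    body : ∀ r s′ → cells s′ %chosen 0 ≡ c → cells s′ %fam 0 ≡ suc i → Inv (suc r) s′ →
        Inv r (perform relabelChain (s′ at %loop₃ ≔ r))
    body r s′ c≡ f≡ inv with r ≟ c
    ... | yes r≡c = choose-≡ (Inv r) (trans r≡c (sym c≡)) (keep r s′ inv λ r≢c → contradiction r≡c r≢c)
    ... | no r≢c = choose-≢ (Inv r) (λ eq → r≢c (trans eq c≡)) (by-label (cells s %lab r ≟ suc i) (cells s %lab r ≟ i))
      where
      r≡ : cells s′ %lab r ≡ cells s %lab r
      r≡ = Relabelled.early inv r ≤-refl
      relabel : Cmd
      relabel = when differs (%lab ! & %loop₃) (& %fam)
        ⟨ when differs (%lab ! & %loop₃) (& %fam ⊖ lit 1) ⟨ skip ∣ %lab ! & %loop₃ ≔ & %fam ⟩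
        ∣ %lab ! & %loop₃ ≔ & %fam ⊖ lit 1 ⟩
      by-label : Dec (cells s %lab r ≡ suc i) → Dec (cells s %lab r ≡ i) → Inv r (perform relabel (s′ at %loop₃ ≔ r))
      by-label (yes l≡) _ = choose-≡ (Inv r) (trans r≡ (trans l≡ (sym f≡)))
        (put-label r s′ _ inv r≢c refl (trans (cong (_∸ 1) f≡) (sym (trans (cong (swap i) l≡) (swap-suc i)))))
      by-label (no l≢) (yes l≡) = choose-≢ (Inv r) (λ eq → l≢ (trans (sym r≡) (trans eq f≡)))
        (choose-≡ (Inv r) (trans r≡ (trans l≡ (sym (cong (_∸ 1) f≡))))
          (put-label r s′ _ inv r≢c refl (trans f≡ (sym (trans (cong (swap i) l≡) (swap-same i))))))
      by-label (no l≢) (no l≢′) = choose-≢ (Inv r) (λ eq → l≢ (trans (sym r≡) (trans eq f≡)))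
        (choose-≢ (Inv r) (λ eq → l≢′ (trans (sym r≡) (trans eq (cong (_∸ 1) f≡))))
          (keep r s′ inv λ _ → sym (swap-other l≢ l≢′)))

  distance-≡⁻¹ : ∀ {a b} → distance a b ≡ 0 → a ≡ b
  distance-≡⁻¹ {a} {b} eq = ≤-antisym (m∸n≡0⇒m≤n (m+n≡0⇒m≡0 (a ∸ b) eq)) (m∸n≡0⇒m≤n (m+n≡0⇒n≡0 (a ∸ b) eq))

degree : (ℕ → ℕ → ℕ) → ℕ → ℕ → ℕ
degree b n j = sumTo n (λ i → b i j)

HasPoset-cong : ∀ {b n σ τ} → τ %size ≡ σ %size → τ %mat ≡ σ %mat → τ %row ≡ σ %row → τ %deg ≡ σ %deg →
                HasPoset b n σ → HasPoset b n τ
HasPoset-cong size mat row deg P = record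
  { size≡ = trans (cong (λ f → f 0) size) size≡
  ; mat≡  = λ i j i<n j<n → trans (cong₂ (λ f g → f (g i + j)) mat row) (mat≡ i j i<n j<n)
  ; deg≡  = λ j j<n → trans (cong (λ f → f j) deg) (deg≡ j j<n) }
  where open HasPoset P

module Inserting {n w le} (order : Order n w le (degree le n)) where
  open Order order
  open Colourings order
  open Insertion order

  ColouringAt : (ℕ → Set) → Config → Set
  ColouringAt In s = Colouring In (cells s %cnt 0) (cells s %chains 0) (cells s %ord) (cells s %colour) (cells s %top)
      (cells s %lab)

  Colouring-subst : ∀ {In cnt cnt′ m m′ ord ord′ colour colour′ top top′ lab} →
    cnt ≡ cnt′ → m ≡ m′ → ord ≡ ord′ → colour ≡ colour′ → top ≡ top′ →
    Colouring In cnt m ord colour top lab → Colouring In cnt′ m′ ord′ colour′ top′ lab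
  Colouring-subst refl refl refl refl refl C = C

  Colouring-In : ∀ {In In′ cnt m ord colour top lab} → (∀ y → In y → In′ y) → (∀ y → In′ y → In y) →
    Colouring In cnt m ord colour top lab → Colouring In′ cnt m ord colour top lab
  Colouring-In ⇒ ⇐ C = record
    { In<n = λ y y∈ → In<n y (⇐ y y∈) ; ord<n = ord<n ; ord-In = λ p p< → ⇒ _ (ord-In p p<)
    ; position = λ y y∈ → position y (⇐ y y∈) ; mono = mono ; colour<m = colour<m ; below-top = below-top
    ; top-In = λ c c<m → ⇒ _ (top-In c c<m) ; lab≤w = lab≤w ; unrelated = unrelated ; few = few }
    where open Colouring C

  opaque
    insert-correct : ∀ {In In′ : ℕ → Set} {x} s → HasPoset le n (cells s) → ColouringAt In s → cells s %ξ 0 ≡ x → x < n →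
        ¬ In x →
      (∀ y → In y → le x y ≡ 0) → (∀ y → In y → In′ y) → In′ x → (∀ y → In′ y → In y ⊎ y ≡ x) →
      Run insert s (insert-time w) (λ t → ColouringAt In′ t × cells t %cnt 0 ≡ suc (cells s %cnt 0))
    insert-correct {In} {In′} {x} s P C ξ≡ x<n x∉ x≰ In⇒ x∈ ⇒In =
      run-after (run-seq
        (search-correct (perform startInsert s) C x<n x≰ refl refl refl ξ≡ (λ y y<n → HasPoset.mat≡ P y x y<n x<n))
        λ t fr F → run-after (run-seq
          (relabel-correct {Found.m F} {Found.c F} {Found.i F} w (perform (%chosen := & %found ⊖ lit 1) t)
            (chains≤ (cells t %lab) (Found.m F) (Selected.lab≤w (Found.selected F)) (Selected.few (Found.selected F)))
            (Found.chains≡ F) (cong (_∸ 1) (Found.found≡ F)) (Found.fam≡ F))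
          λ t₂ fr₂ R → run-block (done t fr F t₂ fr₂ R)))
      where
      done : ∀ t → Frame search (perform startInsert s) t →
        (F : Found In x (cells s %cnt 0) (cells s %ord) (cells s %colour) (cells s %top) t) → ∀ t₂ →
        Frame for %loop₃ from & %chains ⟨ relabelChain ⟩ (perform (%chosen := & %found ⊖ lit 1) t) t₂ →
        Relabelled (Found.m F) (Found.c F) (Found.i F) (cells t %lab) 0 t₂ →
        ColouringAt In′ (perform finishInsert t₂) × cells t₂ %cnt 0 ≡ suc (cells s %cnt 0)
      done t fr F t₂ fr₂ R = Colouring-subst (sym cnt≡) (sym m≡) (sym ord≡) (sym colour≡) (sym top≡)
        (extend (Found.selected F) x<n x∉ x≰ In⇒ x∈ ⇒In
          (Relabelled.chosen R z≤n) (λ k → Relabelled.late R k z≤n) (Found.i<w F)) , cnt≡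
        where
        cnt≡ : cells t₂ %cnt 0 ≡ suc (cells s %cnt 0)
        cnt≡ = trans (cong-app (trans (fr₂ %cnt) (fr %cnt)) 0) (+-comm _ 1)
        m≡ : cells t₂ %chains 0 ≡ Found.m F
        m≡ = trans (cong-app (fr₂ %chains) 0) (Found.chains≡ F)
        ξ≡′ : cells t₂ %ξ 0 ≡ x
        ξ≡′ = trans (cong-app (trans (fr₂ %ξ) (fr %ξ)) 0) ξ≡
        chosen≡ : cells t₂ %chosen 0 ≡ Found.c F
        chosen≡ = trans (cong-app (fr₂ %chosen) 0) (cong (_∸ 1) (Found.found≡ F))
        ord≡ : cells t₂ %ord ≡ cells s %ord [ cells s %cnt 0 ≔ x ]
        ord≡ = trans (trans (fr₂ %ord) (fr %ord)) (cong (cells s %ord [ cells s %cnt 0 ≔_]) ξ≡)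
        colour≡ : cells t₂ %colour [ cells t₂ %ξ 0 ≔ cells t₂ %chosen 0 ] ≡ cells s %colour [ x ≔ Found.c F ]
        colour≡ = trans (cong₂ (λ f a → f [ a ≔ cells t₂ %chosen 0 ]) (trans (fr₂ %colour) (fr %colour)) ξ≡′)
            (cong (cells s %colour [ x ≔_]) chosen≡)
        top≡ : cells t₂ %top [ cells t₂ %chosen 0 ≔ cells t₂ %ξ 0 ] ≡ cells s %top [ Found.c F ≔ x ]
        top≡ = trans (cong₂ (λ f a → f [ a ≔ cells t₂ %ξ 0 ]) (trans (fr₂ %top) (fr %top)) chosen≡)
            (cong (cells s %top [ Found.c F ≔_]) ξ≡′)

  -- The elements inserted before the visit of x in pass d: insertion is lexicographic, by degree
  -- and then by number.
  Earlier : ℕ → ℕ → ℕ → Set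
  Earlier d x y = y < n × (degree le n y < d ⊎ degree le n y ≡ d × y < x)

  -- `cnt≤` bounds the insertions by the visits made so far. This crude bound follows from the loops
  -- alone and is still quadratic in the end.
  record Inserted (d x : ℕ) (s : Config) : Set where
    field
      level≡    : cells s %level 0 ≡ d
      ξ≡        : cells s %ξ 0 ≡ x
      colouring : ColouringAt (Earlier d x) s
      cnt≤      : cells s %cnt 0 ≤ d * n + x

  opaque
    visit-correct : ∀ {d x} s → HasPoset le n (cells s) → Inserted d x s → x < n →
                    Run visit s (visit-time w) (Inserted d (suc x))
    visit-correct {d} {x} s P I x<n = run-seq {R = Between} (run-when (λ k eq → run-block (record
        { level≡ = level≡ ; ξ≡ = ξ≡ ; cnt≤ = ≤-trans cnt≤ (+-monoʳ-≤ (d * n) (n≤1+n x)) ; colouring = Colouring-In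
            (λ { y (y<n , inj₁ lt) → y<n , inj₁ lt ; y (y<n , inj₂ (e , lt)) → y<n , inj₂ (e , m<n⇒m<1+n lt) })
            (λ { y (y<n , inj₁ lt) → y<n , inj₁ lt ; y (y<n , inj₂ (e , lt)) → y<n , inj₂ (e , ≤∧≢⇒< (≤-pred lt)
                   λ { refl → contradiction (trans (sym (distance-≡ (trans deg≡ (trans e (sym level≡))))) eq) λ () }) })
            colouring }))
        (λ eq → let dx : degree le n x ≡ d
                    dx = trans (sym deg≡) (trans (distance-≡⁻¹ eq) level≡) in
          run-weaken ≤-refl (λ t fr (C , c≡) → record
            { level≡ = trans (cong-app (fr %level) 0) level≡ ; ξ≡ = trans (cong-app (fr %ξ) 0) ξ≡ ; colouring = C
            ; cnt≤ = ≤-trans (≤-reflexive c≡) (≤-trans (s≤s cnt≤) (≤-reflexive (sym (+-suc (d * n) x)))) })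
          (insert-correct {Earlier d x} {Earlier d (suc x)} s P colouring ξ≡ x<n
            (λ { (_ , inj₁ lt) → <⇒≢ lt dx ; (_ , inj₂ (_ , lt)) → <-irrefl refl lt })
            (not-below dx)
            (λ { y (y<n , inj₁ lt) → y<n , inj₁ lt ; y (y<n , inj₂ (e , lt)) → y<n , inj₂ (e , m<n⇒m<1+n lt) })
            (x<n , inj₂ (dx , ≤-refl))
            (λ { y (y<n , inj₁ lt) → inj₁ (y<n , inj₁ lt)
               ; y (y<n , inj₂ (e , lt)) → [ (λ y<x → inj₁ (y<n , inj₂ (e , y<x))) , inj₂ ]′ (≤-suc-split lt) }))))
      λ t fr J → run-block record { level≡ = Between.level≡ J ; ξ≡ = +1≡ (Between.ξ≡ J)
                                  ; colouring = Between.colouring J ; cnt≤ = Between.cnt≤ J }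
      where
      open Inserted I
      record Between (t : Config) : Set where
        field
          level≡    : cells t %level 0 ≡ d
          ξ≡        : cells t %ξ 0 ≡ x
          colouring : ColouringAt (Earlier d (suc x)) t
          cnt≤      : cells t %cnt 0 ≤ d * n + suc x
      deg≡ : cells s %deg (cells s %ξ 0) ≡ degree le n x
      deg≡ = trans (cong (cells s %deg) ξ≡) (HasPoset.deg≡ P x x<n)
      -- If x were strictly below an earlier y, its degree would be smaller than that of y; but
      -- earlier elements have at most the degree of x.
      not-below : degree le n x ≡ d → ∀ y → Earlier d x y → le x y ≡ 0
      not-below dx y (y<n , e) with bit x<n y<n
      ... | inj₁ z = z
      ... | inj₂ o with e
      ...   | inj₁ lt = contradiction (strict x<n y<n o λ { refl → <⇒≢ lt dx }) (<⇒≯ (subst (degree le n y <_) (sym dx) lt))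
      ...   | inj₂ (e , lt) = contradiction (trans dx (sym e)) (<⇒≢ (strict x<n y<n o (≢-sym (<⇒≢ lt))))

    insertAll-correct : ∀ s → HasPoset le n (cells s) → Inserted 0 0 s →
      Run insertAll s (insertAll-time n w) (λ t → ColouringAt (_< n) t × cells t %cnt 0 ≤ suc n * n)
    insertAll-correct s P I = run-weaken {B = insertAll-time n w} {Q = Round 0} ≤-refl
      (λ t _ (J : Round 0 t) → Colouring-In (λ _ → proj₁) (λ y y<n → y<n , inj₁ (≤-trans (s≤s (dg≤n y<n))
                   (≤-reflexive (trans (sym (Round.d+r≡n J)) (+-identityʳ _))))) (Round.colouring J)
               , ≤-trans (Round.cnt≤ J) (≤-reflexive (cong (_* n) (trans (sym (+-identityʳ _)) (Round.d+r≡n J)))))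
      (run-for (suc n) Round (trans (cong (_+ 1) (HasPoset.size≡ P)) (+-comm n 1))
        (record { d = 0 ; d+r≡n = refl ; level≡ = Inserted.level≡ I ; colouring = Inserted.colouring I ; cnt≤ =
            ≤-trans (Inserted.cnt≤ I) z≤n })
        λ r s′ _ fr J → run-after (run-seq {R = Inserted (Round.d J) n}
          (level s′ r (HasPoset-cong (fr %size) (fr %mat) (fr %row) (fr %deg) P) J)
          λ t _ K → run-block record
            { d = suc (Round.d J) ; d+r≡n = next-round _ (Round.d+r≡n J)
            ; level≡ = +1≡ (Inserted.level≡ K)
            ; colouring = Colouring-In
                (λ { y (y<n , inj₁ lt) → y<n , inj₁ (m<n⇒m<1+n lt) ; y (y<n , inj₂ (e , _)) → y<n ,
                    inj₁ (s≤s (≤-reflexive e)) })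
                (λ { y (y<n , inj₁ lt) → y<n , [ inj₁ , (λ e → inj₂ (e , y<n)) ]′ (≤-suc-split lt) }) (Inserted.colouring K)
            ; cnt≤ = ≤-trans (Inserted.cnt≤ K) (≤-reflexive (+-comm (Round.d J * n) n)) }))
      where
      record Round (r : ℕ) (t : Config) : Set where
        field
          d         : ℕ
          d+r≡n     : d + r ≡ suc n
          level≡    : cells t %level 0 ≡ d
          colouring : ColouringAt (Earlier d 0) t
          cnt≤      : cells t %cnt 0 ≤ d * n
      record Sweep (d r : ℕ) (t : Config) : Set where
        field
          x        : ℕ
          x+r≡n    : x + r ≡ n
          inserted : Inserted d x t
      level : ∀ s′ r → HasPoset le n (cells s′) → (J : Round (suc r) s′) →
              Run for %loop₂ from & %size ⟨ visit ⟩ (perform (%ξ := lit 0) (s′ at %loop₁ ≔ r))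
                  (for-time (& %size) n (visit-time w)) (Inserted (Round.d J) n)
      level s′ r P′ J = run-weaken {Q = Sweep (Round.d J) 0} ≤-refl
        (λ t _ (K : Sweep (Round.d J) 0 t) → subst (λ z → Inserted (Round.d J) z t)
            (trans (sym (+-identityʳ _)) (Sweep.x+r≡n K)) (Sweep.inserted K))
        (run-for n (Sweep (Round.d J)) (HasPoset.size≡ P′)
          (record { x = 0 ; x+r≡n = refl ; inserted = record { level≡ = Round.level≡ J ; ξ≡ = refl ; colouring =
              Round.colouring J
                  ; cnt≤ = ≤-trans (Round.cnt≤ J) (m≤m+n _ 0) } })
          λ i t _ fr K → run-weaken ≤-refl (λ _ _ L →
              record { x = suc (Sweep.x K) ; x+r≡n = next-round _ (Sweep.x+r≡n K) ; inserted = L })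
            (visit-correct (t at %loop₂ ≔ i) (HasPoset-cong (fr %size) (fr %mat) (fr %row) (fr %deg) P′)
                (record { Inserted (Sweep.inserted K) })
              (≤-trans (s≤s (m≤m+n _ i)) (≤-reflexive (next-round _ (Sweep.x+r≡n K))))))

-- Guessing the colours and the order type of a solution

lowBit : Expr → Expr
lowBit e = e ⊖ (halve e ⊕ halve e)

-- A guess is one number, consumed from its lowest bit. The colour of a variable is the number of
-- ones among its m bits, so that every string of bits can be decoded by halving alone. The
-- remaining bits are the order type, of which each sweep consumes a copy in `%queue`.
drawColour startColour chooseColours checkPair sweep : Cmd

drawColour = %want ! & %ι ≔ %want ! & %ι ⊕ lowBit (& %bits) ⨾ %bits := halve (& %bits)
startColour = %place ! & %ι ≔ lit 0 ⨾ %want ! & %ι ≔ lit 0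
chooseColours = for %ι from & %vars ⟨ startColour ⨾ for %loop₂ from & %chains ⟨ drawColour ⟩ ⟩

-- A place is a position in the order of insertion, across all chains. Chains need not be stored
-- separately: standing on an element of the wrong colour is one more violation that moves the
-- variable on.
enforce repair : Cmd
enforce =
  when differs (%colour ! & %ξ) (%want ! & %ι) ⟨ %place ! & %ι ≔ %place ! & %ι ⊕ lit 1 ∣
  when differs (%colour ! & %η) (%want ! & %κ) ⟨ %place ! & %κ ≔ %place ! & %κ ⊕ lit 1 ∣
  repair ⟩ ⟩
repair =
  when lowBit (& %queue)
    ⟨ when below (& %ξ) (& %η) ⟨ skip ∣ %place ! & %κ ≔ %place ! & %κ ⊕ lit 1 ⟩
    ∣ when below (& %ξ) (& %η) ⟨ %place ! & %ι ≔ %place ! & %ι ⊕ lit 1 ∣ skip ⟩ ⟩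
checkPair =
  %ξ := %ord ! (%place ! & %ι) ⨾ %η := %ord ! (%place ! & %κ) ⨾ enforce ⨾ %queue := halve (& %queue)
sweep = %queue := & %bits ⨾ for %ι from & %vars ⟨ for %κ from & %vars ⟨ checkPair ⟩ ⟩

number : List ℕ → ℕ
number []       = 0
number (b ∷ bs) = b + (number bs + number bs)

low : ℕ → ℕ
low z = z ∸ (⌊ z /2⌋ + ⌊ z /2⌋)

opaque
  half-bit : ∀ {b} z → b ≤ 1 → ⌊ b + (z + z) /2⌋ ≡ z
  half-bit {zero}     z _ = sym (n≡⌊n+n/2⌋ z)
  half-bit {suc zero} zero _ = refl
  half-bit {suc zero} (suc z) _ = trans (cong (λ y → ⌊ suc (suc y) /2⌋) (+-suc z z))
      (cong suc (half-bit {suc zero} z ≤-refl))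
  half-bit {suc (suc b)} z (s≤s ())

  low-bit : ∀ {b} z → b ≤ 1 → low (b + (z + z)) ≡ b
  low-bit {b} z b≤1 = trans (cong (λ y → b + (z + z) ∸ (y + y)) (half-bit z b≤1)) (m+n∸n≡m b (z + z))

  number< : ∀ bs → All (_≤ 1) bs → number bs < 2 ^ length bs
  number< [] [] = s≤s z≤n
  number< (b ∷ bs) (b≤1 ∷ bs≤1) = ≤-trans (s≤s (+-monoˡ-≤ (number bs + number bs) b≤1))
    (≤-trans (≤-reflexive (sym (cong suc (+-suc (number bs) (number bs)))))
      (≤-trans (+-mono-≤ (number< bs bs≤1) (number< bs bs≤1)) (≤-reflexive (cong (2 ^ length bs +_) (sym (+-identityʳ _))))))

  All-++ : ∀ {Q : ℕ → Set} {xs ys} → All Q xs → All Q ys → All Q (xs ++ ys)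
  All-++ []       qs = qs
  All-++ (p ∷ ps) qs = p ∷ All-++ ps qs

-- All loops count down, so the lists of bits start at the largest index.
unary : ℕ → ℕ → List ℕ
unary v zero    = []
unary v (suc c) = (if c <ᵇ v then 1 else 0) ∷ unary v c

colourBits : (ℕ → ℕ) → ℕ → ℕ → List ℕ
colourBits f m zero    = []
colourBits f m (suc v) = unary (f v) m ++ colourBits f m v

rowBits : (ℕ → ℕ) → ℕ → List ℕ
rowBits f zero    = []
rowBits f (suc c) = f c ∷ rowBits f c

typeBits : (ℕ → ℕ → ℕ) → ℕ → ℕ → List ℕ
typeBits t k zero    = []
typeBits t k (suc c) = rowBits (t c) k ++ typeBits t k c

if-≤1 : ∀ b → (if b then 1 else 0) ≤ 1
if-≤1 true  = ≤-refl
if-≤1 false = z≤n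

opaque
  length-unary : ∀ v c → length (unary v c) ≡ c
  length-unary v zero    = refl
  length-unary v (suc c) = cong suc (length-unary v c)

  length-colourBits : ∀ f m v → length (colourBits f m v) ≡ v * m
  length-colourBits f m zero    = refl
  length-colourBits f m (suc v) = trans (length-++ (unary (f v) m))
      (cong₂ _+_ (length-unary (f v) m) (length-colourBits f m v))

  length-rowBits : ∀ f c → length (rowBits f c) ≡ c
  length-rowBits f zero    = refl
  length-rowBits f (suc c) = cong suc (length-rowBits f c)

  length-typeBits : ∀ t k c → length (typeBits t k c) ≡ c * k
  length-typeBits t k zero    = refl
  length-typeBits t k (suc c) = trans (length-++ (rowBits (t c) k))
      (cong₂ _+_ (length-rowBits (t c) k) (length-typeBits t k c))

  unary≤1 : ∀ v c → All (_≤ 1) (unary v c)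
  unary≤1 v zero    = []
  unary≤1 v (suc c) = if-≤1 (c <ᵇ v) ∷ unary≤1 v c

  colourBits≤1 : ∀ f m v → All (_≤ 1) (colourBits f m v)
  colourBits≤1 f m zero    = []
  colourBits≤1 f m (suc v) = All-++ (unary≤1 (f v) m) (colourBits≤1 f m v)

  rowBits≤1 : ∀ f c → (∀ j → j < c → f j ≤ 1) → All (_≤ 1) (rowBits f c)
  rowBits≤1 f zero    f≤1 = []
  rowBits≤1 f (suc c) f≤1 = f≤1 c ≤-refl ∷ rowBits≤1 f c λ j j<c → f≤1 j (m<n⇒m<1+n j<c)

  typeBits≤1 : ∀ t k c → (∀ i j → i < c → j < k → t i j ≤ 1) → All (_≤ 1) (typeBits t k c)
  typeBits≤1 t k zero    t≤1 = []
  typeBits≤1 t k (suc c) t≤1 = All-++ (rowBits≤1 (t c) k λ j → t≤1 c j ≤-refl) (typeBits≤1 t k c λ i j i<c →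
      t≤1 i j (m<n⇒m<1+n i<c))

  -- The unary code of v has v ⊓ c ones at the indices below c. These are the ones still to be
  -- drawn, so this is one step of the decoding invariant.
  ⊓-step : ∀ v c → (if c <ᵇ v then 1 else 0) + (v ⊓ c) ≡ v ⊓ suc c
  ⊓-step v c with c <ᵇ v in eq
  ... | true  = let c<v = <ᵇ⇒< c v (subst T (sym eq) tt) in
                trans (cong suc (m≥n⇒m⊓n≡n (<⇒≤ c<v))) (sym (m≥n⇒m⊓n≡n c<v))
  ... | false = let v≤c = ≮⇒≥ λ c<v → subst T eq (<⇒<ᵇ c<v) in
                trans (m≤n⇒m⊓n≡m v≤c) (sym (m≤n⇒m⊓n≡m (m≤n⇒m≤1+n v≤c)))

choose-time : ℕ → ℕ → ℕ
choose-time k m = for-time (& %vars) k (ticks startColour + for-time (& %chains) m (ticks drawColour))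

sweep-time : ℕ → ℕ
sweep-time k = ticks (%queue := & %bits) + for-time (& %vars) k (for-time (& %vars) k (ticks checkPair))

-- The elements of X are the solutions coded by the current guess; the programs
-- run whether or not there is one.
module Guessing {X : Set} (k : ℕ) where

  -- `ahead` are the bits behind the colours; they stay in `%bits` for the sweeps.
  record Drawn (f : X → ℕ → ℕ) (m : ℕ) (ahead : X → List ℕ) (c : ℕ) (x : X) (s : Config) : Set where
    field
      bits≡  : cells s %bits 0 ≡ number (colourBits (f x) m c ++ ahead x)
      want≡  : ∀ v → c ≤ v → v < k → cells s %want v ≡ f x v
      place≡ : ∀ v → c ≤ v → v < k → cells s %place v ≡ 0

  record Drawing (f : X → ℕ → ℕ) (v : ℕ) (want₀ : ℕ → ℕ) (ahead : X → List ℕ) (c : ℕ) (x : X) (s : Config) : Set where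
    field
      bits≡ : cells s %bits 0 ≡ number (unary (f x v) c ++ ahead x)
      want≡ : cells s %want v + (f x v ⊓ c) ≡ f x v
      rest≡ : ∀ u → u ≢ v → cells s %want u ≡ want₀ u

  opaque
    draw-colour : ∀ f v m ahead s → (∀ x → f x v ≤ m) → cells s %chains 0 ≡ m → cells s %ι 0 ≡ v → cells s %want v ≡ 0 →
      (∀ x → cells s %bits 0 ≡ number (unary (f x v) m ++ ahead x)) →
      Run for %loop₂ from & %chains ⟨ drawColour ⟩ s (for-time (& %chains) m (ticks drawColour))
          (λ t → ∀ x → Drawing f v (cells s %want) ahead 0 x t)
    draw-colour f v m ahead s f≤m chains≡ ι≡ want≡ bits≡ = run-for m (λ c t → ∀ x → Drawing f v (cells s %want) ahead c x t)
        chains≡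
      (λ x → record { bits≡ = bits≡ x ; want≡ = trans (cong (_+ (f x v ⊓ m)) want≡) (m≤n⇒m⊓n≡m (f≤m x)) ; rest≡ = λ _ _ →
          refl })
      λ c t _ fr inv → run-block λ x → body c t (trans (cong-app (fr %ι) 0) ι≡) x (inv x)
      where
      body : ∀ c t → cells t %ι 0 ≡ v → ∀ x → Drawing f v (cells s %want) ahead (suc c) x t →
             Drawing f v (cells s %want) ahead c x (perform drawColour (t at %loop₂ ≔ c))
      body c t ι≡ x inv = record
        { bits≡ = trans (cong ⌊_/2⌋ (Drawing.bits≡ inv))
            (half-bit (number (unary (f x v) c ++ ahead x)) (if-≤1 (c <ᵇ f x v)))
        ; want≡ = trans (cong (_+ (f x v ⊓ c)) (trans at-v (cong (cells t %want v +_)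
                    (trans (cong low (Drawing.bits≡ inv))
                        (low-bit (number (unary (f x v) c ++ ahead x)) (if-≤1 (c <ᵇ f x v)))))))
                  (trans (+-assoc (cells t %want v) _ (f x v ⊓ c))
                  (trans (cong (cells t %want v +_) (⊓-step (f x v) c)) (Drawing.want≡ inv)))
        ; rest≡ = λ u u≢v → trans (≔-other (cells t %want) _ (λ eq → u≢v (trans eq ι≡))) (Drawing.rest≡ inv u u≢v) }
        where
        at-v : (cells t %want [ cells t %ι 0 ≔ cells t %want (cells t %ι 0) + low (cells t %bits 0) ]) v ≡ cells t %want v
            + low (cells t %bits 0)
        at-v = subst (λ z → (cells t %want [ z ≔ cells t %want z + low (cells t %bits 0) ]) v ≡ cells t %want v + low
            (cells t %bits 0))
                 (sym ι≡) (≔-same (cells t %want) v _)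

    choose-colours : ∀ f m ahead s → (∀ x v → v < k → f x v ≤ m) → cells s %vars 0 ≡ k → cells s %chains 0 ≡ m →
      (∀ x → cells s %bits 0 ≡ number (colourBits (f x) m k ++ ahead x)) →
      Run chooseColours s (choose-time k m) (λ t → ∀ x → Drawn f m ahead 0 x t)
    choose-colours f m ahead s f≤m vars≡ chains≡ bits≡ = run-for k (λ c t → ∀ x → Drawn f m ahead c x t) vars≡
      (λ x → record { bits≡ = bits≡ x ; want≡ = λ v k≤v v<k → contradiction v<k (≤⇒≯ k≤v) ; place≡ = λ v k≤v v<k →
          contradiction v<k (≤⇒≯ k≤v) })
      λ c t c<k fr inv → run-after (run-weaken ≤-refl (λ t₂ fr₂ D x → done c t (inv x) t₂ (fr₂ %place) (D x))
        (draw-colour f c m (λ x → colourBits (f x) m c ++ ahead x) (perform startColour (t at %ι ≔ c)) (λ x → f≤m x c c<k)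
          (trans (cong-app (fr %chains) 0) chains≡) refl (≔-same (cells t %want) c 0)
          (λ x → trans (Drawn.bits≡ (inv x)) (cong number (++-assoc (unary (f x c) m) (colourBits (f x) m c) (ahead x))))))
      where
      done : ∀ c t {x} → Drawn f m ahead (suc c) x t → ∀ t₂ → cells t₂ %place ≡ cells t %place [ c ≔ 0 ] →
             Drawing f c (cells t %want [ c ≔ 0 ]) (λ x → colourBits (f x) m c ++ ahead x) 0 x t₂ → Drawn f m ahead c x t₂
      done c t {x} inv t₂ fr D = record { bits≡ = Drawing.bits≡ D ; want≡ = want′ ; place≡ = place′ }
        where
        want′ : ∀ v → c ≤ v → v < k → cells t₂ %want v ≡ f x v
        want′ v c≤v v<k with m≤n⇒m<n∨m≡n c≤v
        ... | inj₂ refl = trans (sym (+-identityʳ _)) (trans (cong (cells t₂ %want c +_) (sym (⊓-zeroʳ (f x c))))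
            (Drawing.want≡ D))
        ... | inj₁ c<v  = trans (Drawing.rest≡ D v (≢-sym (<⇒≢ c<v))) (trans (≔-other (cells t %want) 0 (≢-sym (<⇒≢ c<v)))
            (Drawn.want≡ inv v c<v v<k))
        place′ : ∀ v → c ≤ v → v < k → cells t₂ %place v ≡ 0
        place′ v c≤v v<k with m≤n⇒m<n∨m≡n c≤v
        ... | inj₂ refl = trans (cong (λ g → g c) fr) (≔-same (cells t %place) c 0)
        ... | inj₁ c<v  = trans (cong (λ g → g v) fr) (trans (≔-other (cells t %place) 0 (≢-sym (<⇒≢ c<v)))
            (Drawn.place≡ inv v c<v v<k))

record Setting (n k m : ℕ) (le : ℕ → ℕ → ℕ) (ord colour : ℕ → ℕ) (σ : Store) : Set where
  field
    vars≡   : σ %vars 0 ≡ k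
    chains≡ : σ %chains 0 ≡ m
    ord≡    : σ %ord ≡ ord
    colour≡ : σ %colour ≡ colour
    poset   : HasPoset le n σ

keeps : Cmd → Bool
keeps c = not (writes c %vars) ∧ not (writes c %chains) ∧ not (writes c %ord) ∧ not (writes c %colour) ∧
          not (writes c %size) ∧ not (writes c %mat) ∧ not (writes c %row) ∧ not (writes c %deg)

opaque
  keep : ∀ {n k m le ord colour s t} c → Frame c s t → {T (keeps c)} → Setting n k m le ord colour (cells s) →
      Setting n k m le ord colour (cells t)
  keep c fr {kc} S =
    let a₁ , kc = ∧-T {not (writes c %vars)} kc
        a₂ , kc = ∧-T {not (writes c %chains)} kc
        a₃ , kc = ∧-T {not (writes c %ord)} kc
        a₄ , kc = ∧-T {not (writes c %colour)} kc
        a₅ , kc = ∧-T {not (writes c %size)} kc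
        a₆ , kc = ∧-T {not (writes c %mat)} kc
        a₇ , a₈ = ∧-T {not (writes c %row)} kc
    in record
      { vars≡   = trans (cong (λ f → f 0) (fr %vars {a₁})) vars≡
      ; chains≡ = trans (cong (λ f → f 0) (fr %chains {a₂})) chains≡
      ; ord≡    = trans (fr %ord {a₃}) ord≡
      ; colour≡ = trans (fr %colour {a₄}) colour≡
      ; poset   = HasPoset-cong (fr %size {a₅}) (fr %mat {a₆}) (fr %row {a₇}) (fr %deg {a₈}) poset }
    where open Setting S

  keep-perform : ∀ {n k m le ord colour} c s → {T (straight c)} → {T (keeps c)} →
                 Setting n k m le ord colour (cells s) → Setting n k m le ord colour (cells (perform c s))
  keep-perform c s {st} {kc} S = keep {s = s} {t = perform c s} c (frame (proj₁ (proj₂ (performs c s st)))) {kc} S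

  sumTo-cong : ∀ n f g → (∀ i → i < n → f i ≡ g i) → sumTo n f ≡ sumTo n g
  sumTo-cong zero    f g f≡g = refl
  sumTo-cong (suc n) f g f≡g = cong₂ _+_ (sumTo-cong n f g λ i i<n → f≡g i (m<n⇒m<1+n i<n)) (f≡g n ≤-refl)

  sumTo-mono : ∀ n f g → (∀ i → i < n → f i ≤ g i) → sumTo n f ≤ sumTo n g
  sumTo-mono zero    f g f≤g = z≤n
  sumTo-mono (suc n) f g f≤g = +-mono-≤ (sumTo-mono n f g λ i i<n → f≤g i (m<n⇒m<1+n i<n)) (f≤g n ≤-refl)

  sumTo-advance : ∀ k p i → i < k → sumTo k (p [ i ≔ p i + 1 ]) ≡ suc (sumTo k p)
  sumTo-advance (suc k) p i i<1+k with ≤-suc-split i<1+k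
  ... | inj₁ i<k  = cong₂ _+_ (sumTo-advance k p i i<k) (≔-other p (p i + 1) (≢-sym (<⇒≢ i<k)))
  ... | inj₂ refl = trans (cong₂ _+_ (sumTo-cong k _ p λ j j<k → ≔-other p (p i + 1) (<⇒≢ j<k)) (≔-same p i (p i + 1)))
                          (trans (cong (sumTo i p +_) (+-comm (p i) 1)) (+-suc (sumTo i p) (p i)))

-- The ascent to the least solution

module Sweeping {n w le} (order : Order n w le (degree le n)) (k m r : ℕ) (ord colour : ℕ → ℕ)
  (0<n : ∀ v → v < k → 0 < n) (ord<n : 0 < n → ∀ p → ord p < n)
  (mono : ∀ p q → p ≤ q → q < r → colour (ord p) ≡ colour (ord q) → le (ord p) (ord q) ≡ 1)
  {X : Set} (sol : X → ℕ → ℕ) (sol<r : ∀ x v → v < k → sol x v < r) where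
  open Order order

  Configured : Config → Set
  Configured s = Setting n k m le ord colour (cells s)

  type : X → ℕ → ℕ → ℕ
  type x i j = le (ord (sol x i)) (ord (sol x j))

  PairClean : X → (ℕ → ℕ) → ℕ → ℕ → Set
  PairClean x place i j = colour (ord (place i)) ≡ colour (ord (sol x i)) × colour (ord (place j)) ≡ colour (ord (sol x j)) ×
                          le (ord (place i)) (ord (place j)) ≡ type x i j

  Clean : X → (ℕ → ℕ) → Set
  Clean x place = ∀ i j → i < k → j < k → PairClean x place i j

  record Ready (x : X) (s : Config) : Set where
    field
      want≡ : ∀ v → v < k → cells s %want v ≡ colour (ord (sol x v))
      place≤ : ∀ v → v < k → cells s %place v ≤ sol x v

  -- A violated pair forces one variable to move: had it reached its place in the
  -- solution, the pair would be correct, as the other variable is still below its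
  -- own place on the same chain.
  record Checked (x : X) (i j : ℕ) (s t : Config) : Set where
    field
      queue≡  : cells t %queue 0 ≡ cells s %queue 0
      place≤  : ∀ v → v < k → cells t %place v ≤ sol x v
      outcome : (cells t %place ≡ cells s %place × PairClean x (cells s %place) i j)
              ⊎ (sumTo k (cells s %place) < sumTo k (cells t %place) × ¬ PairClean x (cells s %place) i j)

  opaque
    -- The moving variable was strictly below its place in the solution, so one step does not take
    -- it past that place.
    advanced : ∀ {x i j} s t v u → Ready x s → v < k → cells t %place ≡ cells s %place [ u ≔ cells s %place u + 1 ] → u ≡ v →
      cells t %queue 0 ≡ cells s %queue 0 → cells s %place v ≢ sol x v → ¬ PairClean x (cells s %place) i j →
          Checked x i j s t
    advanced {x} s t v .v R v<k t≡ refl q≡ p≢ unclean = record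
      { queue≡ = q≡
      ; place≤ = place≤
      ; outcome = inj₂ (≤-reflexive (sym (trans (cong (sumTo k) t≡) (sumTo-advance k (cells s %place) v v<k))) , unclean) }
      where
      place≤ : ∀ u → u < k → cells t %place u ≤ sol x u
      place≤ u u<k with u ≟ v
      ... | yes refl = ≤-trans (≤-reflexive (trans (cong (λ f → f u) t≡) (trans (≔-same (cells s %place) u _) (+-comm _ 1))))
                               (≤∧≢⇒< (Ready.place≤ R u u<k) p≢)
      ... | no u≢v   = ≤-trans (≤-reflexive (trans (cong (λ f → f u) t≡) (≔-other (cells s %place) _ u≢v)))
          (Ready.place≤ R u u<k)

    enforce-correct : ∀ {x i j} bs s → i < k → j < k → Configured s → cells s %ι 0 ≡ i → cells s %κ 0 ≡ j →
      cells s %ξ 0 ≡ ord (cells s %place i) → cells s %η 0 ≡ ord (cells s %place j) →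
      Ready x s → cells s %queue 0 ≡ number (type x i j ∷ bs) → Checked x i j s (perform enforce s)
    enforce-correct {x} {i} {j} bs s i<k j<k S ι≡ κ≡ ξ≡ η≡ R queue≡ = by-colours (colour a ≟ colour (ord (sol x i)))
        (colour b ≟ colour (ord (sol x j)))
      where
      place : ℕ → ℕ
      place = cells s %place
      a b : ℕ
      a = ord (place i)
      b = ord (place j)
      a<n : ∀ p → ord p < n
      a<n = ord<n (0<n i i<k)
      Q : Config → Set
      Q = Checked x i j s
      ξ-colour : cells s %colour (cells s %ξ 0) ≡ colour a
      ξ-colour = cong₂ (λ f z → f z) (Setting.colour≡ S) ξ≡
      η-colour : cells s %colour (cells s %η 0) ≡ colour b
      η-colour = cong₂ (λ f z → f z) (Setting.colour≡ S) η≡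
      ι-want : cells s %want (cells s %ι 0) ≡ colour (ord (sol x i))
      ι-want = trans (cong (cells s %want) ι≡) (Ready.want≡ R i i<k)
      κ-want : cells s %want (cells s %κ 0) ≡ colour (ord (sol x j))
      κ-want = trans (cong (cells s %want) κ≡) (Ready.want≡ R j j<k)
      below≡ : cells s %mat (cells s %row (cells s %ξ 0) + cells s %η 0) ≡ le a b
      below≡ = trans (cong₂ (λ y z → cells s %mat (cells s %row y + z)) ξ≡ η≡)
          (HasPoset.mat≡ (Setting.poset S) a b (a<n _) (a<n _))
      unchanged : PairClean x place i j → Checked x i j s s
      unchanged clean = record { queue≡ = refl ; place≤ = Ready.place≤ R ; outcome = inj₁ (refl , clean) }
      type≤1 : type x i j ≤ 1
      type≤1 = [ (λ z → ≤-trans (≤-reflexive z) z≤n) , ≤-reflexive ]′ (bit (a<n (sol x i)) (a<n (sol x j)))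
      low≡ : low (cells s %queue 0) ≡ type x i j
      low≡ = trans (cong low queue≡) (low-bit (number bs) type≤1)
      by-order : colour a ≡ colour (ord (sol x i)) → colour b ≡ colour (ord (sol x j)) →
                 type x i j ≡ 0 ⊎ type x i j ≡ 1 → le a b ≡ 0 ⊎ le a b ≡ 1 → Q (perform repair s)
      by-order ca cb (inj₂ t) (inj₂ l) = choose-suc Q (trans low≡ t)
          (choose-suc Q (trans below≡ l) (unchanged (ca , cb , trans l (sym t))))
      by-order ca cb (inj₁ t) (inj₁ l) = choose-0 Q (trans low≡ t)
          (choose-0 Q (trans below≡ l) (unchanged (ca , cb , trans l (sym t))))
      -- If j stood at its place in the solution, then a would lie below the element of i in the
      -- solution, which is on the same chain, and so below b by the guessed type.
      by-order ca cb (inj₂ t) (inj₁ l) = choose-suc Q (trans low≡ t) (choose-0 Q (trans below≡ l)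
        (advanced s _ j _ R j<k refl κ≡ refl
          (λ eq → contradiction (trans (sym (le-trans (a<n _) (a<n _) (a<n _)
                     (mono _ _ (Ready.place≤ R i i<k) (sol<r x i i<k) ca)
                         (trans (cong (λ p → le (ord (sol x i)) (ord p)) eq) t))) l) λ ())
          (λ { (_ , _ , e) → contradiction (trans (sym l) (trans e t)) λ () })))
      -- If i stood at its place in the solution, then a, being below b, would lie below the element
      -- of j in the solution, later on the chain of b, against the guessed type.
      by-order ca cb (inj₁ t) (inj₂ l) = choose-0 Q (trans low≡ t) (choose-suc Q (trans below≡ l)
        (advanced s _ i _ R i<k refl ι≡ refl
          (λ eq → contradiction (trans (sym (le-trans (a<n _) (a<n _) (a<n _) (trans (cong (λ p → le (ord p) b) (sym eq)) l)
                     (mono _ _ (Ready.place≤ R j j<k) (sol<r x j j<k) cb))) t) λ ())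
          (λ { (_ , _ , e) → contradiction (trans (sym l) (trans e t)) λ () })))
      by-colours : Dec (colour a ≡ colour (ord (sol x i))) → Dec (colour b ≡ colour (ord (sol x j))) → Q (perform enforce s)
      by-colours (no ca) _ = choose-≢ Q (λ e → ca (trans (sym ξ-colour) (trans e ι-want)))
        (advanced s _ i _ R i<k refl ι≡ refl (λ eq → ca (cong (λ p → colour (ord p)) eq)) (λ { (e , _) → ca e }))
      by-colours (yes ca) (no cb) = choose-≡ Q (trans ξ-colour (trans ca (sym ι-want)))
        (choose-≢ Q (λ e → cb (trans (sym η-colour) (trans e κ-want)))
          (advanced s _ j _ R j<k refl κ≡ refl (λ eq → cb (cong (λ p → colour (ord p)) eq)) (λ { (_ , e , _) → cb e })))
      by-colours (yes ca) (yes cb) = choose-≡ Q (trans ξ-colour (trans ca (sym ι-want)))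
          (choose-≡ Q (trans η-colour (trans cb (sym κ-want)))
        (by-order ca cb (bit (a<n _) (a<n _)) (bit (a<n _) (a<n _))))

  -- The state of a sweep that started with the given places; the pairs
  -- satisfying Done have been checked.
  record Swept (x : X) (places : ℕ → ℕ) (Done : ℕ → ℕ → Set) (ahead : List ℕ) (t : Config) : Set where
    field
      queue≡  : cells t %queue 0 ≡ number ahead
      place≤  : ∀ v → v < k → cells t %place v ≤ sol x v
      outcome : (cells t %place ≡ places × (∀ i j → i < k → j < k → Done i j → PairClean x places i j))
              ⊎ (sumTo k places < sumTo k (cells t %place) × ¬ Clean x places)

  -- Both loops count down, so the rows after i and the columns of row i from c on have been
  -- checked.
  RowDone : ℕ → ℕ → ℕ → ℕ → Set
  RowDone i c i′ j = i < i′ ⊎ (i′ ≡ i × c ≤ j)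

  Wanted : X → (ℕ → ℕ) → Set
  Wanted x want = ∀ v → v < k → want v ≡ colour (ord (sol x v))

  opaque
    check-pair : ∀ {x places i c ahead} s → i < k → c < k → Configured s → cells s %ι 0 ≡ i → cells s %κ 0 ≡ c →
      Wanted x (cells s %want) → Swept x places (RowDone i (suc c)) (type x i c ∷ ahead) s →
      Swept x places (RowDone i c) ahead (perform checkPair s)
    check-pair {x} {places} {i} {c} {ahead} s i<k c<k S ι≡ κ≡ wanted W = record
      { queue≡ = trans (cong ⌊_/2⌋ (trans (Checked.queue≡ ch) (Swept.queue≡ W))) (half-bit (number ahead) type≤1)
      ; place≤ = Checked.place≤ ch
      ; outcome = outcome (Swept.outcome W) (Checked.outcome ch) }
      where
      fetchPair : Cmd
      fetchPair = %ξ := %ord ! (%place ! & %ι) ⨾ %η := %ord ! (%place ! & %κ)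
      s₂ : Config
      s₂ = perform fetchPair s
      element : ∀ v {u} → cells s v 0 ≡ u → cells s %ord (cells s %place (cells s v 0)) ≡ ord (cells s %place u)
      element v eq = cong₂ (λ f z → f (cells s %place z)) (Setting.ord≡ S) eq
      ch : Checked x i c s₂ (perform enforce s₂)
      ch = enforce-correct ahead s₂ i<k c<k (keep-perform fetchPair s S) ι≡ κ≡ (element %ι ι≡) (element %κ κ≡)
             (record { want≡ = wanted ; place≤ = Swept.place≤ W }) (Swept.queue≡ W)
      a<n : ∀ p → ord p < n
      a<n = ord<n (0<n i i<k)
      type≤1 : type x i c ≤ 1
      type≤1 = [ (λ z → ≤-trans (≤-reflexive z) z≤n) , ≤-reflexive ]′ (bit (a<n (sol x i)) (a<n (sol x c)))
      place′ : ℕ → ℕ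
      place′ = cells (perform enforce s₂) %place
      outcome : (cells s %place ≡ places × (∀ i′ j → i′ < k → j < k → RowDone i (suc c) i′ j → PairClean x places i′ j))
                ⊎ (sumTo k places < sumTo k (cells s %place) × ¬ Clean x places) →
                (place′ ≡ cells s %place × PairClean x (cells s %place) i c)
                ⊎ (sumTo k (cells s %place) < sumTo k place′ × ¬ PairClean x (cells s %place) i c) →
                (place′ ≡ places × (∀ i′ j → i′ < k → j < k → RowDone i c i′ j → PairClean x places i′ j))
                ⊎ (sumTo k places < sumTo k place′ × ¬ Clean x places)
      outcome (inj₁ (refl , clean)) (inj₁ (p≡ , cl)) = inj₁ (p≡ , λ
        { i′ j i′<k j<k (inj₁ lt) → clean i′ j i′<k j<k (inj₁ lt)
        ; i′ j i′<k j<k (inj₂ (refl , c≤j)) → [ (λ c<j → clean i′ j i′<k j<k (inj₂ (refl , c<j))) , (λ { refl → cl }) ]′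
            (m≤n⇒m<n∨m≡n c≤j) })
      outcome (inj₁ (refl , clean)) (inj₂ (lt , uncl)) = inj₂ (lt , λ cl → uncl (cl i c i<k c<k))
      outcome (inj₂ (lt , uncl)) (inj₁ (p≡ , _)) = inj₂ (subst (λ p → sumTo k places < sumTo k p) (sym p≡) lt , uncl)
      outcome (inj₂ (lt , uncl)) (inj₂ (lt′ , _)) = inj₂ (<-trans lt lt′ , uncl)

    Swept-κ : ∀ {x places Done ahead} c t → Swept x places Done ahead t → Swept x places Done ahead (t at %κ ≔ c)
    Swept-κ c t W = record { queue≡ = Swept.queue≡ W ; place≤ = Swept.place≤ W ; outcome = Swept.outcome W }

    Swept-ι : ∀ {x places Done ahead} c t → Swept x places Done ahead t → Swept x places Done ahead (t at %ι ≔ c)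
    Swept-ι c t W = record { queue≡ = Swept.queue≡ W ; place≤ = Swept.place≤ W ; outcome = Swept.outcome W }

    sweep-row : ∀ {i} (places : X → ℕ → ℕ) (ahead : X → List ℕ) s → i < k → Configured s → cells s %ι 0 ≡ i →
        (∀ x → Wanted x (cells s %want)) →
      (∀ x → Swept x (places x) (λ i′ _ → i < i′) (rowBits (type x i) k ++ ahead x) s) →
      Run for %κ from & %vars ⟨ checkPair ⟩ s (for-time (& %vars) k (ticks checkPair))
          (λ t → ∀ x → Swept x (places x) (RowDone i 0) (ahead x) t)
    sweep-row {i} places ahead s i<k S ι≡ wanted W = run-for k
      (λ c t → ∀ x → Swept x (places x) (RowDone i c) (rowBits (type x i) c ++ ahead x) t) (Setting.vars≡ S)
      (λ x → record { queue≡ = Swept.queue≡ (W x) ; place≤ = Swept.place≤ (W x)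
        ; outcome = [ (λ { (p≡ , cl) → inj₁ (p≡ ,
            λ { i′ j i′<k j<k (inj₁ lt) → cl i′ j i′<k j<k lt ; i′ j i′<k j<k (inj₂ (_ , k≤j)) →
            contradiction j<k (≤⇒≯ k≤j) }) }) , inj₂ ]′ (Swept.outcome (W x)) })
      λ c t c<k fr inv → run-block λ x → check-pair {x} {places x} {i} {c} (t at %κ ≔ c) i<k c<k
        (keep-perform (%κ := lit c) t (keep {s = s} {t = t} for %κ from & %vars ⟨ checkPair ⟩ fr S))
        (trans (cong-app (fr %ι) 0) ι≡) refl (λ v v<k → trans (cong-app (fr %want) v) (wanted x v v<k)) (Swept-κ c t (inv x))

    sweep-correct : ∀ s → Configured s → (∀ x → Wanted x (cells s %want)) → (∀ x v → v < k → cells s %place v ≤ sol x v) →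
      (∀ x → cells s %bits 0 ≡ number (typeBits (type x) k k)) →
      Run sweep s (sweep-time k) (λ t → ∀ x → Swept x (cells s %place) (λ _ _ → ⊤) [] t)
    sweep-correct s S wanted place≤ bits≡ = run-after (run-weaken ≤-refl
      (λ t _ W x → record { queue≡ = Swept.queue≡ (W x) ; place≤ = Swept.place≤ (W x)
        ; outcome = [ (λ { (p≡ , cl) → inj₁ (p≡ , λ i j i<k j<k _ → cl i j i<k j<k z≤n) }) , inj₂ ]′ (Swept.outcome (W x)) })
      (run-for k (λ c t → ∀ x → Swept x (cells s %place) (λ i _ → c ≤ i) (typeBits (type x) k c) t) (Setting.vars≡ S)
        (λ x → record { queue≡ = bits≡ x ; place≤ = place≤ x ; outcome =
            inj₁ (refl , λ i j i<k _ k≤i → contradiction i<k (≤⇒≯ k≤i)) })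
        λ c t c<k fr inv → run-weaken ≤-refl
          (λ t₂ _ W x → record { queue≡ = Swept.queue≡ (W x) ; place≤ = Swept.place≤ (W x)
            ; outcome = [ (λ { (p≡ , cl) → inj₁ (p≡ , λ i j i<k j<k c≤i →
                cl i j i<k j<k ([ inj₁ , (λ { refl → inj₂ (refl , z≤n) }) ]′ (m≤n⇒m<n∨m≡n c≤i))) })
                        , inj₂ ]′ (Swept.outcome (W x)) })
          (sweep-row (λ _ → cells s %place) (λ (x : X) → typeBits (type x) k c) (t at %ι ≔ c) c<k
            (keep-perform (%ι := lit c) t (keep {s = perform (%queue := & %bits) s} {t = t} for %ι from & %vars
                ⟨ for %κ from & %vars ⟨ checkPair ⟩ ⟩ fr
              (keep-perform (%queue := & %bits) s S)))
            refl (λ x v v<k → trans (cong-app (fr %want) v) (wanted x v v<k)) (λ x → Swept-ι c t (inv x)))))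

    -- A sweep that meets a violation raises the sum of the places, which the solution keeps at most
    -- k r. So one of the k r + 1 sweeps starts from clean places, or the last one ends in them, and
    -- clean places no longer move.
    sweeps-correct : ∀ s → Configured s → cells s %sweeps 0 ≡ suc (k * r) → (∀ x → Wanted x (cells s %want)) →
      (∀ (x : X) v → v < k → cells s %place v ≡ 0) → (∀ x → cells s %bits 0 ≡ number (typeBits (type x) k k)) →
      Run for %loop₁ from & %sweeps ⟨ sweep ⟩ s (for-time (& %sweeps) (suc (k * r)) (sweep-time k))
          (λ t → ∀ x → Clean x (cells t %place))
    sweeps-correct s S sweeps≡ wanted place≡ bits≡ = run-weaken {B = for-time (& %sweeps) (suc (k * r)) (sweep-time k)}
        {Q = λ t → ∀ x → Sweeps x 0 t} ≤-refl
      (λ t _ W x → [ (λ cl → cl) , (λ le →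
          contradiction (≤-trans (≤-reflexive (sym (trans (sym (+-identityʳ _)) (Sweeps.d+c≡ (W x))))) (≤-trans le
          (≤-trans (sumTo-mono k _ _ (Sweeps.place≤ (W x))) (sumTo-≤ k (sol x) r λ v v<k → <⇒≤ (sol<r x v v<k)))))
              (<⇒≱ ≤-refl)) ]′ (Sweeps.outcome (W x)))
      (run-for {B = sweep-time k} (suc (k * r)) (λ c t → ∀ x → Sweeps x c t) sweeps≡
        (λ x → record { d = 0 ; d+c≡ = refl ; place≤ = λ v v<k → ≤-trans (≤-reflexive (place≡ x v v<k)) z≤n ; outcome =
            inj₂ z≤n })
        λ c t _ fr inv → run-weaken {B = sweep-time k} ≤-refl (λ t₂ _ W (x : X) → next c t (inv x) t₂ (W x))
          (sweep-correct (t at %loop₁ ≔ c) (keep-perform (%loop₁ := lit c) t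
              (keep {s = s} {t = t} for %loop₁ from & %sweeps ⟨ sweep ⟩ fr S))
            (λ x v v<k → trans (cong-app (fr %want) v) (wanted x v v<k)) (λ x → Sweeps.place≤ (inv x))
            (λ x → trans (cong-app (fr %bits) 0) (bits≡ x))))
      where
      record Sweeps (x : X) (c : ℕ) (t : Config) : Set where
        field
          d       : ℕ
          d+c≡    : d + c ≡ suc (k * r)
          place≤  : ∀ v → v < k → cells t %place v ≤ sol x v
          outcome : Clean x (cells t %place) ⊎ d ≤ sumTo k (cells t %place)
      next : ∀ c t {x} → Sweeps x (suc c) t → ∀ t₂ → Swept x (cells t %place) (λ _ _ → ⊤) [] t₂ → Sweeps x c t₂
      next c t {x} I t₂ W = record
        { d = suc (Sweeps.d I) ; d+c≡ = next-round _ (Sweeps.d+c≡ I) ; place≤ = Swept.place≤ W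
        ; outcome = [ (λ { (p≡ , cl) → inj₁ (subst (Clean x) (sym p≡) λ i j i<k j<k → cl i j i<k j<k tt) })
                    , (λ { (lt , uncl) → [ (λ cl → contradiction cl uncl) , (λ le → inj₂ (≤-trans (s≤s le) lt)) ]′
                        (Sweeps.outcome I) }) ]′ (Swept.outcome W) }

-- Evaluating the matrix

-- Reading the prefix notation from right to left makes it postfix; the stack of
-- truth values is the number %stk, with its top as lowest bit.
evalAtom evalNode : Cmd
evalAtom =
  %ξ := %ord ! (%place ! (%lhs ! & %loop₃)) ⨾
  %η := %ord ! (%place ! (%rhs ! & %loop₃)) ⨾
  when %op ! & %loop₃ ⊖ lit 4
    ⟨ %val := below (& %ξ) (& %η)
    ∣ %val := lit 1 ⊖ differs (& %ξ) (& %η) ⟩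
evalNode =
  when %op ! & %loop₃ ⊖ lit 2
    ⟨ evalAtom ⨾ %stk := differs (& %val) (%sgn ! & %loop₃) ⊕ (& %stk ⊕ & %stk)
    ∣ when %op ! & %loop₃ ⊖ lit 1
        ⟨ when lowBit (& %stk)
            ⟨ %stk := lit 1 ⊕ (halve (halve (& %stk)) ⊕ halve (halve (& %stk))) ∣ %stk := halve (& %stk) ⟩
        ∣ when lowBit (& %stk)
            ⟨ %stk := halve (& %stk) ∣ %stk := halve (halve (& %stk)) ⊕ halve (halve (& %stk)) ⟩ ⟩ ⟩

element : Store → Var → ℕ → ℕ
element σ v j = σ %ord (σ %place (σ v j))

-- The effect of `evalNode` on the stack, as a function of the numbers it reads. At an atom the
-- distance to the sign is an exclusive or. A connective drops the top bit and, depending on it,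
-- keeps or overwrites the bit underneath.
push : ℕ → ℕ → ℕ → ℕ → ℕ → ℕ → ℕ
push op sgn l x y z =
  choose (op ∸ 2) (distance (choose (op ∸ 4) l (1 ∸ distance x y)) sgn + (z + z))
    (choose (op ∸ 1) (choose (low z) (1 + (⌊ ⌊ z /2⌋ /2⌋ + ⌊ ⌊ z /2⌋ /2⌋)) ⌊ z /2⌋)
                     (choose (low z) ⌊ z /2⌋ (⌊ ⌊ z /2⌋ /2⌋ + ⌊ ⌊ z /2⌋ /2⌋)))

pushNode : Store → ℕ → ℕ → ℕ
pushNode σ j z = push (σ %op j) (σ %sgn j) (σ %mat (σ %row (element σ %lhs j) + element σ %rhs j)) (element σ %lhs j)
    (element σ %rhs j) z

pushAll : (ℕ → ℕ → ℕ) → ℕ → ℕ → ℕ → ℕ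
pushAll f l zero    z = z
pushAll f l (suc c) z = pushAll f l c (f (l + c) z)

eval-time : ℕ → ℕ
eval-time l = for-time (& %len) l (ticks evalNode)

opaque
  choose-map : ∀ {A B : Set} (f : A → B) z t e → f (choose z t e) ≡ choose z (f t) (f e)
  choose-map f zero    t e = refl
  choose-map f (suc _) t e = refl

  choose-cong : ∀ {A : Set} z {t t′ e e′ : A} → t ≡ t′ → e ≡ e′ → choose z t e ≡ choose z t′ e′
  choose-cong z refl refl = refl

  evalNode-stk : ∀ s j → cells (perform evalNode (s at %loop₃ ≔ j)) %stk 0 ≡ pushNode (cells s) j (cells s %stk 0)
  evalNode-stk s j = trans (choose-map (λ t → cells t %stk 0) (cells s %op j ∸ 2) _ _) (choose-cong (cells s %op j ∸ 2)
    (trans (choose-map (λ t → cells (perform (%stk := differs (& %val) (%sgn ! & %loop₃) ⊕ (& %stk ⊕ & %stk)) t) %stk 0)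
        (cells s %op j ∸ 4) _ _)
      (sym (choose-map (λ v → distance v (cells s %sgn j) + (cells s %stk 0 + cells s %stk 0)) (cells s %op j ∸ 4) _ _)))
    (trans (choose-map (λ t → cells t %stk 0) (cells s %op j ∸ 1) _ _) (choose-cong (cells s %op j ∸ 1)
      (choose-map (λ t → cells t %stk 0) (low (cells s %stk 0)) _ _)
          (choose-map (λ t → cells t %stk 0) (low (cells s %stk 0)) _ _))))

  element-cong : ∀ {σ τ} v j → τ %ord ≡ σ %ord → τ %place ≡ σ %place → τ v ≡ σ v → element τ v j ≡ element σ v j
  element-cong v j ord place v≡ = cong₂ (λ f z → f z) ord (cong₂ (λ f z → f z) place (cong (λ f → f j) v≡))

  pushNode-cong : ∀ {σ τ} j z → τ %op ≡ σ %op → τ %sgn ≡ σ %sgn → τ %lhs ≡ σ %lhs → τ %rhs ≡ σ %rhs →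
    τ %ord ≡ σ %ord → τ %place ≡ σ %place → τ %mat ≡ σ %mat → τ %row ≡ σ %row → pushNode τ j z ≡ pushNode σ j z
  pushNode-cong {σ} {τ} j z op sgn lhs rhs ord place mat row = same (cong (λ f → f j) op) (cong (λ f → f j) sgn)
    (cong₂ (λ f z → f z) mat (cong₂ _+_ (cong₂ (λ f z → f z) row x≡) y≡)) x≡ y≡
    where
    x≡ : element τ %lhs j ≡ element σ %lhs j
    x≡ = element-cong {σ} {τ} %lhs j ord place lhs
    y≡ : element τ %rhs j ≡ element σ %rhs j
    y≡ = element-cong {σ} {τ} %rhs j ord place rhs
    same : ∀ {a a′ b b′ c c′ d d′ e e′} → a ≡ a′ → b ≡ b′ → c ≡ c′ → d ≡ d′ → e ≡ e′ → push a b c d e z ≡ push a′ b′ c′ d′ e′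
        z
    same refl refl refl refl refl = refl

  evaluate-correct : ∀ l s → cells s %len 0 ≡ l →
    Run for %loop₃ from & %len ⟨ evalNode ⟩ s (eval-time l) (λ t → cells t %stk 0 ≡ pushAll (pushNode (cells s)) 0 l
        (cells s %stk 0))
  evaluate-correct l s len≡ = run-for l (λ c t → pushAll (pushNode (cells s)) 0 c (cells t %stk 0) ≡ pushAll
      (pushNode (cells s)) 0 l (cells s %stk 0)) len≡ refl
    λ c t _ fr inv → run-block (trans (cong (pushAll (pushNode (cells s)) 0 c) (trans (evalNode-stk t c)
      (pushNode-cong {cells s} {cells t} c (cells t %stk 0) (fr %op) (fr %sgn) (fr %lhs) (fr %rhs) (fr %ord) (fr %place)
          (fr %mat) (fr %row)))) inv)

  pushAll-+ : ∀ f l a b z → pushAll f l (a + b) z ≡ pushAll f l a (pushAll f (l + a) b z)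
  pushAll-+ f l a zero    z = cong (λ c → pushAll f l c z) (+-identityʳ a)
  pushAll-+ f l a (suc b) z = trans (cong (λ c → pushAll f l c z) (+-suc a b))
    (trans (cong (λ q → pushAll f l (a + b) (f q z)) (sym (+-assoc l a b))) (pushAll-+ f l a b (f (l + a + b) z)))

bitOf : ∀ {A : Set} → Dec A → ℕ
bitOf d = if does d then 1 else 0

module Truth {n} (P : FinPoset n) where
  open FinPoset P

  ⟦_⟧ᴬ? : ∀ {k} (α : Atom k) ρ → Dec (⟦_⟧ᴬ P α ρ)
  ⟦ x ≐ y ⟧ᴬ? ρ = lookup ρ x ≟ᶠ lookup ρ y
  ⟦ x ≼ y ⟧ᴬ? ρ = lookup ρ x ⊑? lookup ρ y

  ⟦_⟧ᴹ? : ∀ {k} (ψ : Matrix k) ρ → Dec (⟦_⟧ᴹ P ψ ρ)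
  ⟦ pos α ⟧ᴹ? ρ  = ⟦ α ⟧ᴬ? ρ
  ⟦ neg α ⟧ᴹ? ρ  = ¬? (⟦ α ⟧ᴬ? ρ)
  ⟦ ψ ∧′ χ ⟧ᴹ? ρ = ⟦ ψ ⟧ᴹ? ρ ×-dec ⟦ χ ⟧ᴹ? ρ
  ⟦ ψ ∨′ χ ⟧ᴹ? ρ = ⟦ ψ ⟧ᴹ? ρ ⊎-dec ⟦ χ ⟧ᴹ? ρ

  module _ {le : ℕ → ℕ → ℕ} (le≡ : ∀ i j → le (toℕ i) (toℕ j) ≡ bitOf (i ⊑? j)) where

    module _ {k} (ρ : Vec (Fin n) k) (σ : Store) (poset : HasPoset le n σ)
             (ρ≡ : ∀ v → σ %ord (σ %place (toℕ v)) ≡ toℕ (lookup ρ v)) where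

      Evaluates : Matrix k → ℕ → Set
      Evaluates ψ l = ∀ z → pushAll (pushNode σ) l (nodes ψ) z ≡ bitOf (⟦ ψ ⟧ᴹ? ρ) + (z + z)

      opaque
        push-atom : ∀ α s l z → node σ l ≡ atomNode s α → pushNode σ l z ≡ distance (bitOf (⟦ α ⟧ᴬ? ρ)) s + (z + z)
        push-atom (x ≼ y) s l z eq 
          = trans (cong (λ o → push o (σ %sgn l) lxy e₁ e₂ z) (cong proj₁ eq))
                  (cong₂ (λ v t → distance v t + (z + z)) value (cong (λ q → proj₁ (proj₂ q)) eq))
          where
          e₁ e₂ lxy : ℕ
          e₁ = element σ %lhs l
          e₂ = element σ %rhs l
          lxy = σ %mat (σ %row e₁ + e₂)
          value : lxy ≡ bitOf (lookup ρ x ⊑? lookup ρ y)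
          value = trans (cong₂ (λ a b → σ %mat (σ %row a + b))
                    (trans (cong (λ q → σ %ord (σ %place (proj₁ (proj₂ (proj₂ q))))) eq) (ρ≡ x))
                    (trans (cong (λ q → σ %ord (σ %place (proj₂ (proj₂ (proj₂ q))))) eq) (ρ≡ y)))
                  (trans (HasPoset.mat≡ poset _ _ (toℕ<n (lookup ρ x)) (toℕ<n (lookup ρ y))) (le≡ (lookup ρ x) (lookup ρ y)))
        push-atom (x ≐ y) s l z eq
          = trans (cong (λ o → push o (σ %sgn l) lxy e₁ e₂ z) (cong proj₁ eq))
                  (cong₂ (λ v t → distance v t + (z + z)) value (cong (λ q → proj₁ (proj₂ q)) eq))
          where
          e₁ e₂ lxy : ℕ
          e₁ = element σ %lhs l
          e₂ = element σ %rhs l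
          lxy = σ %mat (σ %row e₁ + e₂)
          by-equality : ∀ (i j : Fin n) → 1 ∸ distance (toℕ i) (toℕ j) ≡ bitOf (i ≟ᶠ j)
          by-equality i j with i ≟ᶠ j
          ... | yes i≡j = cong (1 ∸_) (distance-≡ (cong toℕ i≡j))
          ... | no  i≢j with d , eq ← distance-≢ {toℕ i} {toℕ j} (λ e → i≢j (toℕ-injective e)) = trans (cong (1 ∸_) eq) (0∸n≡0 d)
          value : 1 ∸ distance e₁ e₂ ≡ bitOf (lookup ρ x ≟ᶠ lookup ρ y)
          value = trans (cong₂ (λ a b → 1 ∸ distance a b)
                    (trans (cong (λ q → σ %ord (σ %place (proj₁ (proj₂ (proj₂ q))))) eq) (ρ≡ x))
                    (trans (cong (λ q → σ %ord (σ %place (proj₂ (proj₂ (proj₂ q))))) eq) (ρ≡ y)))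
                  (by-equality (lookup ρ x) (lookup ρ y))

        bitOf≤1 : ∀ {A : Set} (d : Dec A) → bitOf d ≤ 1
        bitOf≤1 d = if-≤1 (does d)

        distance-1 : ∀ {A : Set} (d : Dec A) → distance (bitOf d) 1 ≡ bitOf (¬? d)
        distance-1 d with does d
        ... | true  = refl
        ... | false = refl

        distance-0 : ∀ v → distance v 0 ≡ v
        distance-0 v = trans (cong (v +_) (0∸n≡0 v)) (+-identityʳ v)

        push-∧ : ∀ {A B : Set} (d : Dec A) (e : Dec B) {op} s l x y z → op ≡ 1 →
                 push op s l x y (bitOf d + ((bitOf e + (z + z)) + (bitOf e + (z + z)))) ≡ bitOf (d ×-dec e) + (z + z)
        push-∧ d e s l x y z refl rewrite low-bit (bitOf e + (z + z)) (bitOf≤1 d) | half-bit (bitOf e + (z + z))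
            (bitOf≤1 d) | half-bit z (bitOf≤1 e) with does d
        ... | true  = refl
        ... | false = refl

        push-∨ : ∀ {A B : Set} (d : Dec A) (e : Dec B) {op} s l x y z → op ≡ 2 →
                 push op s l x y (bitOf d + ((bitOf e + (z + z)) + (bitOf e + (z + z)))) ≡ bitOf (d ⊎-dec e) + (z + z)
        push-∨ d e s l x y z refl rewrite low-bit (bitOf e + (z + z)) (bitOf≤1 d) | half-bit (bitOf e + (z + z))
            (bitOf≤1 d) | half-bit z (bitOf≤1 e) with does d
        ... | true  = refl
        ... | false = refl

        -- ψ is stored before χ and hence evaluated after it, so its value lies on top when the
        -- connective is reached.
        push-connective : ∀ ψ χ l → Evaluates ψ (suc l) → Evaluates χ (suc l + nodes ψ) → ∀ z →
          pushAll (pushNode σ) l (suc (nodes ψ + nodes χ)) z ≡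
          pushNode σ l (bitOf (⟦ ψ ⟧ᴹ? ρ) + ((bitOf (⟦ χ ⟧ᴹ? ρ) + (z + z)) + (bitOf (⟦ χ ⟧ᴹ? ρ) + (z + z))))
        push-connective ψ χ l evψ evχ z =
          trans (pushAll-+ (pushNode σ) l 1 (nodes ψ + nodes χ) z)
          (trans (cong (λ q → pushNode σ q (pushAll (pushNode σ) (l + 1) (nodes ψ + nodes χ) z)) (+-identityʳ l))
          (cong (pushNode σ l) (trans (cong (λ q → pushAll (pushNode σ) q (nodes ψ + nodes χ) z) (+-comm l 1))
            (trans (pushAll-+ (pushNode σ) (suc l) (nodes ψ) (nodes χ) z)
            (trans (cong (pushAll (pushNode σ) (suc l) (nodes ψ)) (evχ z)) (evψ _))))))

        evaluates : ∀ ψ l → Stored σ l ψ → Evaluates ψ l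
        evaluates (pos α) l st z = trans (cong (λ q → pushNode σ q z) (+-identityʳ l))
          (trans (push-atom α 0 l z st) (cong (_+ (z + z)) (distance-0 (bitOf (⟦ α ⟧ᴬ? ρ)))))
        evaluates (neg α) l st z = trans (cong (λ q → pushNode σ q z) (+-identityʳ l))
          (trans (push-atom α 1 l z st) (cong (_+ (z + z)) (distance-1 (⟦ α ⟧ᴬ? ρ))))
        evaluates (ψ ∧′ χ) l (o , st , st′) z = trans (push-connective ψ χ l (evaluates ψ _ st) (evaluates χ _ st′) z)
          (push-∧ (⟦ ψ ⟧ᴹ? ρ) (⟦ χ ⟧ᴹ? ρ) (σ %sgn l) (σ %mat (σ %row (element σ %lhs l) + element σ %rhs l))
              (element σ %lhs l) (element σ %rhs l) z o)
        evaluates (ψ ∨′ χ) l (o , st , st′) z = trans (push-connective ψ χ l (evaluates ψ _ st) (evaluates χ _ st′) z)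
          (push-∨ (⟦ ψ ⟧ᴹ? ρ) (⟦ χ ⟧ᴹ? ρ) (σ %sgn l) (σ %mat (σ %row (element σ %lhs l) + element σ %rhs l))
              (element σ %lhs l) (element σ %rhs l) z o)

  does-transfer : ∀ {A B : Set} (d : Dec A) (e : Dec B) → does d ≡ does e → A → B
  does-transfer (yes _) (yes b) _  _ = b
  does-transfer (no ¬a) _       _  a = contradiction a ¬a

  -- Equality of elements is not listed separately: antisymmetry recovers it from the two
  -- comparisons.
  SameType : ∀ {k} → Vec (Fin n) k → Vec (Fin n) k → Set
  SameType ρ ρ′ = ∀ u v → does (lookup ρ u ⊑? lookup ρ v) ≡ does (lookup ρ′ u ⊑? lookup ρ′ v)

  open IsDecPartialOrder isDecPartialOrder using (reflexive; antisym)

  sameType-atom : ∀ {k} (α : Atom k) {ρ ρ′} → SameType ρ ρ′ → ⟦_⟧ᴬ P α ρ → ⟦_⟧ᴬ P α ρ′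
  sameType-atom (x ≼ y) same h = does-transfer (_ ⊑? _) (_ ⊑? _) (same x y) h
  sameType-atom (x ≐ y) same h = antisym (does-transfer (_ ⊑? _) (_ ⊑? _) (same x y) (reflexive h))
                                         (does-transfer (_ ⊑? _) (_ ⊑? _) (same y x) (reflexive (sym h)))

  sameType-matrix : ∀ {k} (ψ : Matrix k) {ρ ρ′} → SameType ρ ρ′ → ⟦_⟧ᴹ P ψ ρ → ⟦_⟧ᴹ P ψ ρ′
  sameType-matrix (pos α) {ρ} {ρ′} same h = sameType-atom α {ρ} {ρ′} same h
  sameType-matrix (neg α) {ρ} {ρ′} same h h′ = h (sameType-atom α {ρ′} {ρ} (λ u v → sym (same u v)) h′)
  sameType-matrix (ψ ∧′ χ) {ρ} {ρ′} same (h , h′) = sameType-matrix ψ {ρ} {ρ′} same h , sameType-matrix χ {ρ} {ρ′} same h′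
  sameType-matrix (ψ ∨′ χ) {ρ} {ρ′} same (inj₁ h) = inj₁ (sameType-matrix ψ {ρ} {ρ′} same h)
  sameType-matrix (ψ ∨′ χ) {ρ} {ρ′} same (inj₂ h) = inj₂ (sameType-matrix χ {ρ} {ρ′} same h)

-- Exhausting the guesses

-- The product k r and the power of 2 are built by repeated addition and doubling. The test in
-- `solve` is 0 exactly if the poset is empty and there are variables: then no assignment exists,
-- and positions would not denote elements.
doubleGuesses countRow countGuesses guessBody solve : Cmd
doubleGuesses = %guesses := & %guesses ⊕ & %guesses
countRow =
  %sweeps := & %sweeps ⊕ & %cnt ⨾
  for %loop₂ from & %chains ⟨ doubleGuesses ⟩ ⨾
  for %loop₂ from & %vars ⟨ doubleGuesses ⟩
countGuesses = %guesses := lit 1 ⨾ %sweeps := lit 1 ⨾ for %loop₁ from & %vars ⟨ countRow ⟩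
guessBody =
  %bits := & %guess ⨾
  chooseColours ⨾
  for %loop₁ from & %sweeps ⟨ sweep ⟩ ⨾
  %stk := lit 0 ⨾
  for %loop₃ from & %len ⟨ evalNode ⟩ ⨾
  when & %stk ⟨ %ans := lit 1 ∣ skip ⟩
solve =
  when & %size ⊕ (lit 1 ⊖ & %vars)
    ⟨ for %guess from & %guesses ⟨ guessBody ⟩
    ∣ skip ⟩

double-time : Expr → ℕ → ℕ
double-time e c = for-time e c (ticks doubleGuesses)

row-count-time count-time : ℕ → ℕ → ℕ
row-count-time k m = ticks (%sweeps := & %sweeps ⊕ & %cnt) + (double-time (& %chains) m + double-time (& %vars) k)
count-time k m = ticks (%guesses := lit 1) + (ticks (%sweeps := lit 1) + for-time (& %vars) k (row-count-time k m))

guess-time : ℕ → ℕ → ℕ → ℕ → ℕ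
guess-time k m r l = ticks (%bits := & %guess) + (choose-time k m + (for-time (& %sweeps) (suc (k * r)) (sweep-time k) +
  (ticks (%stk := lit 0) + (eval-time l + ticks when & %stk ⟨ %ans := lit 1 ∣ skip ⟩))))

solve-time : ℕ → ℕ → ℕ → ℕ → ℕ → ℕ
solve-time g k m r l = costᴱ (& %size ⊕ (lit 1 ⊖ & %vars)) +
    (2 + (for-time (& %guesses) g (guess-time k m r l) + ticks skip))

opaque
  double-correct : ∀ e c s → ⟦ e ⟧ᴱ (cells s) ≡ c → Run for %loop₂ from e ⟨ doubleGuesses ⟩ s (double-time e c)
    (λ t → cells t %guesses 0 ≡ cells s %guesses 0 * 2 ^ c)
  double-correct e c s e≡ = run-weaken {Q = λ t → cells t %guesses 0 * 1 ≡ cells s %guesses 0 * 2 ^ c} ≤-refl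
    (λ t _ eq → trans (sym (*-identityʳ _)) eq)
    (run-for c (λ i t → cells t %guesses 0 * 2 ^ i ≡ cells s %guesses 0 * 2 ^ c) e≡ refl
      λ i t _ _ inv → run-block (trans (twice (cells t %guesses 0) (2 ^ i)) inv))
    where
    twice : ∀ a b → (a + a) * b ≡ a * (b + (b + 0))
    twice = solve-∀

  count-correct : ∀ k m r s → cells s %vars 0 ≡ k → cells s %chains 0 ≡ m → cells s %cnt 0 ≡ r →
    Run countGuesses s (count-time k m) (λ t → cells t %guesses 0 ≡ 2 ^ (k * m + k * k) × cells t %sweeps 0 ≡ suc (k * r))
  count-correct k m r s vars≡ chains≡ cnt≡ = run-after (run-after (run-weaken {Q = Counted 0} ≤-refl
    (λ t _ C → subst (λ d → cells t %guesses 0 ≡ 2 ^ (d * m + d * k)) (all C) (Counted.guesses≡ C) ,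
               subst (λ d → cells t %sweeps 0 ≡ suc (d * r)) (all C) (Counted.sweeps≡ C))
    (run-for k Counted vars≡ (record { d = 0 ; d+c≡k = refl ; guesses≡ = refl ; sweeps≡ = refl })
      λ c t _ fr C → run-after (run-seq (double-correct (& %chains) m _ (trans (cong-app (fr %chains) 0) chains≡))
        λ t₂ fr₂ eq₂ → run-weaken ≤-refl (λ t₃ fr₃ eq₃ → record
          { d = suc (Counted.d C) ; d+c≡k = next-round _ (Counted.d+c≡k C)
          ; guesses≡ = trans eq₃ (trans (cong (_* 2 ^ k) (trans eq₂ (cong (_* 2 ^ m) (Counted.guesses≡ C))))
              (powers (Counted.d C)))
          ; sweeps≡ = trans (cong-app (trans (fr₃ %sweeps) (fr₂ %sweeps)) 0)
              (trans (cong₂ _+_ (Counted.sweeps≡ C) (trans (cong-app (fr %cnt) 0) cnt≡))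
                        (cong suc (+-comm (Counted.d C * r) r))) })
          (double-correct (& %vars) k t₂ (trans (cong-app (trans (fr₂ %vars) (fr %vars)) 0) vars≡))))))
    where
    record Counted (c : ℕ) (t : Config) : Set where
      field
        d        : ℕ
        d+c≡k    : d + c ≡ k
        guesses≡ : cells t %guesses 0 ≡ 2 ^ (d * m + d * k)
        sweeps≡  : cells t %sweeps 0 ≡ suc (d * r)
    all : ∀ {t} (C : Counted 0 t) → Counted.d C ≡ k
    all C = trans (sym (+-identityʳ _)) (Counted.d+c≡k C)
    arith : ∀ d m k → d * m + d * k + m + k ≡ suc d * m + suc d * k
    arith = solve-∀
    powers : ∀ d → 2 ^ (d * m + d * k) * 2 ^ m * 2 ^ k ≡ 2 ^ (suc d * m + suc d * k)
    powers d = trans (cong (_* 2 ^ k) (sym (^-distribˡ-+-* 2 (d * m + d * k) m)))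
      (trans (sym (^-distribˡ-+-* 2 (d * m + d * k + m) k)) (cong (2 ^_) (arith d m k)))

  node-cong : ∀ {σ τ} → τ %op ≡ σ %op → τ %sgn ≡ σ %sgn → τ %lhs ≡ σ %lhs → τ %rhs ≡ σ %rhs → ∀ j → node τ j ≡ node σ j
  node-cong op sgn lhs rhs j = quad (cong (λ f → f j) op) (cong (λ f → f j) sgn) (cong (λ f → f j) lhs)
      (cong (λ f → f j) rhs)

  bitOf-does : ∀ {A B : Set} (d : Dec A) (e : Dec B) → bitOf d ≡ bitOf e → does d ≡ does e
  bitOf-does (yes _) (yes _) _ = refl
  bitOf-does (no _)  (no _)  _ = refl

module Solving {n w} (P : FinPoset n) {le : ℕ → ℕ → ℕ} (le≡ : ∀ i j → le (toℕ i) (toℕ j) ≡ bitOf (FinPoset._⊑?_ P i j))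
  (order : Order n w le (degree le n)) {k} (ψ : Matrix k) {m r : ℕ} {ord colour top lab : ℕ → ℕ}
  (colouring : Colourings.Colouring order (_< n) r m ord colour top lab) where
  open Order order
  open Truth P
  open FinPoset P using (_⊑?_)
  open Colourings.Colouring colouring using (ord<n; position; mono; colour<m)

  Satisfiable : Set
  Satisfiable = ∃[ ρ ] ⟦_⟧ᴹ P ψ ρ

  typeOf : (ℕ → ℕ) → ℕ → ℕ → ℕ
  typeOf sol i j = le (ord (sol i)) (ord (sol j))

  guessBits : (ℕ → ℕ) → List ℕ
  guessBits sol = colourBits (λ v → colour (ord (sol v))) m k ++ typeBits (typeOf sol) k k

  record Coded (g : ℕ) : Set where
    field
      sol   : ℕ → ℕ
      sol<r : ∀ v → v < k → sol v < r
      code≡ : g ≡ number (guessBits sol)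
      ρ     : Vec (Fin n) k
      ρ≡    : ∀ v → toℕ (lookup ρ v) ≡ ord (sol (toℕ v))
      holds : ⟦_⟧ᴹ P ψ ρ

  record Prepared (s : Config) : Set where
    field
      setting : Setting n k m le ord colour (cells s)
      sweeps≡ : cells s %sweeps 0 ≡ suc (k * r)
      len≡    : cells s %len 0 ≡ nodes ψ
      stored  : Stored (cells s) 0 ψ

  -- The first alternative does not mention g, because a guess that codes no solution may still end
  -- at a satisfying assignment.
  Result : ℕ → Config → Config → Set
  Result g s t = (cells t %ans 0 ≡ 1 × Satisfiable) ⊎ (cells t %ans 0 ≡ cells s %ans 0 × ¬ Coded g)

  module _ (0<n : ∀ v → v < k → 0 < n) where

    module Sw (g : ℕ) = Sweeping order k m r ord colour 0<n ord<n mono {Coded g} Coded.sol Coded.sol<r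

    opaque
      guess-correct : ∀ g s → Prepared s → cells s %guess 0 ≡ g →
        Run guessBody s (guess-time k m r (nodes ψ)) (Result g s)
      guess-correct g s R g≡ = run-after (run-seq
        (Guessing.choose-colours {X = Coded g} k (λ x v → colour (ord (Coded.sol x v))) m
            (λ x → typeBits (typeOf (Coded.sol x)) k k) s₁
          (λ x v v<k → <⇒≤ (colour<m _ (Coded.sol<r x v v<k))) (Setting.vars≡ S) (Setting.chains≡ S)
              (λ x → trans g≡ (Coded.code≡ x)))
        λ s₂ fr₂ D → run-seq
          (Sw.sweeps-correct g s₂ (keep {s = s₁} {t = s₂} chooseColours fr₂ S₁)
            (trans (cong-app (fr₂ %sweeps) 0) (Prepared.sweeps≡ R))
            (λ x v v<k → Guessing.Drawn.want≡ (D x) v z≤n v<k) (λ x v v<k → Guessing.Drawn.place≡ (D x) v z≤n v<k)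
            (λ x → Guessing.Drawn.bits≡ (D x)))
          λ s₃ fr₃ clean → run-after (run-seq
            (evaluate-correct (nodes ψ) (perform (%stk := lit 0) s₃) (trans (cong-app (trans (fr₃ %len) (fr₂ %len)) 0)
                (Prepared.len≡ R)))
            λ s₅ fr₅ stk≡ → run-block (finish s₃ s₅ (keep {s = s₂} {t = s₃} for %loop₁ from & %sweeps ⟨ sweep ⟩ fr₃
                (keep {s = s₁} {t = s₂} chooseColours fr₂ S₁))
              (Stored-cong ψ (λ j _ → node-cong {cells s} {cells s₃} (trans (fr₃ %op) (fr₂ %op))
                  (trans (fr₃ %sgn) (fr₂ %sgn)) (trans (fr₃ %lhs) (fr₂ %lhs)) (trans (fr₃ %rhs) (fr₂ %rhs)) j)
                  (Prepared.stored R))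
              clean stk≡ (cong-app (trans (fr₅ %ans) (trans (fr₃ %ans) (fr₂ %ans))) 0))))
        where
        s₁ : Config
        s₁ = perform (%bits := & %guess) s
        S : Setting n k m le ord colour (cells s)
        S = Prepared.setting R
        S₁ : Setting n k m le ord colour (cells s₁)
        S₁ = keep-perform (%bits := & %guess) s S
        finish : ∀ s₃ s₅ → Setting n k m le ord colour (cells s₃) → Stored (cells s₃) 0 ψ →
            (∀ x → Sw.Clean g x (cells s₃ %place)) →
          cells s₅ %stk 0 ≡ pushAll (pushNode (cells (perform (%stk := lit 0) s₃))) 0 (nodes ψ) 0 →
              cells s₅ %ans 0 ≡ cells s %ans 0 →
          Result g s (perform when & %stk ⟨ %ans := lit 1 ∣ skip ⟩ s₅)
        finish s₃ s₅ S₃ st clean stk≡ ans≡ = by-truth (⟦ ψ ⟧ᴹ? ρ) refl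
          where
          -- If the guess codes nothing, the places may have run past the inserted elements. `ord`
          -- yields elements of the poset there as well, so ρ is an assignment in every case.
          value : ∀ v → ord (cells s₃ %place (toℕ {k} v)) < n
          value v = ord<n (0<n (toℕ v) (toℕ<n v)) _
          ρ : Vec (Fin n) k
          ρ = Vec.tabulate λ v → fromℕ< (value v)
          ρ≡ : ∀ v → ord (cells s₃ %place (toℕ v)) ≡ toℕ (lookup ρ v)
          ρ≡ v = sym (trans (cong toℕ (lookup∘tabulate (λ v → fromℕ< (value v)) v)) (toℕ-fromℕ< (value v)))
          bit≡ : cells s₅ %stk 0 ≡ bitOf (⟦ ψ ⟧ᴹ? ρ)
          bit≡ = trans stk≡ (trans (evaluates le≡ ρ (cells (perform (%stk := lit 0) s₃))
              (Setting.poset (keep-perform (%stk := lit 0) s₃ S₃))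
            (λ v → trans (cong (λ f → f (cells s₃ %place (toℕ v))) (Setting.ord≡ S₃)) (ρ≡ v)) ψ 0
                (Stored-cong ψ (λ _ _ → refl) st) 0) (+-identityʳ _))
          -- The ascent need not end at the elements of the coded solution, only at elements of the
          -- same type.
          same : ∀ (x : Coded g) → SameType (Coded.ρ x) ρ
          same x u v = bitOf-does (lookup (Coded.ρ x) u ⊑? lookup (Coded.ρ x) v) (lookup ρ u ⊑? lookup ρ v)
            (trans (sym (le≡ (lookup (Coded.ρ x) u) (lookup (Coded.ρ x) v))) (trans (cong₂ le (Coded.ρ≡ x u) (Coded.ρ≡ x v))
              (trans (sym (proj₂ (proj₂ (clean x (toℕ u) (toℕ v) (toℕ<n u) (toℕ<n v)))))
                  (trans (cong₂ le (ρ≡ u) (ρ≡ v)) (le≡ (lookup ρ u) (lookup ρ v))))))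
          by-truth : (d : Dec (⟦_⟧ᴹ P ψ ρ)) → d ≡ ⟦ ψ ⟧ᴹ? ρ → Result g s (perform when & %stk ⟨ %ans := lit 1 ∣ skip ⟩ s₅)
          by-truth (yes h) eq = choose-suc (Result g s) (trans bit≡ (cong bitOf (sym eq))) (inj₁ (refl , ρ , h))
          by-truth (no ¬h) eq = choose-0 (Result g s) (trans bit≡ (cong bitOf (sym eq)))
            (inj₂ (ans≡ , λ x → ¬h (sameType-matrix ψ {Coded.ρ {g} x} {ρ} (same x) (Coded.holds x))))

  -- A code has m bits per variable for its colour and k bits for its row of the order type.
  encode-solution : Satisfiable → ∃[ g ] g < 2 ^ (k * m + k * k) × Coded g
  encode-solution (ρ , h) = number (guessBits sol) ,
    subst (λ e → number (guessBits sol) < 2 ^ e)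
      (trans (length-++ (colourBits (λ v → colour (ord (sol v))) m k))
          (cong₂ _+_ (length-colourBits _ m k) (length-typeBits (typeOf sol) k k)))
      (number< (guessBits sol) (All-++ (colourBits≤1 _ m k) (typeBits≤1 (typeOf sol) k k λ i j i<k j<k →
        [ (λ z → ≤-trans (≤-reflexive z) z≤n) , ≤-reflexive ]′ (bit (sol-n i i<k) (sol-n j j<k))))) ,
    record { sol = sol ; sol<r = sol<r ; code≡ = refl ; ρ = ρ ; ρ≡ = ρ≡ ; holds = h }
    where
    at : ∀ v → Dec (v < k) → ℕ
    at v (yes v<k) = proj₁ (position _ (toℕ<n (lookup ρ (fromℕ< v<k))))
    at v (no _)    = 0
    sol : ℕ → ℕ
    sol v = at v (v <? k)
    sol<r : ∀ v → v < k → sol v < r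
    sol<r v v<k with v <? k
    ... | yes v<k′ = proj₁ (proj₂ (position _ (toℕ<n (lookup ρ (fromℕ< v<k′)))))
    ... | no v≮k   = contradiction v<k v≮k
    sol-n : ∀ v → v < k → ord (sol v) < n
    sol-n v v<k with v <? k
    ... | yes v<k′ = subst (_< n) (sym (proj₂ (proj₂ (position _ (toℕ<n (lookup ρ (fromℕ< v<k′)))))))
        (toℕ<n (lookup ρ (fromℕ< v<k′)))
    ... | no v≮k   = contradiction v<k v≮k
    ρ≡ : ∀ v → toℕ (lookup ρ v) ≡ ord (sol (toℕ v))
    ρ≡ v with toℕ v <? k
    ... | yes v<k = trans (cong (λ u → toℕ (lookup ρ u)) (sym (fromℕ<-toℕ v v<k)))
        (sym (proj₂ (proj₂ (position _ (toℕ<n (lookup ρ (fromℕ< v<k)))))))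
    ... | no v≮k  = contradiction (toℕ<n v) v≮k

  Answered : Config → Set
  Answered t = (cells t %ans 0 ≡ 1 × Satisfiable) ⊎ (cells t %ans 0 ≡ 0 × ¬ Satisfiable)

  opaque
    solve-correct : ∀ s → Prepared s → cells s %guesses 0 ≡ 2 ^ (k * m + k * k) → cells s %ans 0 ≡ 0 →
      Run solve s (solve-time (2 ^ (k * m + k * k)) k m r (nodes ψ)) Answered
    solve-correct s R guesses≡ ans≡ = run-when
      (λ c eq → run-weaken {Q = Searched 0} ≤-refl
        (λ t _ → [ inj₁ {B = cells t %ans 0 ≡ 0 × ¬ Satisfiable} ,
            (λ { (z , none) → inj₂ (z , λ sat → let g , g< , c = encode-solution sat in none g z≤n g< c) }) ]′)
        (run-for G Searched guesses≡ (inj₂ (ans≡ , λ g G≤g g<G → contradiction g<G (≤⇒≯ G≤g)))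
          λ i t i<G fr inv → run-weaken ≤-refl (λ t₂ _ → merge {i} {t} {t₂} inv i<G)
            (guess-correct (nonempty c eq) i (t at %guess ≔ i) (ready t fr i) refl)))
      (λ eq → run-block (inj₂ (ans≡ , λ { (ρ , _) → no-assignment eq ρ })))
      where
      G : ℕ
      G = 2 ^ (k * m + k * k)
      Searched : ℕ → Config → Set
      Searched i t = (cells t %ans 0 ≡ 1 × Satisfiable) ⊎ (cells t %ans 0 ≡ 0 × (∀ g → i ≤ g → g < G → ¬ Coded g))
      merge : ∀ {i t t₂} → Searched (suc i) t → i < G → Result i (t at %guess ≔ i) t₂ → Searched i t₂
      merge _ _ (inj₁ found) = inj₁ found
      merge (inj₁ (o , sat)) _ (inj₂ (a , _)) = inj₁ (trans a o , sat)
      merge {i} (inj₂ (z , none)) _ (inj₂ (a , ¬c)) = inj₂ (trans a z , λ g i≤g g<G →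
        [ (λ i<g → none g i<g g<G) , (λ { refl → ¬c }) ]′ (m≤n⇒m<n∨m≡n i≤g))
      size≡ : cells s %size 0 ≡ n
      size≡ = HasPoset.size≡ (Setting.poset (Prepared.setting R))
      vars≡ : cells s %vars 0 ≡ k
      vars≡ = Setting.vars≡ (Prepared.setting R)
      nonempty : ∀ c → cells s %size 0 + (1 ∸ cells s %vars 0) ≡ suc c → ∀ v → v < k → 0 < n
      nonempty c eq v v<k = n≢0⇒n>0 λ n≡0 → contradiction
        (trans (sym eq) (cong₂ (λ a b → a + (1 ∸ b)) (trans size≡ n≡0) vars≡))
        (λ e → contradiction (trans e (m≤n⇒m∸n≡0 (≤-trans (s≤s z≤n) v<k))) λ ())
      no-assignment : cells s %size 0 + (1 ∸ cells s %vars 0) ≡ 0 → Vec (Fin n) k → ⊥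
      no-assignment eq = no-vector (trans (sym size≡) (m+n≡0⇒m≡0 (cells s %size 0) eq))
          (subst (λ z → 1 ∸ z ≡ 0) vars≡ (m+n≡0⇒n≡0 (cells s %size 0) eq))
        where
        no-vector : ∀ {n k} → n ≡ 0 → 1 ∸ k ≡ 0 → Vec (Fin n) k → ⊥
        no-vector refl _ (() Vec.∷ _)
      ready : ∀ t → Frame for %guess from & %guesses ⟨ guessBody ⟩ s t → ∀ i → Prepared (t at %guess ≔ i)
      ready t fr i = record
        { setting = keep-perform (%guess := lit i) t (keep {s = s} {t = t} for %guess from & %guesses ⟨ guessBody ⟩ fr
            (Prepared.setting R))
        ; sweeps≡ = trans (cong-app (fr %sweeps) 0) (Prepared.sweeps≡ R)
        ; len≡    = trans (cong-app (fr %len) 0) (Prepared.len≡ R)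
        ; stored  = Stored-cong ψ (λ j _ → node-cong {cells s} {cells t} (fr %op) (fr %sgn) (fr %lhs) (fr %rhs) j)
            (Prepared.stored R) }

-- The input poset as a function on numbers

bitOf-1 : ∀ {A : Set} (d : Dec A) → A → bitOf d ≡ 1
bitOf-1 (yes _) _ = refl
bitOf-1 (no ¬a) a = contradiction a ¬a

bitOf-1⁻¹ : ∀ {A : Set} (d : Dec A) → bitOf d ≡ 1 → A
bitOf-1⁻¹ (yes a) _ = a

bitOf-0⁻¹ : ∀ {A : Set} (d : Dec A) → bitOf d ≡ 0 → ¬ A
bitOf-0⁻¹ (no ¬a) _ = ¬a

bitOf-cases : ∀ {A : Set} (d : Dec A) → bitOf d ≡ 0 ⊎ bitOf d ≡ 1
bitOf-cases (yes _) = inj₂ refl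
bitOf-cases (no _)  = inj₁ refl

opaque
  sumTo-strict : ∀ n f g i → i < n → (∀ j → j < n → f j ≤ g j) → f i < g i → sumTo n f < sumTo n g
  sumTo-strict (suc n) f g i i<1+n f≤g fi<gi with ≤-suc-split i<1+n
  ... | inj₁ i<n  = +-mono-<-≤ (sumTo-strict n f g i i<n (λ j j<n → f≤g j (m<n⇒m<1+n j<n)) fi<gi) (f≤g n ≤-refl)
  ... | inj₂ refl = +-mono-≤-< (sumTo-mono n f g λ j j<n → f≤g j (m<n⇒m<1+n j<n)) fi<gi

module Numbered {n} (P : FinPoset n) where
  open FinPoset P
  open IsDecPartialOrder isDecPartialOrder using (reflexive; antisym) renaming (trans to ⊑-trans)

  entry : ∀ {x y} → Dec (x < n) → Dec (y < n) → ℕ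
  entry (yes x<n) (yes y<n) = bitOf (fromℕ< x<n ⊑? fromℕ< y<n)
  entry _         _         = 0

  le : ℕ → ℕ → ℕ
  le x y = entry (x <? n) (y <? n)

  opaque
    le≡ : ∀ i j → le (toℕ i) (toℕ j) ≡ bitOf (i ⊑? j)
    le≡ i j with toℕ i <? n | toℕ j <? n
    ... | yes i<n | yes j<n = cong₂ (λ a b → bitOf (a ⊑? b)) (fromℕ<-toℕ i i<n) (fromℕ<-toℕ j j<n)
    ... | no i≮n  | _       = contradiction (toℕ<n i) i≮n
    ... | yes _   | no j≮n  = contradiction (toℕ<n j) j≮n

    le-fromℕ< : ∀ {x y} (x<n : x < n) (y<n : y < n) → le x y ≡ bitOf (fromℕ< x<n ⊑? fromℕ< y<n)
    le-fromℕ< x<n y<n = trans (sym (cong₂ le (toℕ-fromℕ< x<n) (toℕ-fromℕ< y<n))) (le≡ _ _)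

    le⇒⊑ : ∀ {x y} (x<n : x < n) (y<n : y < n) → le x y ≡ 1 → fromℕ< x<n ⊑ fromℕ< y<n
    le⇒⊑ x<n y<n eq = bitOf-1⁻¹ (_ ⊑? _) (trans (sym (le-fromℕ< x<n y<n)) eq)

    ⊑⇒le : ∀ {x y} (x<n : x < n) (y<n : y < n) → fromℕ< x<n ⊑ fromℕ< y<n → le x y ≡ 1
    ⊑⇒le x<n y<n h = trans (le-fromℕ< x<n y<n) (bitOf-1 (_ ⊑? _) h)

    le-cases : ∀ {x y} → x < n → y < n → le x y ≡ 0 ⊎ le x y ≡ 1
    le-cases x<n y<n = subst (λ z → z ≡ 0 ⊎ z ≡ 1) (sym (le-fromℕ< x<n y<n)) (bitOf-cases (_ ⊑? _))

    le≤1 : ∀ {x y} → x < n → y < n → le x y ≤ 1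
    le≤1 x<n y<n = [ (λ z → ≤-trans (≤-reflexive z) z≤n) , ≤-reflexive ]′ (le-cases x<n y<n)

    le-transitive : ∀ {x y z} → x < n → y < n → z < n → le x y ≡ 1 → le y z ≡ 1 → le x z ≡ 1
    le-transitive x<n y<n z<n xy yz = ⊑⇒le x<n z<n (⊑-trans (le⇒⊑ x<n y<n xy) (le⇒⊑ y<n z<n yz))

    -- By transitivity whatever is below x is below y, and y itself is below y but not below x.
    le-strict : ∀ {x y} → x < n → y < n → le x y ≡ 1 → x ≢ y → degree le n x < degree le n y
    le-strict {x} {y} x<n y<n xy x≢y = sumTo-strict n (λ i → le i x) (λ i → le i y) y y<n
      (λ i i<n → [ (λ z → ≤-trans (≤-reflexive z) z≤n) ,
          (λ o → ≤-trans (≤-reflexive o) (≤-reflexive (sym (le-transitive i<n x<n y<n o xy)))) ]′ (le-cases i<n x<n))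
      (subst₂ _<_ (sym yx≡0) (sym (⊑⇒le y<n y<n (reflexive refl))) ≤-refl)
      where
      yx≡0 : le y x ≡ 0
      yx≡0 with le-cases y<n x<n
      ... | inj₁ z = z
      ... | inj₂ o = contradiction (trans (sym (toℕ-fromℕ< x<n))
          (trans (cong toℕ (antisym (le⇒⊑ x<n y<n xy) (le⇒⊑ y<n x<n o))) (toℕ-fromℕ< y<n))) x≢y

  toSubset : ∀ xs → All (_< n) xs → Subset n
  toSubset []       []         = ∅
  toSubset (x ∷ xs) (x<n ∷ ps) = ⁅ fromℕ< x<n ⁆ ∪ toSubset xs ps

  Unrelated : ℕ → ℕ → Set
  Unrelated x y = le x y ≡ 0 × le y x ≡ 0

  opaque
    ∈-toSubset : ∀ {Q : ℕ → Set} xs ps → All Q xs → ∀ {i} → i ∈ˢ toSubset xs ps → Q (toℕ i)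
    ∈-toSubset []       []         []       i∈ = contradiction i∈ ∉⊥
    ∈-toSubset {Q} (x ∷ xs) (x<n ∷ ps) (q ∷ qs) i∈ with x∈p∪q⁻ ⁅ fromℕ< x<n ⁆ (toSubset xs ps) i∈
    ... | inj₁ i∈x = subst Q (sym (trans (cong toℕ (x∈⁅y⁆⇒x≡y _ i∈x)) (toℕ-fromℕ< x<n))) q
    ... | inj₂ i∈s = ∈-toSubset xs ps qs i∈s

    unrelated⇒incomparable : ∀ i j → Unrelated (toℕ i) (toℕ j) → ¬ (i ⊑ j) × ¬ (j ⊑ i)
    unrelated⇒incomparable i j (ij , ji) = bitOf-0⁻¹ (i ⊑? j) (trans (sym (le≡ i j)) ij) ,
        bitOf-0⁻¹ (j ⊑? i) (trans (sym (le≡ j i)) ji)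

    toSubset-antichain : ∀ xs ps → AllPairs Unrelated xs → Antichain P (toSubset xs ps)
    toSubset-antichain []       []         []         i∈ = contradiction i∈ ∉⊥
    toSubset-antichain (x ∷ xs) (x<n ∷ ps) (us ∷ ap) {i} {j} i∈ j∈ i≢j
      with x∈p∪q⁻ ⁅ fromℕ< x<n ⁆ (toSubset xs ps) i∈ | x∈p∪q⁻ ⁅ fromℕ< x<n ⁆ (toSubset xs ps) j∈
    ... | inj₁ i≡x | inj₁ j≡x = contradiction (trans (x∈⁅y⁆⇒x≡y _ i≡x) (sym (x∈⁅y⁆⇒x≡y _ j≡x))) i≢j
    ... | inj₂ i∈s | inj₂ j∈s = toSubset-antichain xs ps ap i∈s j∈s i≢j
    ... | inj₁ i≡x | inj₂ j∈s = unrelated⇒incomparable i j (subst (λ z → Unrelated z (toℕ j))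
            (sym (trans (cong toℕ (x∈⁅y⁆⇒x≡y _ i≡x)) (toℕ-fromℕ< x<n))) (∈-toSubset xs ps us j∈s))
    ... | inj₂ i∈s | inj₁ j≡x with a , b ← unrelated⇒incomparable j i (subst (λ z → Unrelated z (toℕ i))
            (sym (trans (cong toℕ (x∈⁅y⁆⇒x≡y _ j≡x)) (toℕ-fromℕ< x<n))) (∈-toSubset xs ps us i∈s)) = b , a

    -- A list of pairwise unrelated elements has no repetitions, since by reflexivity no element is
    -- unrelated to itself. Each entry therefore enlarges the subset.
    length≤∣toSubset∣ : ∀ xs ps → AllPairs Unrelated xs → length xs ≤ ∣ toSubset xs ps ∣
    length≤∣toSubset∣ []       []         []        = z≤n
    length≤∣toSubset∣ (x ∷ xs) (x<n ∷ ps) (us ∷ ap) = ≤-trans (s≤s (length≤∣toSubset∣ xs ps ap))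
      (p⊂q⇒∣p∣<∣q∣ (q⊆p∪q _ _ , fromℕ< x<n , x∈p∪q⁺ (inj₁ (x∈⁅x⁆ _)) ,
        λ x∈ → contradiction (trans (sym (⊑⇒le x<n x<n (reflexive refl)))
                 (subst (λ z → le x z ≡ 0) (toℕ-fromℕ< x<n) (proj₁ (∈-toSubset xs ps us x∈)))) λ ()))

    order : ∀ {w} → HasWidth P w → Order n w le (degree le n)
    order (_ , maximal) = record
      { bit       = le-cases
      ; le-refl   = λ x<n → ⊑⇒le x<n x<n (reflexive refl)
      ; le-trans  = le-transitive
      ; strict    = le-strict
      ; dg≤n      = λ {x} x<n → ≤-trans (sumTo-≤ n (λ i → le i x) 1 λ i i<n → le≤1 i<n x<n) (≤-reflexive (*-identityʳ n))
      ; antichain = λ xs ps ap → ≤-trans (length≤∣toSubset∣ xs ps ap)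
          (maximal (toSubset xs ps) (toSubset-antichain xs ps ap)) }

    map-segment : ∀ {c} (f : Fin n → ℕ) F i (g : Fin c → Fin n) → (∀ j → toℕ (g j) ≡ i + toℕ j) → (∀ j → f j ≡ F (toℕ j)) →
                  map f (tabulate g) ≡ segment F i c
    map-segment {zero}  f F i g g≡ f≡ = refl
    map-segment {suc c} f F i g g≡ f≡ = cong₂ _∷_ (trans (f≡ (g Fin.zero)) (cong F (trans (g≡ Fin.zero) (+-identityʳ i))))
      (map-segment f F (suc i) (λ j → g (Fin.suc j)) (λ j → trans (g≡ (Fin.suc j)) (+-suc i (toℕ j))) f≡)

    concatMap-rows : ∀ {c} (h : Fin n → List ℕ) i (g : Fin c → Fin n) → (∀ j → toℕ (g j) ≡ i + toℕ j) →
                     (∀ j → h j ≡ segment (le (toℕ j)) 0 n) → concatMap h (tabulate g) ≡ rows le n i c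
    concatMap-rows {zero}  h i g g≡ h≡ = refl
    concatMap-rows {suc c} h i g g≡ h≡ = cong₂ _++_
      (trans (h≡ (g Fin.zero)) (cong (λ z → segment (le z) 0 n) (trans (g≡ Fin.zero) (+-identityʳ i))))
      (concatMap-rows h (suc i) (λ j → g (Fin.suc j)) (λ j → trans (g≡ (Fin.suc j)) (+-suc i (toℕ j))) h≡)

    codePoset≡ : codePoset P ≡ n ∷ rows le n 0 n
    codePoset≡ = cong (n ∷_) (concatMap-rows _ 0 (λ i → i) (λ _ → refl)
      λ i → map-segment _ (le (toℕ i)) 0 (λ j → j) (λ _ → refl) λ j → sym (le≡ i j))

-- Bounding the running time

-- Running times as polynomials in the parameters, the number n of elements (size)
-- and the number of inserted elements (rank), for which (n + 1) n is good enough.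
data Poly : Set where
  con       : ℕ → Poly
  par       : ℕ → Poly
  size rank : Poly
  _⊞_ _⊠_   : Poly → Poly → Poly

infixl 6 _⊞_
infixl 7 _⊠_

-- For any X ≥ 2 above all parameters, this is the power of X that suffices: a constant c is at most
-- 2 to the power c, and the factor 2 in front of the larger summand of a sum costs one more X.
exponent : Poly → ℕ
exponent (con c) = c
exponent (par _) = 1
exponent size    = 0
exponent rank    = 0
exponent (p ⊞ q) = suc (exponent p + exponent q)
exponent (p ⊠ q) = exponent p + exponent q

order-in-n : Poly → ℕ
order-in-n (con _) = 0
order-in-n (par _) = 0
order-in-n size    = 1
order-in-n rank    = 2
order-in-n (p ⊞ q) = order-in-n p ⊔ order-in-n q
order-in-n (p ⊠ q) = order-in-n p + order-in-n q

module _ (n r : ℕ) (value : ℕ → ℕ) where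

  ⟦_⟧ᴾ : Poly → ℕ
  ⟦ con c ⟧ᴾ = c
  ⟦ par i ⟧ᴾ = value i
  ⟦ size ⟧ᴾ  = n
  ⟦ rank ⟧ᴾ  = r
  ⟦ p ⊞ q ⟧ᴾ = ⟦ p ⟧ᴾ + ⟦ q ⟧ᴾ
  ⟦ p ⊠ q ⟧ᴾ = ⟦ p ⟧ᴾ * ⟦ q ⟧ᴾ

  opaque
    n<2^n : ∀ n → n < 2 ^ n
    n<2^n zero    = s≤s z≤n
    n<2^n (suc n) = ≤-trans (≤-reflexive (+-comm 1 (suc n))) (+-mono-≤ (n<2^n n) (≤-trans (m^n>0 2 n) (m≤m+n _ 0)))

    bounded : ∀ X → 2 ≤ X → (∀ i → value i ≤ X) → r ≤ suc n * n →
              ∀ p → ⟦ p ⟧ᴾ ≤ X ^ exponent p * suc n ^ order-in-n p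
    bounded X 2≤X par≤ r≤ (con c) = ≤-trans (≤-trans (<⇒≤ (n<2^n c)) (^-monoˡ-≤ c 2≤X)) (≤-reflexive (sym (*-identityʳ _)))
    bounded X 2≤X par≤ r≤ (par i) = ≤-trans (par≤ i) (≤-reflexive (sym (trans (*-identityʳ _) (*-identityʳ X))))
    bounded X 2≤X par≤ r≤ size    = ≤-trans (n≤1+n n) (≤-reflexive (sym (trans (+-identityʳ _) (*-identityʳ (suc n)))))
    bounded X 2≤X par≤ r≤ rank    = ≤-trans r≤ (≤-trans (*-monoʳ-≤ (suc n) (n≤1+n n))
      (≤-reflexive (sym (trans (+-identityʳ _) (cong (suc n *_) (*-identityʳ (suc n)))))))
    bounded X@(suc _) 2≤X par≤ r≤ (p ⊞ q) = ≤-trans (+-mono-≤ (weaken p (m≤m+n (exponent p) _) (m≤m⊔n _ (order-in-n q)))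
                                                      (weaken q (m≤n+m _ (exponent p)) (m≤n⊔m (order-in-n p) _)))
      (≤-trans (≤-reflexive (cong (M +_) (sym (+-identityʳ M))))
      (≤-trans (*-monoˡ-≤ M 2≤X) (≤-reflexive (sym (*-assoc X (X ^ (exponent p + exponent q)) _)))))
      where
      M : ℕ
      M = X ^ (exponent p + exponent q) * suc n ^ (order-in-n p ⊔ order-in-n q)
      weaken : ∀ p {i d} → exponent p ≤ i → order-in-n p ≤ d → ⟦ p ⟧ᴾ ≤ X ^ i * suc n ^ d
      weaken p i≤ d≤ = ≤-trans (bounded X 2≤X par≤ r≤ p) (*-mono-≤ (^-monoʳ-≤ X i≤) (^-monoʳ-≤ (suc n) d≤))
    bounded X 2≤X par≤ r≤ (p ⊠ q) = ≤-trans (*-mono-≤ (bounded X 2≤X par≤ r≤ p) (bounded X 2≤X par≤ r≤ q))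
      (≤-reflexive (trans (interchange (X ^ exponent p) (suc n ^ order-in-n p) (X ^ exponent q) (suc n ^ order-in-n q))
        (sym (cong₂ _*_ (^-distribˡ-+-* X (exponent p) (exponent q))
            (^-distribˡ-+-* (suc n) (order-in-n p) (order-in-n q))))))
      where
      interchange : ∀ a b c d → a * b * (c * d) ≡ a * c * (b * d)
      interchange = solve-∀

modelCheck : Cmd
modelCheck = parse ⨾ readPoset ⨾ insertAll ⨾ countGuesses ⨾ solve

-- Here l is the length of the code, k the number of variables, m of chains, r of insertions, N of
-- nodes of the matrix and g of guesses.
total-time : (n w l k m r N g : ℕ) → ℕ
total-time n w l k m r N g = parse-time l + (poset-time n + (insertAll-time n w + (count-time k m + solve-time g k m r N)))

for-poly : Expr → Poly → Poly → Poly
for-poly e n B = con (10 + costᴱ e) ⊞ (n ⊠ (con 34 ⊞ B) ⊞ con 11)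

value : (w l k m N g : ℕ) → ℕ → ℕ
value w l k m N g 0 = l
value w l k m N g 1 = w
value w l k m N g 2 = k
value w l k m N g 3 = m
value w l k m N g 4 = N
value w l k m N g 5 = g
value w l k m N g 6 = maxChains w
value w l k m N g _ = 0

insert-poly insertAll-poly count-poly guess-poly total-poly : Poly
insert-poly = con (ticks startInsert) ⊞ (par 1 ⊠ (con 12 ⊞ (con 2 ⊞ (con (ticks (%members := lit 0)) ⊞
  (for-poly (& %chains) (par 6) (con (ticks scanChain)) ⊞ con (ticks decide))))) ⊞ con 13 ⊞
  (con (ticks (%chosen := & %found ⊖ lit 1)) ⊞ (for-poly (& %chains) (par 6) (con (ticks relabelChain)) ⊞ con
      (ticks finishInsert))))
insertAll-poly = for-poly (& %size ⊕ lit 1) (con 1 ⊞ size) (con (1 + (8 + (1 + 1))) ⊞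
  (for-poly (& %size) size (con (costᴱ (differs (%deg ! & %ξ) (& %level))) ⊞ (con 2 ⊞ insert-poly) ⊞ con
      (ticks (increment %ξ))) ⊞ con (ticks (increment %level))))
count-poly = con (ticks (%guesses := lit 1)) ⊞ (con (ticks (%sweeps := lit 1)) ⊞ for-poly (& %vars) (par 2)
  (con (ticks (%sweeps := & %sweeps ⊕ & %cnt)) ⊞ (for-poly (& %chains) (par 3) (con (ticks doubleGuesses)) ⊞ for-poly
      (& %vars) (par 2) (con (ticks doubleGuesses)))))
guess-poly = con (ticks (%bits := & %guess)) ⊞
    (for-poly (& %vars) (par 2) (con (ticks startColour) ⊞ for-poly (& %chains) (par 3) (con (ticks drawColour))) ⊞
  (for-poly (& %sweeps) (con 1 ⊞ par 2 ⊠ rank) (con (ticks (%queue := & %bits)) ⊞ for-poly (& %vars) (par 2)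
      (for-poly (& %vars) (par 2) (con (ticks checkPair)))) ⊞
  (con (ticks (%stk := lit 0)) ⊞ (for-poly (& %len) (par 4) (con (ticks evalNode)) ⊞ con
      (ticks when & %stk ⟨ %ans := lit 1 ∣ skip ⟩)))))
total-poly = con 11 ⊞ (par 0 ⊠ con symbol-time ⊞ con 11) ⊞
  ((con 1 ⊞ for-poly (& %size) size (con (ticks startRow) ⊞ (for-poly (& %size) size (con (ticks readCell)) ⊞ con
      (ticks (increment %ι))))) ⊞
  (insertAll-poly ⊞ (count-poly ⊞ (con (costᴱ (& %size ⊕ (lit 1 ⊖ & %vars))) ⊞
      (con 2 ⊞ (for-poly (& %guesses) (par 5) guess-poly ⊞ con 0))))))

opaque
  -- The polynomial repeats the structure of the running times, so both sides agree by computation.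
  total≡ : ∀ n w l k m r N g → ⟦_⟧ᴾ n r (value w l k m N g) total-poly ≡ total-time n w l k m r N g
  total≡ n w l k m r N g = refl

opaque
  factor : ℕ
  factor = exponent total-poly

  factor≡ : factor ≡ exponent total-poly
  factor≡ = refl

-- The exponent y³ also bounds the number of bits of a guess.
bound : ℕ → ℕ → ℕ
bound a b = 2 ^ (let y = a + b + 2 in y * (y * (y * (factor * 1))))

opaque
  time≤bound : ∀ n w l k m r N → k ≤ l → m ≤ maxChains w → N ≤ l → r ≤ suc n * n →
               total-time n w l k m r N (2 ^ (k * m + k * k)) ≤ bound l w * (suc n * suc n)
  time≤bound n w l k m r N k≤l m≤ N≤l r≤ = ≤-trans (≤-reflexive (sym (total≡ n w l k m r N g)))
    (≤-trans (bounded n r (value w l k m N g) X 2≤X par≤ r≤ total-poly)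
    -- The quadratic dependence on n is checked here: `order-in-n total-poly` evaluates to 2.
    (*-mono-≤ (≤-reflexive power) (≤-reflexive (cong (suc n *_) (*-identityʳ (suc n))))))
    where
    g y X : ℕ
    g = 2 ^ (k * m + k * k)
    -- The summand 2 secures `2≤X`, and y² bounds the number of chains together with l.
    y = l + w + 2
    X = 2 ^ (y * (y * y))
    power : X ^ exponent total-poly ≡ bound l w
    power = trans (cong (X ^_) (sym factor≡)) (trans (^-*-assoc 2 (y * (y * y)) factor) (cong (2 ^_) (arith y factor)))
      where
      arith : ∀ y f → y * (y * y) * f ≡ y * (y * (y * (f * 1)))
      arith = solve-∀
    2≤y : 2 ≤ y
    2≤y = m≤n+m 2 (l + w)
    1≤y : 1 ≤ y
    1≤y = ≤-trans (s≤s z≤n) 2≤y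
    grow : ∀ z → z ≤ y * z
    grow z = ≤-trans (≤-reflexive (sym (*-identityˡ z))) (*-monoˡ-≤ z 1≤y)
    y²≤y³ : y * y ≤ y * (y * y)
    y²≤y³ = grow (y * y)
    y≤y³ : y ≤ y * (y * y)
    y≤y³ = ≤-trans (grow y) y²≤y³
    z≤2^z : ∀ z → z ≤ 2 ^ z
    z≤2^z z = <⇒≤ (n<2^n 0 0 (λ _ → 0) z)
    below-X : ∀ {z} → z ≤ y * (y * y) → z ≤ X
    below-X z≤ = ≤-trans z≤ (z≤2^z _)
    2≤X : 2 ≤ X
    2≤X = below-X (≤-trans 2≤y y≤y³)
    l≤y : l ≤ y
    l≤y = ≤-trans (m≤m+n l w) (m≤m+n _ 2)
    w≤y : w ≤ y
    w≤y = ≤-trans (m≤n+m w l) (m≤m+n _ 2)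
    chains+l≤ : maxChains w + l ≤ y * y
    chains+l≤ = ≤-trans (m≤m+n _ _) (≤-reflexive (arith l w))
      where
      arith : ∀ l w → suc w * w + l + (l * l + l * w + l + w * l + 2 * w + l + l + (w + 4)) ≡ (l + w + 2) * (l + w + 2)
      arith = solve-∀
    guesses≤ : k * m + k * k ≤ y * (y * y)
    guesses≤ = ≤-trans (≤-reflexive (sym (*-distribˡ-+ k m k)))
      (*-mono-≤ (≤-trans k≤l l≤y) (≤-trans (+-mono-≤ m≤ k≤l) chains+l≤))
    par≤ : ∀ i → value w l k m N g i ≤ X
    par≤ 0 = below-X (≤-trans l≤y y≤y³)
    par≤ 1 = below-X (≤-trans w≤y y≤y³)
    par≤ 2 = below-X (≤-trans k≤l (≤-trans l≤y y≤y³))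
    par≤ 3 = below-X (≤-trans m≤ (≤-trans (m≤m+n _ l) (≤-trans chains+l≤ y²≤y³)))
    par≤ 4 = below-X (≤-trans N≤l (≤-trans l≤y y≤y³))
    par≤ 5 = ^-monoʳ-≤ 2 guesses≤
    par≤ 6 = below-X (≤-trans (m≤m+n _ l) (≤-trans chains+l≤ y²≤y³))
    par≤ (suc (suc (suc (suc (suc (suc (suc _))))))) = z≤n

-- Computing the bound

-- Four nested loops double 1 as often as the exponent of `bound` says; that is why the exponent is
-- written as an iterated product ending in `factor * 1`.
computeBound : Cmd
computeBound =
  input %tok ⨾ input %val ⨾ %tok := & %tok ⊕ & %val ⊕ lit 2 ⨾ %ans := lit 1 ⨾
  for %loop₁ from & %tok ⟨ for %loop₂ from & %tok
      ⟨ for %loop₃ from & %tok ⟨ for %loop₄ from lit factor ⟨ %ans := & %ans ⊕ & %ans ⟩ ⟩ ⟩ ⟩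

-- The exponent e counts doublings, and a loop of n rounds around the command multiplies it by n.
-- The clause is stated for all states with the same `%tok`, so that it can be nested.
Multiplies : Cmd → ℕ → ℕ → ℕ → Set
Multiplies c y e B = ∀ s → cells s %tok 0 ≡ y → Run c s B (λ t → cells t %ans 0 ≡ cells s %ans 0 * 2 ^ e)

opaque
  repeat : ∀ {c y e B} v f n → {T (not (writes c v))} → {T (not (writes for v from f ⟨ c ⟩ %tok))} →
           (∀ s → cells s %tok 0 ≡ y → ⟦ f ⟧ᴱ (cells s) ≡ n) → {T (not (toℕ (slot %ans) ≡ᵇ toℕ (slot v)))} →
               {T (not (toℕ (slot %tok) ≡ᵇ toℕ (slot v)))} →
           Multiplies c y e B → Multiplies for v from f ⟨ c ⟩ y (n * e) (for-time f n B)
  repeat {c} {y} {e} {B} v f n {v∉c} {tok∉} f≡ {ans≢v} {tok≢v} mul s tok≡ =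
      run-weaken ≤-refl (λ t _ eq → trans (sym (*-identityʳ _)) eq)
    (run-for n (λ i t → cells t %ans 0 * 2 ^ (i * e) ≡ cells s %ans 0 * 2 ^ (n * e)) {v∉c} (f≡ s tok≡)
      (cong (λ z → z * 2 ^ (n * e)) (same s n))
      λ i t _ fr inv → run-weaken ≤-refl (λ t₂ _ eq → trans (cong (_* 2 ^ (i * e)) (trans eq (cong (_* 2 ^ e) (same t i))))
          (trans (trans (*-assoc (cells t %ans 0) (2 ^ e) _) (cong (cells t %ans 0 *_) (sym (^-distribˡ-+-* 2 e (i * e)))))
              inv))
        (mul (t at v ≔ i) (trans (cong (λ g → g 0) (unwritten (cells t) v 0 i %tok tok≢v))
            (trans (cong (λ g → g 0) (fr %tok {tok∉})) tok≡))))
    where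
    same : ∀ t i → cells (t at v ≔ i) %ans 0 ≡ cells t %ans 0
    same t i = cong (λ g → g 0) (unwritten (cells t) v 0 i %ans ans≢v)

  run-computeBound : ∀ a b → ∃[ B ] Run computeBound (blank (a ∷ b ∷ [])) B (λ t → cells t %ans 0 ≡ bound a b)
  run-computeBound a b = _ , run-after (run-after (run-after (run-after
    (run-weaken ≤-refl (λ t _ eq → trans eq (*-identityˡ _))
      (repeat {y = y} {e = y * (y * (factor * 1))} %loop₁ (& %tok) y (λ _ eq → eq)
        (repeat {e = y * (factor * 1)} %loop₂ (& %tok) y (λ _ eq → eq)
          (repeat {e = factor * 1} %loop₃ (& %tok) y (λ _ eq → eq)
            (repeat {e = 1} %loop₄ (lit factor) factor (λ _ _ → refl)
              (λ s _ → run-block (double-ans (cells s %ans 0)))))) _ refl)))))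
    where
    y : ℕ
    y = a + b + 2
    double-ans : ∀ z → z + z ≡ z * 2
    double-ans = solve-∀

  computeBound-correct : ∀ a b → ∃[ t ] Outputs (compile 0 computeBound) (a ∷ b ∷ []) t (bound a b)
  computeBound-correct a b with _ , ran {s} {t} r _ eq ← run-computeBound a b =
    t , subst (Outputs (compile 0 computeBound) (a ∷ b ∷ []) t) eq (compile-outputs {computeBound} {a ∷ b ∷ []} r)

-- The complete algorithm and the theorem

variables≤code : ∀ {j} (φ : ∃Formula j) → variables φ ≤ j + length (code φ)
variables≤code {j} (matrix ψ) = m≤m+n j _
variables≤code {j} (ex φ)     = ≤-trans (variables≤code φ) (≤-reflexive (sym (+-suc j _)))

nodes≤codeᴹ : ∀ {j} (ψ : Matrix j) → nodes ψ ≤ length (codeᴹ ψ)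
nodes≤codeᴹ (pos (_ ≐ _)) = s≤s z≤n
nodes≤codeᴹ (pos (_ ≼ _)) = s≤s z≤n
nodes≤codeᴹ (neg (_ ≐ _)) = s≤s z≤n
nodes≤codeᴹ (neg (_ ≼ _)) = s≤s z≤n
nodes≤codeᴹ (ψ ∧′ χ) = s≤s (≤-trans (+-mono-≤ (nodes≤codeᴹ ψ) (nodes≤codeᴹ χ)) (≤-reflexive (sym (length-++ (codeᴹ ψ)))))
nodes≤codeᴹ (ψ ∨′ χ) = s≤s (≤-trans (+-mono-≤ (nodes≤codeᴹ ψ) (nodes≤codeᴹ χ)) (≤-reflexive (sym (length-++ (codeᴹ ψ)))))

nodes≤code : ∀ {j} (φ : ∃Formula j) → nodes (matrixOf φ) ≤ length (code φ)
nodes≤code (matrix ψ) = nodes≤codeᴹ ψ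
nodes≤code (ex φ)     = m≤n⇒m≤1+n (nodes≤code φ)

module Correctness {n} (P : FinPoset n) {w} (hasWidth : HasWidth P w) (φ : ∃Sentence) where
  open Numbered P
  ord : Order n w le (degree le n)
  ord = order hasWidth
  open Inserting ord

  Answer : Config → Set
  Answer t = (cells t %ans 0 ≡ 1 × P ⊨ φ) ⊎ (cells t %ans 0 ≡ 0 × ¬ (P ⊨ φ))

  opaque
    sentence : (∃[ ρ ] ⟦_⟧ᴹ P (matrixOf φ) ρ) → P ⊨ φ
    sentence sat with Vec.[] , h ← matrix⇒sat P φ sat = h
    -- Before any insertion `ord` is 0 everywhere, and 0 is an element as soon as n is positive; all
    -- other conditions are vacuous or count nothing.
    empty : ∀ s → cells s %cnt 0 ≡ 0 → cells s %chains 0 ≡ 0 → (∀ p → cells s %ord p ≡ 0) → ColouringAt (Earlier 0 0) s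
    empty s cnt≡ chains≡ ord≡ = record
      { In<n = λ y → proj₁ ; ord<n = λ 0<n p → subst (_< n) (sym (ord≡ p)) 0<n
      ; ord-In = λ p p< → ⊥-elim (none cnt≡ p<) ; position = λ { y (_ , inj₁ ()) ; y (_ , inj₂ (_ , ())) }
      ; mono = λ p q _ q< → ⊥-elim (none cnt≡ q<) ; colour<m = λ p p< → ⊥-elim (none cnt≡ p<) ; below-top = λ p p< →
          ⊥-elim (none cnt≡ p<)
      ; top-In = λ c c< → ⊥-elim (none chains≡ c<) ; lab≤w = λ c c< → ⊥-elim (none chains≡ c<)
      ; unrelated = λ c d c< → ⊥-elim (none chains≡ c<) ; few = λ i →
          ≤-trans (≤-reflexive (cong (λ m → count (cells s %lab) m i) chains≡)) z≤n }
      where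
      none : ∀ {a b} → a ≡ 0 → b < a → ⊥
      none refl ()

    model-check : Run modelCheck (blank (encode φ P)) (bound ∥ φ ∥ w * (suc n * suc n)) Answer
    model-check with ran {s₁} r₁ b₁ p₁ ← parse-correct φ (codePoset P)
                with ran {s₂} r₂ b₂ p₂ ← read-poset le n s₁ (trans (ParsedSentence.tape≡ p₁) codePoset≡)
                      (cong-app (frame r₁ %ι) 0) (λ j → cong-app (frame r₁ %deg) j)
                with ran {s₃} r₃ b₃ (C , cnt≤) ← insertAll-correct s₂ p₂ (record
                      { level≡ = cong-app (frame (seq r₁ r₂) %level) 0
                      ; ξ≡ = cong-app (frame (seq r₁ r₂) %ξ) 0
                      ; cnt≤ = ≤-reflexive (cong-app (frame (seq r₁ r₂) %cnt) 0)
                      ; colouring = empty s₂ (cong-app (frame (seq r₁ r₂) %cnt) 0)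
                          (cong-app (frame (seq r₁ r₂) %chains) 0)
                          (λ p → cong-app (frame (seq r₁ r₂) %ord) p) })
                with ran {s₄} r₄ b₄ (g≡ , sw≡) ← count-correct (variables φ) (cells s₃ %chains 0) (cells s₃ %cnt 0) s₃
                      (trans (cong-app (frame (seq r₂ r₃) %vars) 0) (ParsedSentence.vars≡ p₁)) refl refl
                with ran r₅ b₅ q ← Solving.solve-correct P le≡ ord (matrixOf φ) C s₄ (record
                      { setting = record
                          { vars≡ = trans (cong-app (frame (seq r₂ (seq r₃ r₄)) %vars) 0) (ParsedSentence.vars≡ p₁)
                          ; chains≡ = cong-app (frame r₄ %chains) 0
                          ; ord≡ = frame r₄ %ord ; colour≡ = frame r₄ %colour
                          ; poset = HasPoset-cong (frame (seq r₃ r₄) %size) (frame (seq r₃ r₄) %mat)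
                                      (frame (seq r₃ r₄) %row) (frame (seq r₃ r₄) %deg) p₂ }
                      ; sweeps≡ = sw≡
                      ; len≡ = trans (cong-app (frame (seq r₂ (seq r₃ r₄)) %len) 0) (ParsedSentence.len≡ p₁)
                      ; stored = Stored-cong (matrixOf φ) (λ j _ → node-cong {cells s₁} {cells s₄}
                          (frame (seq r₂ (seq r₃ r₄)) %op) (frame (seq r₂ (seq r₃ r₄)) %sgn)
                          (frame (seq r₂ (seq r₃ r₄)) %lhs) (frame (seq r₂ (seq r₃ r₄)) %rhs) j)
                          (ParsedSentence.stored p₁) })
                      g≡ (cong-app (frame (seq r₁ (seq r₂ (seq r₃ r₄))) %ans) 0)
        = ran (seq r₁ (seq r₂ (seq r₃ (seq r₄ r₅))))
            (≤-trans (+-mono-≤ b₁ (+-mono-≤ b₂ (+-mono-≤ b₃ (+-mono-≤ b₄ b₅))))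
              (time≤bound n w ∥ φ ∥ (variables φ) (cells s₃ %chains 0) (cells s₃ %cnt 0) (nodes (matrixOf φ))
                  (variables≤code φ)
                (chains≤ (cells s₃ %lab) _ (Colourings.Colouring.lab≤w C) (Colourings.Colouring.few C)) (nodes≤code φ) cnt≤))
            ([ (λ { (o , sat) → inj₁ (o , sentence sat) }) ,
                (λ { (z , unsat) → inj₂ (z , λ h → unsat (sat⇒matrix P φ (Vec.[] , h))) }) ]′ q)

theorem1p1 : Σ[ h ∈ (ℕ → ℕ → ℕ) ] Σ[ g ∈ (ℕ → ℕ) ] Σ[ p ∈ Program ]
    Computable₂ h
    × g ∈O (λ n → n ^ 2)
    × ((n : ℕ) (P : FinPoset n) (w : ℕ) → HasWidth P w →
    (φ : ∃Sentence) →
    DecidesWithin p (encode φ P) (P ⊨ φ) (h ∥ φ ∥ w * g n))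
-- The square is that of n + 1, because the empty poset takes time too; from n = 1 on it is at most
-- 4 n².
theorem1p1 = bound , (λ n → suc n * suc n) , compile 0 modelCheck ,
  (compile 0 computeBound , computeBound-correct) , (4 , 1 , quadratic) , decides
  where
  quadratic : ∀ n → 1 ≤ n → suc n * suc n ≤ 4 * n ^ 2
  quadratic n 1≤n = ≤-trans (*-mono-≤ (+-monoˡ-≤ n 1≤n) (+-monoˡ-≤ n 1≤n)) (≤-reflexive (arith n))
    where
    arith : ∀ n → (n + n) * (n + n) ≡ 4 * (n * (n * 1))
    arith = solve-∀
  decides : (n : ℕ) (P : FinPoset n) (w : ℕ) → HasWidth P w → (φ : ∃Sentence) →
            DecidesWithin (compile 0 modelCheck) (encode φ P) (P ⊨ φ) (bound ∥ φ ∥ w * (suc n * suc n))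
  decides n P w hw φ with ran {s} {t} r b q ← Correctness.model-check P hw φ = t , b ,
    [ (λ { (o , h) → inj₁ (h , subst (Outputs (compile 0 modelCheck) (encode φ P) t) o (compile-outputs r)) })
    , (λ { (z , ¬h) → inj₂ (¬h , subst (Outputs (compile 0 modelCheck) (encode φ P) t) z (compile-outputs r)) }) ]′ q
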